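{- There exists a positive integer $v'$ such that for each integer $v\ge v'$, any graph that is cospectral with the Johnson graph $J(v,3)$ is the intersection graph of some linear $3$-uniform hypergraph.
   Context: All graphs are finite, undirected and simple. Two graphs are cospectral if their adjacency matrices have the same spectrum (as multisets of eigenvalues). For a set $X$ of size $v$ (with $v\ge 6$), the Johnson graph $J(v,3)$ has as vertices the $3$-subsets of $X$, two of them being adjacent iff they intersect in precisely $2$ elements. A hypergraph $H$ is a pair $(X,E)$ with $X$ a finite set (vertices) and $E$ a set of non-empty subsets of $X$ (edges). It is $h$-uniform ($h\ge 2$) if every edge has cardinality $h$; it is linear if every pair of distinct vertices is contained in at most one edge. The intersection graph of $H=(X,E)$ is the graph with vertex set $E$ in which two distinct edges $e,e'\in E$ are adjacent iff $e\cap e'\ne\emptyset$. Graphs are identified up to isomorphism. -}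

module Defs where

open import Level using (0ℓ)
open import Algebra.Bundles using (CommutativeRing)
import Algebra.Properties.Ring as RingProperties
import Algebra.Properties.Semiring.Sum as SemiringSum
import Algebra.Properties.Semiring.Exp as SemiringExp
open import Data.Bool.Base using (Bool; true; false; T; if_then_else_)
import Data.Bool.Properties as Bool
open import Data.Bool.Properties using (T?; T-irrelevant)
open import Data.Fin.Base using (Fin; zero; suc; toℕ; punchIn)
open import Data.Fin.Properties using (+↔⊎)
import Data.Fin.Properties as Fin
open import Data.Fin.Subset using (Subset; _∈_; _∩_; ∣_∣; Nonempty)
open import Data.Fin.Subset.Properties using (∩-comm; ∩-idem; nonempty?)
open import Data.List.Base using (List; foldr)
import Data.List.Relation.Binary.Permutation.Setoid as Permutation
open import Data.Nat.Base as ℕ using (ℕ; zero; suc)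
import Data.Nat.Properties as ℕ
open import Data.Product.Base using (Σ; Σ-syntax; ∃-syntax; _×_; _,_; proj₁; proj₂)
open import Data.Rational.Base as ℚ using (ℚ; 0ℚ; 1ℚ)
import Data.Rational.Properties as ℚ
open import Data.Rational.Solver using (module +-*-Solver)
open import Data.Sum.Base using (_⊎_; inj₁; inj₂)
open import Data.Sum.Function.Propositional using (_⊎-↔_)
open import Data.Vec.Base using ([]; _∷_)
open import Data.Vec.Properties using (≡-dec)
open import Function.Base using (_∘_)
open import Function.Bundles using (_↔_; mk↔ₛ′; _⇔_; Inverse)
open import Function.Properties.Inverse using (↔-sym; ↔-trans)
open import Relation.Binary.Definitions using (Decidable; Symmetric; Irreflexive)
open import Relation.Binary.PropositionalEquality
  using (_≡_; _≢_; refl; sym; trans; cong; cong₂; subst)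
open import Relation.Nullary.Decidable using (yes; no; ⌊_⌋; ¬?; _×-dec_)
open import Relation.Nullary.Negation using (contradiction)
import Relation.Unary as Unary

------------------------------------------------------------------------
-- Real numbers, as Cauchy sequences of rationals

-- ∣ aₘ - bₙ ∣ → 0 as m and n tend to infinity independently.  For a = b
-- this is the Cauchy condition; for Cauchy sequences a and b it says
-- that they have the same limit.
record Close (a b : ℕ → ℚ) : Set where
  constructor mkClose
  field
    near : ∀ ε → 0ℚ ℚ.< ε →
      ∃[ N ] (∀ m n → N ℕ.≤ m → N ℕ.≤ n → ℚ.∣ a m ℚ.- b n ∣ ℚ.< ε)

open Close public

record ℝ : Set where
  constructor mkℝ
  field
    seq    : ℕ → ℚ
    cauchy : Close seq seq

open ℝ public

infix 4 _≈_

record _≈_ (x y : ℝ) : Set where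
  constructor mk≈
  field
    close : Close (seq x) (seq y)

open _≈_ public

private

  open RingProperties ℚ.+-*-ring using (x[y-z]≈xy-xz; [y-z]x≈yx-zx)

  abstract
    quotient : ∀ b ε → 0ℚ ℚ.< b → 0ℚ ℚ.< ε → ∃[ δ ] (0ℚ ℚ.< δ × b ℚ.* δ ≡ ε)
    quotient b ε 0<b 0<ε = ℚ.1/ b ℚ.* ε , 0<δ , b*δ≡ε
      where
      instance
        b-pos : ℚ.Positive b
        b-pos = ℚ.positive 0<b

        b-nonZero : ℚ.NonZero b
        b-nonZero = ℚ.pos⇒nonZero b

        1/b-pos : ℚ.Positive (ℚ.1/ b)
        1/b-pos = ℚ.1/pos⇒pos b

      0<δ : 0ℚ ℚ.< ℚ.1/ b ℚ.* ε
      0<δ = subst (ℚ._< ℚ.1/ b ℚ.* ε) (ℚ.*-zeroʳ (ℚ.1/ b)) (ℚ.*-monoʳ-<-pos (ℚ.1/ b) 0<ε)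

      b*δ≡ε : b ℚ.* (ℚ.1/ b ℚ.* ε) ≡ ε
      b*δ≡ε = trans (sym (ℚ.*-assoc b (ℚ.1/ b) ε))
                (trans (cong (ℚ._* ε) (ℚ.*-inverseʳ b)) (ℚ.*-identityˡ ε))

    0<1 : 0ℚ ℚ.< 1ℚ
    0<1 = ℚ.positive⁻¹ 1ℚ

    half : ∀ ε → 0ℚ ℚ.< ε → ∃[ δ ] (0ℚ ℚ.< δ × δ ℚ.+ δ ≡ ε)
    half ε 0<ε =
      let δ , 0<δ , eq = quotient (1ℚ ℚ.+ 1ℚ) ε (ℚ.positive⁻¹ (1ℚ ℚ.+ 1ℚ)) 0<ε
      in δ , 0<δ , trans (lem δ) eq
      where
      open +-*-Solver
      lem : ∀ δ → δ ℚ.+ δ ≡ (1ℚ ℚ.+ 1ℚ) ℚ.* δ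
      lem = solve 1 (λ δ → δ :+ δ := (con 1ℚ :+ con 1ℚ) :* δ) refl

    ∣p-q∣≡∣q-p∣ : ∀ p q → ℚ.∣ p ℚ.- q ∣ ≡ ℚ.∣ q ℚ.- p ∣
    ∣p-q∣≡∣q-p∣ p q = trans (cong ℚ.∣_∣ (lem p q)) (ℚ.∣-p∣≡∣p∣ (q ℚ.- p))
      where
      open +-*-Solver
      lem : ∀ p q → p ℚ.- q ≡ ℚ.- (q ℚ.- p)
      lem = solve 2 (λ p q → p :- q := :- (q :- p)) refl

    telescope : ∀ p q r → p ℚ.- r ≡ (p ℚ.- q) ℚ.+ (q ℚ.- r)
    telescope = solve 3 (λ p q r → p :- r := (p :- q) :+ (q :- r)) refl
      where open +-*-Solver

    ∣+∣-< : ∀ p q {s δ γ ε} → s ≡ p ℚ.+ q → ℚ.∣ p ∣ ℚ.< δ → ℚ.∣ q ∣ ℚ.< γ → δ ℚ.+ γ ≡ ε → ℚ.∣ s ∣ ℚ.< ε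
    ∣+∣-< p q refl p<δ q<γ refl = ℚ.≤-<-trans (ℚ.∣p+q∣≤∣p∣+∣q∣ p q) (ℚ.+-mono-< p<δ q<γ)

    ≤⊔ˡ : ∀ {M N k} → M ℕ.⊔ N ℕ.≤ k → M ℕ.≤ k
    ≤⊔ˡ {M} {N} = ℕ.≤-trans (ℕ.m≤m⊔n M N)

    ≤⊔ʳ : ∀ M {N k} → M ℕ.⊔ N ℕ.≤ k → N ℕ.≤ k
    ≤⊔ʳ M {N} = ℕ.≤-trans (ℕ.m≤n⊔m M N)

    Close-sym : ∀ {a b} → Close a b → Close b a
    Close-sym {a} {b} a≈b = mkClose λ ε 0<ε →
      let N , close′ = near a≈b ε 0<ε
      in N , λ m n N≤m N≤n →
        subst (ℚ._< ε) (∣p-q∣≡∣q-p∣ (a n) (b m)) (close′ n m N≤n N≤m)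

    Close-trans : ∀ {a b c} → Close a b → Close b c → Close a c
    Close-trans {a} {b} {c} a≈b b≈c = mkClose λ ε 0<ε →
      let δ , 0<δ , δ+δ≡ε = half ε 0<ε
          M , close₁ = near a≈b δ 0<δ
          N , close₂ = near b≈c δ 0<δ
          K = M ℕ.⊔ N
      in K , λ m n K≤m K≤n →
        ∣+∣-< (a m ℚ.- b K) (b K ℚ.- c n) (telescope (a m) (b K) (c n))
          (close₁ m K (≤⊔ˡ K≤m) (ℕ.m≤m⊔n M N))
          (close₂ K n (ℕ.m≤n⊔m M N) (≤⊔ʳ M K≤n)) δ+δ≡ε

    +-close : ∀ {a a′ b b′} → Close a a′ → Close b b′ →
              Close (λ n → a n ℚ.+ b n) (λ n → a′ n ℚ.+ b′ n)
    +-close {a} {a′} {b} {b′} a≈a′ b≈b′ = mkClose λ ε 0<ε →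
      let δ , 0<δ , δ+δ≡ε = half ε 0<ε
          M , close₁ = near a≈a′ δ 0<δ
          N , close₂ = near b≈b′ δ 0<δ
      in M ℕ.⊔ N , λ m n K≤m K≤n →
        ∣+∣-< (a m ℚ.- a′ n) (b m ℚ.- b′ n) (lem (a m) (b m) (a′ n) (b′ n))
          (close₁ m n (≤⊔ˡ K≤m) (≤⊔ˡ K≤n))
          (close₂ m n (≤⊔ʳ M K≤m) (≤⊔ʳ M K≤n)) δ+δ≡ε
      where
      open +-*-Solver
      lem : ∀ p q r s → (p ℚ.+ q) ℚ.- (r ℚ.+ s) ≡ (p ℚ.- r) ℚ.+ (q ℚ.- s)
      lem = solve 4 (λ p q r s → (p :+ q) :- (r :+ s) := (p :- r) :+ (q :- s)) refl

    -‿close : ∀ {a a′} → Close a a′ → Close (λ n → ℚ.- a n) (λ n → ℚ.- a′ n)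
    -‿close {a} {a′} a≈a′ = mkClose λ ε 0<ε →
      let N , close′ = near a≈a′ ε 0<ε
      in N , λ m n N≤m N≤n →
        subst (ℚ._< ε)
          (trans (sym (ℚ.∣-p∣≡∣p∣ (a m ℚ.- a′ n))) (cong ℚ.∣_∣ (ℚ.neg-distrib-+ (a m) (ℚ.- a′ n))))
          (close′ m n N≤m N≤n)

    bounded : ∀ {a b} → Close a b → ∃[ B ] (0ℚ ℚ.< B × ∃[ N ] (∀ n → N ℕ.≤ n → ℚ.∣ a n ∣ ℚ.≤ B))
    bounded {a} {b} a≈b =
      let N , close′ = near a≈b 1ℚ 0<1
      in 1ℚ ℚ.+ ℚ.∣ b N ∣ , ℚ.+-mono-<-≤ 0<1 (ℚ.0≤∣p∣ (b N)) , N , λ n N≤n →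
        subst (λ p → ℚ.∣ p ∣ ℚ.≤ 1ℚ ℚ.+ ℚ.∣ b N ∣) (sym (lem (a n) (b N)))
          (ℚ.≤-trans (ℚ.∣p+q∣≤∣p∣+∣q∣ (a n ℚ.- b N) (b N))
            (ℚ.+-monoˡ-≤ ℚ.∣ b N ∣ (ℚ.<⇒≤ (close′ n N N≤n ℕ.≤-refl))))
      where
      open +-*-Solver
      lem : ∀ p q → p ≡ (p ℚ.- q) ℚ.+ q
      lem = solve 2 (λ p q → p := (p :- q) :+ q) refl

    ∣*∣-mono : ∀ p q {B δ} → 0ℚ ℚ.< B → ℚ.∣ p ∣ ℚ.≤ B → ℚ.∣ q ∣ ℚ.< δ → ℚ.∣ p ℚ.* q ∣ ℚ.< B ℚ.* δ
    ∣*∣-mono p q {B} {δ} 0<B p≤B q<δ = begin-strict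
      ℚ.∣ p ℚ.* q ∣        ≡⟨ ℚ.∣p*q∣≡∣p∣*∣q∣ p q ⟩
      ℚ.∣ p ∣ ℚ.* ℚ.∣ q ∣  ≤⟨ ℚ.*-monoʳ-≤-nonNeg ℚ.∣ q ∣ {{ℚ.nonNegative (ℚ.0≤∣p∣ q)}} p≤B ⟩
      B ℚ.* ℚ.∣ q ∣        <⟨ ℚ.*-monoʳ-<-pos B {{ℚ.positive 0<B}} q<δ ⟩
      B ℚ.* δ              ∎
      where open ℚ.≤-Reasoning

    *-close : ∀ {a a′ b b′} → Close a a′ → Close b b′ →
              Close (λ n → a n ℚ.* b n) (λ n → a′ n ℚ.* b′ n)
    *-close {a} {a′} {b} {b′} a≈a′ b≈b′ = mkClose λ ε 0<ε →
      let B , 0<B , N₁ , a≤B = bounded a≈a′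
          C , 0<C , N₂ , b′≤C = bounded (Close-sym b≈b′)
          η , 0<η , η+η≡ε = half ε 0<ε
          δ , 0<δ , Bδ≡η = quotient B η 0<B 0<η
          γ , 0<γ , Cγ≡η = quotient C η 0<C 0<η
          N₃ , close₃ = near b≈b′ δ 0<δ
          N₄ , close₄ = near a≈a′ γ 0<γ
          K₁ = N₁ ℕ.⊔ N₂
          K₂ = N₃ ℕ.⊔ N₄
      in K₁ ℕ.⊔ K₂ , λ m n K≤m K≤n →
        ∣+∣-< (a m ℚ.* (b m ℚ.- b′ n)) (b′ n ℚ.* (a m ℚ.- a′ n)) (lem (a m) (b m) (a′ n) (b′ n))
          (∣*∣-mono (a m) (b m ℚ.- b′ n) 0<B (a≤B m (≤⊔ˡ (≤⊔ˡ K≤m)))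
             (close₃ m n (≤⊔ˡ (≤⊔ʳ K₁ K≤m)) (≤⊔ˡ (≤⊔ʳ K₁ K≤n))))
          (∣*∣-mono (b′ n) (a m ℚ.- a′ n) 0<C (b′≤C n (≤⊔ʳ N₁ (≤⊔ˡ K≤n)))
             (close₄ m n (≤⊔ʳ N₃ (≤⊔ʳ K₁ K≤m)) (≤⊔ʳ N₃ (≤⊔ʳ K₁ K≤n))))
          (trans (cong₂ ℚ._+_ Bδ≡η Cγ≡η) η+η≡ε)
      where
      lem : ∀ p q r s → (p ℚ.* q) ℚ.- (r ℚ.* s) ≡ (p ℚ.* (q ℚ.- s)) ℚ.+ (s ℚ.* (p ℚ.- r))
      lem p q r s = trans (telescope (p ℚ.* q) (p ℚ.* s) (r ℚ.* s)) (cong₂ ℚ._+_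
        (sym (x[y-z]≈xy-xz p q s))
        (trans (sym ([y-z]x≈yx-zx s p r)) (ℚ.*-comm (p ℚ.- r) s)))

    Close-≗ : ∀ {a b} → Close a a → (∀ n → a n ≡ b n) → Close a b
    Close-≗ {a} a≈a a≗b = mkClose λ ε 0<ε →
      let N , close′ = near a≈a ε 0<ε
      in N , λ m n N≤m N≤n →
        subst (λ q → ℚ.∣ a m ℚ.- q ∣ ℚ.< ε) (a≗b n) (close′ m n N≤m N≤n)

    Close-const : ∀ q → Close (λ _ → q) (λ _ → q)
    Close-const q = mkClose λ ε 0<ε →
      0 , λ _ _ _ _ → subst (ℚ._< ε) (sym (cong ℚ.∣_∣ (ℚ.+-inverseʳ q))) 0<ε

  pointwise : ∀ x y → (∀ n → seq x n ≡ seq y n) → x ≈ y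
  pointwise x y eq = mk≈ (Close-≗ (cauchy x) eq)

fromℚ : ℚ → ℝ
fromℚ q = mkℝ (λ _ → q) (Close-const q)

ℝ-commutativeRing : CommutativeRing 0ℓ 0ℓ
ℝ-commutativeRing = record
  { Carrier = ℝ
  ; _≈_     = _≈_
  ; _+_     = _+_
  ; _*_     = _*_
  ; -_      = -_
  ; 0#      = fromℚ 0ℚ
  ; 1#      = fromℚ 1ℚ
  ; isCommutativeRing = record
    { isRing = record
      { +-isAbelianGroup = record
        { isGroup = record
          { isMonoid = record
            { isSemigroup = record
              { isMagma = record
                { isEquivalence = record
                  { refl  = λ {x} → mk≈ (cauchy x)
                  ; sym   = λ x≈y → mk≈ (Close-sym (close x≈y))
                  ; trans = λ x≈y y≈z → mk≈ (Close-trans (close x≈y) (close y≈z))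
                  }
                ; ∙-cong = λ x≈x′ y≈y′ → mk≈ (+-close (close x≈x′) (close y≈y′))
                }
              ; assoc = λ x y z → pointwise ((x + y) + z) (x + (y + z))
                                    (λ n → ℚ.+-assoc (seq x n) (seq y n) (seq z n))
              }
            ; identity = (λ x → pointwise (fromℚ 0ℚ + x) x (λ n → ℚ.+-identityˡ (seq x n)))
                       , (λ x → pointwise (x + fromℚ 0ℚ) x (λ n → ℚ.+-identityʳ (seq x n)))
            }
          ; inverse = (λ x → pointwise ((- x) + x) (fromℚ 0ℚ) (λ n → ℚ.+-inverseˡ (seq x n)))
                    , (λ x → pointwise (x + (- x)) (fromℚ 0ℚ) (λ n → ℚ.+-inverseʳ (seq x n)))
          ; ⁻¹-cong = λ x≈x′ → mk≈ (-‿close (close x≈x′))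
          }
        ; comm = λ x y → pointwise (x + y) (y + x) (λ n → ℚ.+-comm (seq x n) (seq y n))
        }
      ; *-cong     = λ x≈x′ y≈y′ → mk≈ (*-close (close x≈x′) (close y≈y′))
      ; *-assoc    = λ x y z → pointwise ((x * y) * z) (x * (y * z))
                                 (λ n → ℚ.*-assoc (seq x n) (seq y n) (seq z n))
      ; *-identity = (λ x → pointwise (fromℚ 1ℚ * x) x (λ n → ℚ.*-identityˡ (seq x n)))
                   , (λ x → pointwise (x * fromℚ 1ℚ) x (λ n → ℚ.*-identityʳ (seq x n)))
      ; distrib    = (λ x y z → pointwise (x * (y + z)) ((x * y) + (x * z))
                                  (λ n → ℚ.*-distribˡ-+ (seq x n) (seq y n) (seq z n)))
                   , (λ x y z → pointwise ((y + z) * x) ((y * x) + (z * x))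
                                  (λ n → ℚ.*-distribʳ-+ (seq x n) (seq y n) (seq z n)))
      }
    ; *-comm = λ x y → pointwise (x * y) (y * x) (λ n → ℚ.*-comm (seq x n) (seq y n))
    }
  }
  where
  _+_ _*_ : ℝ → ℝ → ℝ
  x + y = mkℝ (λ n → seq x n ℚ.+ seq y n) (+-close (cauchy x) (cauchy y))
  x * y = mkℝ (λ n → seq x n ℚ.* seq y n) (*-close (cauchy x) (cauchy y))

  -_ : ℝ → ℝ
  - x = mkℝ (λ n → ℚ.- seq x n) (-‿close (cauchy x))

------------------------------------------------------------------------
-- Spectra of square matrices

module Matrices {c ℓ} (R : CommutativeRing c ℓ) where

  open CommutativeRing R hiding (zero)
  open SemiringSum semiring using (sum)
  open SemiringExp semiring using (_^_)

  Matrix : ℕ → Set c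
  Matrix n = Fin n → Fin n → Carrier

  identity : ∀ {n} → Matrix n
  identity i j = if ⌊ i Fin.≟ j ⌋ then 1# else 0#

  -- Laplace expansion along the first row.
  det : ∀ {n} → Matrix n → Carrier
  det {zero}  M = 1#
  det {suc n} M = sum λ j →
    ((- 1#) ^ toℕ j) * (M zero j * det (λ i k → M (suc i) (punchIn j k)))

  -- The value at t of the characteristic polynomial det (tI - M).
  charPoly : ∀ {n} → Matrix n → Carrier → Carrier
  charPoly M t = det (λ i j → t * identity i j - M i j)

-- A list, taken up to permutation, stands for a multiset.  θs is the
-- spectrum of M if it consists of the zeros of the characteristic
-- polynomial of M, each repeated according to its multiplicity, i.e. if
-- that polynomial is the product of the t - θ with θ in θs.  (An
-- identity of polynomial functions on ℝ is one of polynomials, and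
-- length θs = n follows by comparing degrees.)
module _ where

  open CommutativeRing ℝ-commutativeRing using (_*_; _-_; 1#)
  open Matrices ℝ-commutativeRing

  IsSpectrum : ∀ {n} → Matrix n → List ℝ → Set
  IsSpectrum M θs = ∀ t → charPoly M t ≈ foldr (λ θ p → (t - θ) * p) 1# θs

open Permutation (CommutativeRing.setoid ℝ-commutativeRing) public using (_↭_)

------------------------------------------------------------------------
-- Graphs

record Graph : Set₁ where
  infix 4 _∼_
  field
    Vertex   : Set
    order    : ℕ
    enum     : Vertex ↔ Fin order
    _∼_      : Vertex → Vertex → Set
    _∼?_     : Decidable _∼_
    ∼-sym    : Symmetric _∼_
    ∼-irrefl : Irreflexive _≡_ _∼_

infix 4 _≅_

_≅_ : Graph → Graph → Set
G ≅ H = Σ[ f ∈ G.Vertex ↔ H.Vertex ]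
  (∀ x y → (x G.∼ y) ⇔ (Inverse.to f x H.∼ Inverse.to f y))
  where
  module G = Graph G
  module H = Graph H

adjacencyMatrix : (G : Graph) → Matrices.Matrix ℝ-commutativeRing (Graph.order G)
adjacencyMatrix G i j = if ⌊ from i ∼? from j ⌋ then 1# else 0#
  where
  open Graph G
  open Inverse enum using (from)
  open CommutativeRing ℝ-commutativeRing using (0#; 1#)

-- Adjacency matrices are symmetric, so all their eigenvalues are real
-- and a spectrum in the sense of IsSpectrum always exists.
Cospectral : Graph → Graph → Set
Cospectral G H = ∃[ θs ] ∃[ ηs ]
  IsSpectrum (adjacencyMatrix G) θs × IsSpectrum (adjacencyMatrix H) ηs × θs ↭ ηs

------------------------------------------------------------------------
-- Families of subsets of Fin n as finite types

private

  Σ-≡ : ∀ {A : Set} {P : A → Set} → Unary.Irrelevant P →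
        {x y : Σ A P} → proj₁ x ≡ proj₁ y → x ≡ y
  Σ-≡ irr {x , p} {.x , q} refl = cong (x ,_) (irr p q)

  finite-family : ∀ n (P : Subset n → Set) → Unary.Decidable P → Unary.Irrelevant P →
                  ∃[ k ] (Σ (Subset n) P ↔ Fin k)
  finite-family zero P P? irr with P? []
  ... | yes p = 1 , mk↔ₛ′ (λ _ → zero) (λ _ → [] , p) (λ { zero → refl })
                      (λ { ([] , q) → Σ-≡ irr refl })
  ... | no ¬p = 0 , mk↔ₛ′ (λ { ([] , q) → contradiction q ¬p }) (λ ()) (λ ())
                      (λ { ([] , q) → contradiction q ¬p })
  finite-family (suc n) P P? irr
    with finite-family n (P ∘ (true ∷_)) (P? ∘ (true ∷_)) irr
       | finite-family n (P ∘ (false ∷_)) (P? ∘ (false ∷_)) irr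
  ... | k , f | l , g = k ℕ.+ l , ↔-trans split (↔-trans (f ⊎-↔ g) (↔-sym +↔⊎))
    where
    split : Σ (Subset (suc n)) P ↔ (Σ (Subset n) (P ∘ (true ∷_)) ⊎ Σ (Subset n) (P ∘ (false ∷_)))
    split = mk↔ₛ′
      (λ { (true ∷ s , p) → inj₁ (s , p) ; (false ∷ s , p) → inj₂ (s , p) })
      (λ { (inj₁ (s , p)) → true ∷ s , p ; (inj₂ (s , p)) → false ∷ s , p })
      (λ { (inj₁ _) → refl ; (inj₂ _) → refl })
      (λ { (true ∷ _ , _) → refl ; (false ∷ _ , _) → refl })

------------------------------------------------------------------------
-- Johnson graphs J(v,3)

johnson₃ : ℕ → Graph
johnson₃ v = record
  { Vertex   = Σ[ p ∈ Subset v ] ∣ p ∣ ≡ 3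
  ; order    = proj₁ finite
  ; enum     = proj₂ finite
  ; _∼_      = λ { (p , _) (q , _) → ∣ p ∩ q ∣ ≡ 2 }
  ; _∼?_     = λ { (p , _) (q , _) → ∣ p ∩ q ∣ ℕ.≟ 2 }
  ; ∼-sym    = λ { {p , _} {q , _} eq → trans (cong ∣_∣ (∩-comm q p)) eq }
  ; ∼-irrefl = λ { {p , ∣p∣≡3} refl eq →
                   contradiction (trans (sym ∣p∣≡3) (trans (sym (cong ∣_∣ (∩-idem p))) eq)) λ () }
  }
  where
  finite = finite-family v (λ p → ∣ p ∣ ≡ 3) (λ p → ∣ p ∣ ℕ.≟ 3) ℕ.≡-irrelevant

------------------------------------------------------------------------
-- Hypergraphs

record Hypergraph : Set where
  field
    size     : ℕ
    isEdge   : Subset size → Bool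
    nonempty : ∀ e → T (isEdge e) → Nonempty e

  Edge : Set
  Edge = Σ[ e ∈ Subset size ] T (isEdge e)

Uniform : ℕ → Hypergraph → Set
Uniform h H = ∀ ((e , _) : Edge) → ∣ e ∣ ≡ h
  where open Hypergraph H

Linear : Hypergraph → Set
Linear H = ∀ x y → x ≢ y → ∀ ((e , _) (e′ , _) : Edge) →
  x ∈ e → y ∈ e → x ∈ e′ → y ∈ e′ → e ≡ e′
  where open Hypergraph H

intersectionGraph : Hypergraph → Graph
intersectionGraph H = record
  { Vertex   = Edge
  ; order    = proj₁ finite
  ; enum     = proj₂ finite
  ; _∼_      = λ { (e , _) (e′ , _) → e ≢ e′ × Nonempty (e ∩ e′) }
  ; _∼?_     = λ { (e , _) (e′ , _) → ¬? (≡-dec Bool._≟_ e e′) ×-dec nonempty? (e ∩ e′) }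
  ; ∼-sym    = λ { {e , _} {e′ , _} (e≢e′ , meet) →
                   (e≢e′ ∘ sym) , subst Nonempty (∩-comm e e′) meet }
  ; ∼-irrefl = λ { refl (e≢e , _) → contradiction refl e≢e }
  }
  where
  open Hypergraph H
  finite = finite-family size (T ∘ isEdge) (T? ∘ isEdge) T-irrelevant

{-# OPTIONS --safe #-}

-- Cospectrality with J(v,3) is only used through the traces of the powers
-- of Y = A + 3I, which the characteristic polynomial determines.  For
-- J(v,3), Y is the product of the up and down operators between 3-sets and
-- 2-sets, whence Y (Y - a) (Y - b) = 36 J with a = v - 4 and b = 2v - 6.
-- As the trace of the square of a symmetric matrix is the sum of the
-- squares of its entries, the same identity holds for every cospectral
-- graph.  So there Y is positive semidefinite, and the graph is regular of
-- degree 3v - 9 with as many triangles at each vertex as J(v,3).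
--
-- The vertices thus become vectors of norm 3 with inner products 0 and 1.
-- No vertex has 10 pairwise nonadjacent neighbours, so Ramsey's theorem
-- provides large cliques, and a vertex has either at most 12 or all but at
-- most 12 neighbours in a large clique.  By the triangle count, two
-- cliques cannot nearly cover the neighbourhood of x, so it contains three
-- large cliques that are nearly orthogonal.  The vector of x is then nearly
-- the sum of the unit vectors along these cliques, which determines its
-- inner products up to a small error, hence exactly: the vertices near one
-- of the three cliques form a line, two vertices are adjacent iff they
-- share a line, and the lines are the points of the hypergraph.
module Submission where

open import Defs
open import Algebra.Bundles using (CommutativeRing)
import Algebra.Properties.Group as GroupProperties
import Algebra.Properties.Semiring.Exp as SemiringExp
import Algebra.Properties.Semiring.Sum as SemiringSum
open import Data.Bool.Base using (true; false; if_then_else_)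
import Data.Bool.Properties as Bool
open import Data.Empty using (⊥; ⊥-elim)
open import Data.Fin.Base using (Fin; zero; suc; toℕ; punchIn)
import Data.Fin.Base as Fin
open import Data.Fin.Patterns using (0F; 1F; 2F)
import Data.Fin.Properties as Fin
open import Data.Fin.Subset using (Subset; ⁅_⁆; _∪_; _∩_; ∣_∣; Nonempty) renaming (_∈_ to _∈ₛ_; _∉_ to _∉ₛ_)
open import Data.Fin.Subset.Properties
  using (x∈⁅x⁆; x∈⁅y⁆⇒x≡y; ∣⁅x⁆∣≡1; x∈p∩q⁺; x∈p∩q⁻; x∈p∪q⁺; x∈p∪q⁻; ∪-identityˡ; ∩-idem; ∣p∩q∣≤∣p∣; ∣p∩q∣≤∣q∣)
open import Data.Integer.Base using (ℤ; +_; _+_; _*_; -_; _-_; 0ℤ; 1ℤ) renaming (∣_∣ to ‖_‖)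
import Data.Integer.Base as ℤ
import Data.Integer.Properties as ℤ
import Data.Integer.Solver as ℤ
open import Data.List.Base using (List; []; _∷_; _++_; foldr; length; filter; take; allFin; tabulate)
open import Data.List.Membership.Propositional using (_∈_)
import Data.List.Membership.DecPropositional as Membership
import Data.List.Properties as List
import Data.List.Relation.Binary.Permutation.Homogeneous as Permutation
open import Data.List.Relation.Binary.Pointwise.Base using (Pointwise; []; _∷_)
open import Data.List.Relation.Binary.Sublist.Heterogeneous.Properties using (take-Sublist; filter-Sublist)
open import Data.List.Relation.Binary.Sublist.Propositional using (_⊆_; []; _∷_; _∷ʳ_; ⊆-refl)
open import Data.List.Relation.Binary.Sublist.Propositional.Properties using (All-resp-⊆)
open import Data.List.Relation.Unary.All using (All; []; _∷_)
import Data.List.Relation.Unary.All as All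
import Data.List.Relation.Unary.All.Properties as All
open import Data.List.Relation.Unary.AllPairs using (AllPairs; []; _∷_)
import Data.List.Relation.Unary.AllPairs.Properties as AllPairs
open import Data.List.Relation.Unary.Any using (here; there)
open import Data.List.Relation.Unary.Unique.Propositional.Properties using (allFin⁺)
open import Data.Nat.Base using (ℕ; zero; suc; _<_; _≤_)
import Data.Nat.Base as ℕ
import Data.Nat.Properties as ℕ
import Data.Nat.Solver as ℕ
open import Data.Product.Base using (Σ-syntax; ∃-syntax; _×_; _,_; proj₁; proj₂)
import Data.Rational.Base as ℚ
import Data.Rational.Properties as ℚ
import Data.Rational.Unnormalised.Base as ℚᵘ
import Data.Rational.Unnormalised.Properties as ℚᵘ
open import Data.Sum.Base using (_⊎_; inj₁; inj₂)
open import Data.Unit.Base using (⊤; tt)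
open import Data.Vec.Base using ([]; _∷_; here; there)
open import Data.Vec.Functional using (updateAt)
open import Data.Vec.Properties using (≡-dec)
open import Function.Base using (_∘_; _$_; const; id)
open import Function.Bundles using (Inverse; _↔_; mk↔ₛ′; mk⇔)
open import Relation.Binary.PropositionalEquality
  using (_≡_; _≢_; refl; sym; trans; cong; cong₂; subst; subst₂; module ≡-Reasoning)
open import Relation.Nullary.Decidable using (Dec; yes; no; ⌊_⌋; ¬?; _×-dec_; toWitness; fromWitness)
open import Relation.Nullary.Negation using (¬_; contradiction)

open GroupProperties (CommutativeRing.+-group ℤ.+-*-commutativeRing) using (∙-cancelˡ)
open SemiringSum (CommutativeRing.semiring ℤ.+-*-commutativeRing)
  using (sum; ∑-distrib-+; ∑-comm; *-distribˡ-sum; *-distribʳ-sum)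
  renaming (sum-cong-≗ to sum-cong)
open SemiringExp (CommutativeRing.semiring ℤ.+-*-commutativeRing) using (_^_)
open Matrices ℤ.+-*-commutativeRing using (Matrix; det; identity; charPoly)
open ℤ.+-*-Solver
open ℕ.+-*-Solver using () renaming (solve to solveℕ; _:*_ to _⊗_; _:+_ to _⊕_; _:=_ to _⊜_; con to conℕ)

-- The reals are Cauchy sequences without decidable equality, so no eigenvector and no multiplicity
-- is ever formed. The spectrum is used only through values of characteristic polynomials at
-- integers, where equality of reals becomes equality in ℤ. Traces are read off the resolvent: tr
-- (Y^k (t - Y)⁻¹) times the characteristic polynomial satisfies a recursion in k, and growth in t
-- isolates tr Y^k. Limits and derivatives are replaced by the remark that an integer is zero once a
-- large multiple of it is small. Spectral arguments become identities between the moments ⟨Y^k x,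
-- x⟩, and positivity becomes a sum of squares. Ramsey's theorem only gives cliques of one fixed
-- size, 915, and not whole lines. A line is therefore never listed: it is the set of vertices near
-- a sample clique, and the constants are chosen so that errors of 12 per clique never make this
-- ambiguous.

private
  module R = CommutativeRing ℝ-commutativeRing
  module ℝM = Matrices ℝ-commutativeRing
  module ℝΣ = SemiringSum R.semiring
  module ℝE = SemiringExp R.semiring

-- Determinants of integer matrices

num : ∀ {n} → ℕ → Polynomial n
num k = con (+ k)

Vector : ℕ → Set
Vector n = Fin n → ℤ

infix 7 _[_≔_]

_[_≔_] : ∀ {m n} → (Fin m → Vector n) → Fin m → Vector n → Fin m → Vector n
M [ i ≔ r ] = updateAt M i (const r)

sign : ∀ {n} → Fin n → ℤ
sign j = (- 1ℤ) ^ toℕ j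

minor : ∀ {m n} → (Fin (suc m) → Vector (suc n)) → Fin (suc n) → Fin m → Vector n
minor M j i k = M (suc i) (punchIn j k)

infix 4 _≐_

_≐_ : ∀ {m n} → (Fin m → Vector n) → (Fin m → Vector n) → Set
M ≐ N = ∀ i j → M i j ≡ N i j

det-cong : ∀ {n} {M N : Matrix n} → M ≐ N → det M ≡ det N
det-cong {zero} M≐N = refl
det-cong {suc n} M≐N = sum-cong λ j → cong (sign j *_)
  (cong₂ _*_ (M≐N zero j) (det-cong λ i k → M≐N (suc i) (punchIn j k)))

[≔]-cong : ∀ {m n} {M N : Fin m → Vector n} i {r s : Vector n} →
          M ≐ N → (∀ j → r j ≡ s j) → M [ i ≔ r ] ≐ N [ i ≔ s ]
[≔]-cong zero M≐N r≗s zero = r≗s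
[≔]-cong zero M≐N r≗s (suc k) = M≐N (suc k)
[≔]-cong (suc i) M≐N r≗s zero = M≐N zero
[≔]-cong (suc i) M≐N r≗s (suc k) = [≔]-cong i (M≐N ∘ suc) r≗s k

[≔]-submatrix : ∀ {m n p} (M : Fin m → Vector n) i r (c : Fin p → Fin n) →
          (λ k → (M [ i ≔ r ]) k ∘ c) ≐ (λ k → M k ∘ c) [ i ≔ r ∘ c ]
[≔]-submatrix M zero r c zero j = refl
[≔]-submatrix M zero r c (suc k) j = refl
[≔]-submatrix M (suc i) r c zero j = refl
[≔]-submatrix M (suc i) r c (suc k) j = [≔]-submatrix (M ∘ suc) i r c k j

[≔]-same : ∀ {m n} (M : Fin m → Vector n) i r → (M [ i ≔ r ]) i ≡ r
[≔]-same M zero r = refl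
[≔]-same M (suc i) r = [≔]-same (M ∘ suc) i r

[≔]-other : ∀ {m n} (M : Fin m → Vector n) i r {k} → k ≢ i → (M [ i ≔ r ]) k ≡ M k
[≔]-other M zero r {zero} k≢i = contradiction refl k≢i
[≔]-other M zero r {suc k} k≢i = refl
[≔]-other M (suc i) r {zero} k≢i = refl
[≔]-other M (suc i) r {suc k} k≢i = [≔]-other (M ∘ suc) i r (k≢i ∘ cong suc)

[≔]-id : ∀ {m n} (M : Fin m → Vector n) i → M [ i ≔ M i ] ≐ M
[≔]-id M zero zero j = refl
[≔]-id M zero (suc k) j = refl
[≔]-id M (suc i) zero j = refl
[≔]-id M (suc i) (suc k) j = [≔]-id (M ∘ suc) i k j

sum-linear : ∀ {n} x (f g : Vector n) → sum (λ j → x * f j + g j) ≡ x * sum f + sum g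
sum-linear x f g = trans (∑-distrib-+ (λ j → x * f j) g) (cong (_+ sum g) (sym (*-distribˡ-sum x f)))

sum-zero : ∀ {n} (f : Vector n) → (∀ j → f j ≡ 0ℤ) → sum f ≡ 0ℤ
sum-zero {zero} f eq = refl
sum-zero {suc n} f eq = cong₂ _+_ (eq zero) (sum-zero (f ∘ suc) (eq ∘ suc))

*-distribˡ-sum² : ∀ {n} x y (f : Vector n) → x * (y * sum f) ≡ sum (λ j → x * (y * f j))
*-distribˡ-sum² x y f = trans (cong (x *_) (*-distribˡ-sum y f)) (*-distribˡ-sum x (λ j → y * f j))

-- Taking `x * r + s` as the only form of linearity lets `linear-expansion` peel off one coordinate
-- per step.
det-linear : ∀ {n} (M : Matrix n) i x (r s : Vector n) →
          det (M [ i ≔ (λ j → x * r j + s j) ]) ≡ x * det (M [ i ≔ r ]) + det (M [ i ≔ s ])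
det-linear M zero x r s = trans
  (sum-cong λ j → solve 5 (λ σ x a b m → σ :* ((x :* a :+ b) :* m) := x :* (σ :* (a :* m)) :+ σ :* (b :* m)) refl
          (sign j) x (r j) (s j) (det (minor M j)))
  (sum-linear x (λ j → sign j * (r j * det (minor M j))) (λ j → sign j * (s j * det (minor M j))))
det-linear M (suc i) x r s = trans (sum-cong λ j → begin
  sign j * (M zero j * det (minor (M [ suc i ≔ (λ k → x * r k + s k) ]) j))
    ≡⟨ cong (λ d → sign j * (M zero j * d)) (begin
         det (minor (M [ suc i ≔ (λ k → x * r k + s k) ]) j)
          ≡⟨ det-cong ([≔]-submatrix (M ∘ suc) i _ (punchIn j)) ⟩
         det (minor M j [ i ≔ (λ k → x * r (punchIn j k) + s (punchIn j k)) ])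
          ≡⟨ det-linear (minor M j) i x _ _ ⟩
         x * det (minor M j [ i ≔ r ∘ punchIn j ]) + det (minor M j [ i ≔ s ∘ punchIn j ])
          ≡⟨ cong₂ (λ a b → x * a + b) (det-cong ([≔]-submatrix (M ∘ suc) i r (punchIn j)))
          (det-cong ([≔]-submatrix (M ∘ suc) i s (punchIn j))) ⟨
         x * det (minor (M [ suc i ≔ r ]) j) + det (minor (M [ suc i ≔ s ]) j) ∎) ⟩
  sign j * (M zero j * (x * det (minor (M [ suc i ≔ r ]) j) + det (minor (M [ suc i ≔ s ]) j)))
    ≡⟨ solve 5 (λ σ a x c d → σ :* (a :* (x :* c :+ d)) := x :* (σ :* (a :* c)) :+ σ :* (a :* d)) refl
         (sign j) (M zero j) x (det (minor (M [ suc i ≔ r ]) j)) (det (minor (M [ suc i ≔ s ]) j)) ⟩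
  x * (sign j * (M zero j * det (minor (M [ suc i ≔ r ]) j))) + sign j * (M zero j * det (minor (M [ suc i ≔ s ]) j)) ∎)
  (sum-linear x (λ j → sign j * (M zero j * det (minor (M [ suc i ≔ r ]) j)))
          (λ j → sign j * (M zero j * det (minor (M [ suc i ≔ s ]) j))))
  where open ≡-Reasoning

-- X j k depends only on the two columns deleted by punchIn j ∘ punchIn k,
-- not on their order: (0 , k) is matched with (1 + k , 0), and what is left
-- has the same shape.
Crossing : ∀ n → (Fin (suc n) → Fin n → ℤ) → Set
Crossing zero X = ⊤
Crossing (suc n) X = (∀ k → X zero k ≡ X (suc k) zero) × Crossing n (λ j k → X (suc j) (suc k))

Crossing-cong : ∀ n {X Y : Fin (suc n) → Fin n → ℤ} → (∀ j k → X j k ≡ Y j k) → Crossing n X → Crossing n Y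
Crossing-cong zero X≡Y _ = tt
Crossing-cong (suc n) X≡Y (c , d) =
  (λ k → trans (sym (X≡Y zero k)) (trans (c k) (X≡Y (suc k) zero))) ,
  Crossing-cong n (λ j k → X≡Y (suc j) (suc k)) d

skip-zero : ∀ {m n} → (Fin m → Fin n) → Fin (suc m) → Fin (suc n)
skip-zero h zero = zero
skip-zero h (suc l) = suc (h l)

-- `Y` stands for the determinant of the columns selected by a map. It is arbitrary so that the
-- induction can pass to `Y ∘ skip-zero`: when both deleted columns are successors, column zero
-- survives and the rest is a smaller instance.
crossing-punchIn : ∀ n (Y : (Fin n → Fin (suc (suc n))) → ℤ) → (∀ {f g} → (∀ l → f l ≡ g l) → Y f ≡ Y g) →
          Crossing (suc n) (λ j k → Y (λ l → punchIn j (punchIn k l)))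
crossing-punchIn zero Y Y-cong = (λ k → Y-cong λ ()) , tt
crossing-punchIn (suc n) Y Y-cong = (λ k → Y-cong λ l → refl) ,
  Crossing-cong (suc n) {λ j k → Y (skip-zero (λ l → punchIn j (punchIn k l)))}
    {λ j k → Y (λ l → punchIn (suc j) (punchIn (suc k) l))}
    (λ j k → Y-cong λ { zero → refl ; (suc l) → refl })
    (crossing-punchIn n (Y ∘ skip-zero) (λ f≗g → Y-cong λ { zero → refl ; (suc l) → cong suc (f≗g l) }))

crossed : ∀ {n} → Vector (suc n) → Vector (suc n) → (Fin (suc n) → Fin n → ℤ) → Fin (suc n) → Fin n → ℤ
crossed r s X j k = sign j * (r j * (sign k * (s (punchIn j k) * X j k)))

-- The two summands are double Laplace expansions along the rows `r` and `s`, in either order. The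
-- term with `r` at column 0 and `s` at column `1 + k` cancels the term of the other order at
-- `(1 + k , 0)`, whose sign has one more factor -1. The terms with both columns positive gain two
-- such factors and form a smaller instance.
crossed-sum : ∀ n (r s : Vector (suc n)) (X : Fin (suc n) → Fin n → ℤ) → Crossing n X →
          sum (λ j → sum (crossed r s X j)) + sum (λ j → sum (crossed s r X j)) ≡ 0ℤ
crossed-sum zero r s X _ = refl
crossed-sum (suc n) r s X (X-eq , X′) = begin
  (sum (F r s zero) + sum (λ j → F r s (suc j) zero + sum (λ k → F r s (suc j) (suc k)))) +
  (sum (F s r zero) + sum (λ j → F s r (suc j) zero + sum (λ k → F s r (suc j) (suc k))))
    ≡⟨ cong₂ (λ p q → (sum (F r s zero) + p) + (sum (F s r zero) + q))
         (∑-distrib-+ (λ j → F r s (suc j) zero) (λ j → sum (λ k → F r s (suc j) (suc k))))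
         (∑-distrib-+ (λ j → F s r (suc j) zero) (λ j → sum (λ k → F s r (suc j) (suc k)))) ⟩
  (sum (F r s zero) + (sum (λ j → F r s (suc j) zero) + R r s)) +
  (sum (F s r zero) + (sum (λ j → F s r (suc j) zero) + R s r))
    ≡⟨ cong₂ (λ p q → (sum (F r s zero) + (p + R r s)) + (sum (F s r zero) + (q + R s r))) (opposite r s) (opposite s r) ⟩
  (sum (F r s zero) + (- 1ℤ * sum (F s r zero) + R r s)) + (sum (F s r zero) + (- 1ℤ * sum (F r s zero) + R s r))
    ≡⟨ solve 4 (λ a b c d → (a :+ (con (- 1ℤ) :* b :+ c)) :+ (b :+ (con (- 1ℤ) :* a :+ d)) := c :+ d) refl
         (sum (F r s zero)) (sum (F s r zero)) (R r s) (R s r) ⟩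
  R r s + R s r
    ≡⟨ cong₂ _+_ (smaller r s) (smaller s r) ⟩
  R′ r s + R′ s r
    ≡⟨ crossed-sum n (r ∘ suc) (s ∘ suc) (λ j k → X (suc j) (suc k)) X′ ⟩
  0ℤ ∎
  where
  open ≡-Reasoning
  F : Vector (suc (suc n)) → Vector (suc (suc n)) → Fin (suc (suc n)) → Fin (suc n) → ℤ
  F r s = crossed r s X

  R R′ : Vector (suc (suc n)) → Vector (suc (suc n)) → ℤ
  R r s = sum (λ j → sum (λ k → F r s (suc j) (suc k)))
  R′ r s = sum (λ j → sum (crossed (r ∘ suc) (s ∘ suc) (λ j k → X (suc j) (suc k)) j))

  opposite : ∀ r s → sum (λ j → F r s (suc j) zero) ≡ - 1ℤ * sum (F s r zero)
  opposite r s = trans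
    (sum-cong λ k → trans
      (cong (λ x → sign (suc k) * (r (suc k) * (1ℤ * (s zero * x)))) (sym (X-eq k)))
      (solve 4 (λ σ a b x → con (- 1ℤ) :* σ :* (a :* (num 1 :* (b :* x)))
          := con (- 1ℤ) :* (num 1 :* (b :* (σ :* (a :* x))))) refl
        (sign k) (r (suc k)) (s zero) (X zero k)))
    (sym (*-distribˡ-sum (- 1ℤ) (F s r zero)))

  smaller : ∀ r s → R r s ≡ R′ r s
  smaller r s = sum-cong λ j → sum-cong λ k →
    solve 5 (λ σ τ a b x → con (- 1ℤ) :* σ :* (a :* (con (- 1ℤ) :* τ :* (b :* x))) := σ :* (a :* (τ :* (b :* x)))) refl
      (sign j) (sign k) (r (suc j)) (s (suc (punchIn j k))) (X (suc j) (suc k))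

swap₀₁ : ∀ {m n} → (Fin (suc (suc m)) → Vector n) → Fin (suc (suc m)) → Vector n
swap₀₁ M zero = M (suc zero)
swap₀₁ M (suc zero) = M zero
swap₀₁ M (suc (suc i)) = M (suc (suc i))

det-swap₀₁ : ∀ {n} (M : Matrix (suc (suc n))) → det M + det (swap₀₁ M) ≡ 0ℤ
det-swap₀₁ {n} M = trans
  (cong₂ _+_ (sum-cong (λ j → expand (M zero) (M (suc zero)) j)) (sum-cong (λ j → expand (M (suc zero)) (M zero) j)))
  (crossed-sum (suc n) (M zero) (M (suc zero)) X (crossing-punchIn n (λ c → det (λ i l → M (suc (suc i)) (c l)))
    (λ f≗g → det-cong λ i l → cong (M (suc (suc i))) (f≗g l))))
  where
  X : Fin (suc (suc n)) → Fin (suc n) → ℤ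
  X j k = det (λ i l → M (suc (suc i)) (punchIn j (punchIn k l)))

  expand : ∀ r s j → sign j * (r j * sum (λ k → sign k * (s (punchIn j k) * X j k))) ≡ sum (crossed r s X j)
  expand r s j = *-distribˡ-sum² (sign j) (r j) (λ k → sign k * (s (punchIn j k) * X j k))

det-equal-rows : ∀ {n} (M : Matrix n) {i j} → i ≢ j → (∀ k → M i k ≡ M j k) → det M ≡ 0ℤ

det-equal-lower-rows : ∀ {n} (M : Matrix (suc n)) {i j} → i ≢ j → (∀ k → M (suc i) k ≡ M (suc j) k) → det M ≡ 0ℤ
det-equal-lower-rows M i≢j eq = sum-zero (λ k → sign k * (M zero k * det (minor M k))) λ k → trans
  (cong (λ d → sign k * (M zero k * d)) (det-equal-rows (minor M k) i≢j (λ l → eq (punchIn k l))))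
  (solve 2 (λ σ a → σ :* (a :* num 0) := num 0) refl (sign k) (M zero k))

-- If the first two rows agree, swapping them shows that twice the determinant is zero, and ℤ has no
-- torsion. Otherwise the swap moves the first row below the top, and the equal pair lies within the
-- minors.
det-equal-first-row : ∀ {n} (M : Matrix (suc n)) {j} → (∀ k → M zero k ≡ M (suc j) k) → det M ≡ 0ℤ
det-equal-first-row {suc n} M {zero} eq = ℤ.*-cancelˡ-≡ (+ 2) (det M) 0ℤ (begin
  + 2 * det M ≡⟨ solve 1 (λ d → num 2 :* d := d :+ d) refl (det M) ⟩
  det M + det M ≡⟨ cong (_+_ (det M)) (det-cong same) ⟩
  det M + det (swap₀₁ M) ≡⟨ det-swap₀₁ M ⟩
  0ℤ ∎)
  where
  open ≡-Reasoning
  same : M ≐ swap₀₁ M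
  same zero k = eq k
  same (suc zero) k = sym (eq k)
  same (suc (suc i)) k = refl
det-equal-first-row {suc n} M {suc j} eq = begin
  det M ≡⟨ ℤ.+-identityʳ (det M) ⟨
  det M + 0ℤ ≡⟨ cong (_+_ (det M)) (det-equal-lower-rows (swap₀₁ M) {zero} {suc j} (λ ()) eq) ⟨
  det M + det (swap₀₁ M) ≡⟨ det-swap₀₁ M ⟩
  0ℤ ∎
  where open ≡-Reasoning

det-equal-rows M {zero} {zero} i≢j eq = contradiction refl i≢j
det-equal-rows M {zero} {suc j} i≢j eq = det-equal-first-row M eq
det-equal-rows M {suc i} {zero} i≢j eq = det-equal-first-row M (sym ∘ eq)
det-equal-rows M {suc i} {suc j} i≢j eq = det-equal-lower-rows M (i≢j ∘ cong suc) eq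

-- Cofactors and the first-order expansion of the determinant

unit : ∀ {n} → Fin n → Vector n
unit i j = identity i j

unit-suc : ∀ {n} (i j : Fin n) → unit (suc i) (suc j) ≡ unit i j
unit-suc i j with i Fin.≟ j
... | yes _ = refl
... | no _ = refl

linear-expansion : ∀ {n} (f : Vector n → ℤ) →
  (∀ {r s} → (∀ j → r j ≡ s j) → f r ≡ f s) →
  (∀ x r s → f (λ j → x * r j + s j) ≡ x * f r + f s) →
  ∀ r → sum (λ j → r j * f (unit j)) ≡ f r
-- Without coordinates `r` agrees with `1ℤ * r + r`, so linearity gives `f r ≡ f r + f r`.
linear-expansion {zero} f f-cong f-lin r = sym (begin
  f r ≡⟨ solve 1 (λ a → a := con (- 1ℤ) :* a :+ (a :+ a)) refl (f r) ⟩
  - 1ℤ * f r + (f r + f r) ≡⟨ cong (λ z → - 1ℤ * f r + (z + f r)) (ℤ.*-identityˡ (f r)) ⟨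
  - 1ℤ * f r + (1ℤ * f r + f r) ≡⟨ cong (_+_ (- 1ℤ * f r)) (f-lin 1ℤ r r) ⟨
  - 1ℤ * f r + f (λ j → 1ℤ * r j + r j) ≡⟨ cong (_+_ (- 1ℤ * f r)) (f-cong λ ()) ⟩
  - 1ℤ * f r + f r ≡⟨ solve 1 (λ a → con (- 1ℤ) :* a :+ a := num 0) refl (f r) ⟩
  0ℤ ∎)
  where open ≡-Reasoning
linear-expansion {suc n} f f-cong f-lin r = begin
  r zero * f (unit zero) + sum (λ j → r (suc j) * f (unit (suc j)))
    ≡⟨ cong (_+_ (r zero * f (unit zero))) (sum-cong λ j → cong (r (suc j) *_) (f-cong (unit-pad j))) ⟩
  r zero * f (unit zero) + sum (λ j → r (suc j) * g (unit j))
    ≡⟨ cong (_+_ (r zero * f (unit zero))) (linear-expansion g g-cong g-lin (r ∘ suc)) ⟩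
  r zero * f (unit zero) + g (r ∘ suc)
    ≡⟨ f-lin (r zero) (unit zero) (pad (r ∘ suc)) ⟨
  f (λ j → r zero * unit zero j + pad (r ∘ suc) j)
    ≡⟨ f-cong (λ { zero → solve 1 (λ a → a :* num 1 :+ num 0 := a) refl (r zero)
          ; (suc j) → solve 2 (λ a b → a :* num 0 :+ b := b) refl (r zero) (r (suc j)) }) ⟩
  f r ∎
  where
  open ≡-Reasoning
  pad : Vector n → Vector (suc n)
  pad t zero = 0ℤ
  pad t (suc j) = t j

  g : Vector n → ℤ
  g t = f (pad t)

  unit-pad : ∀ (i : Fin n) j → unit (suc i) j ≡ pad (unit i) j
  unit-pad i zero = refl
  unit-pad i (suc j) = unit-suc i j

  g-cong : ∀ {r s} → (∀ j → r j ≡ s j) → g r ≡ g s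
  g-cong eq = f-cong λ { zero → refl ; (suc j) → eq j }

  g-lin : ∀ x r s → g (λ j → x * r j + s j) ≡ x * g r + g s
  g-lin x r s = trans
    (f-cong λ { zero → solve 1 (λ x → num 0 := x :* num 0 :+ num 0) refl x ; (suc j) → refl })
    (f-lin x (pad r) (pad s))

-- Entry (b , a) of the adjugate. Replacing a row by a unit vector, instead of deleting a row and a
-- column, hides the signs and makes multilinearity apply directly.
cofactor : ∀ {n} → Matrix n → Matrix n
cofactor M a b = det (M [ a ≔ unit b ])

cofactor-expansion : ∀ {n} (M : Matrix n) a r → sum (λ b → r b * cofactor M a b) ≡ det (M [ a ≔ r ])
cofactor-expansion M a = linear-expansion (λ r → det (M [ a ≔ r ]))
  (λ r≗s → det-cong ([≔]-cong a (λ _ _ → refl) r≗s)) (det-linear M a)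

cofactor-inverse : ∀ {n} (M : Matrix n) a k → sum (λ b → M k b * cofactor M a b) ≡ det M * unit a k
cofactor-inverse M a k with a Fin.≟ k
... | yes refl = trans (cofactor-expansion M a (M a)) (trans (det-cong ([≔]-id M a)) (sym (ℤ.*-identityʳ (det M))))
... | no a≢k = trans (cofactor-expansion M a (M k)) (trans
  (det-equal-rows (M [ a ≔ M k ]) a≢k λ l →
    trans (cong (_$ l) ([≔]-same M a (M k))) (sym (cong (_$ l) ([≔]-other M a (M k) (a≢k ∘ sym)))))
  (sym (ℤ.*-zeroʳ (det M))))

-- Only the linear coefficient is made explicit; `e` is some integer depending on `h`. That is
-- enough to compare derivatives without introducing polynomials.
det-derivative : ∀ {n} (M N : Matrix n) h →
  ∃[ e ] (det (λ i j → M i j + h * N i j) ≡ det M + h * sum (λ i → det (M [ i ≔ N i ])) + h * h * e)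
det-derivative {zero} M N h = 0ℤ , solve 1 (λ h → num 1 := num 1 :+ h :* num 0 :+ h :* h :* num 0) refl h
det-derivative {suc n} M N h = sum E , (begin
  sum (λ j → sign j * ((M zero j + h * N zero j) * det (λ i k → minor M j i k + h * minor N j i k)))
    ≡⟨ sum-cong (λ j → trans
         (cong (λ d → sign j * ((M zero j + h * N zero j) * d)) (proj₂ (IH j)))
         (solve 7 (λ σ a b h m d e → σ :* ((a :+ h :* b) :* (m :+ h :* d :+ h :* h :* e))
          := h :* h :* (σ :* (a :* e) :+ σ :* (b :* d) :+ h :* (σ :* (b :* e)))
          :+ (h :* (σ :* (b :* m) :+ σ :* (a :* d)) :+ σ :* (a :* m))) refl
          (sign j) (M zero j) (N zero j) h (det (minor M j)) (D j) (proj₁ (IH j)))) ⟩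
  sum (λ j → h * h * E j + (h * (sign j * (N zero j * det (minor M j)) + sign j * (M zero j * D j))
          + sign j * (M zero j * det (minor M j))))
    ≡⟨ sum-linear (h * h) E (λ j → h * P j + L j) ⟩
  h * h * sum E + sum (λ j → h * (sign j * (N zero j * det (minor M j)) + sign j * (M zero j * D j))
          + sign j * (M zero j * det (minor M j)))
    ≡⟨ cong (_+_ (h * h * sum E)) (sum-linear h P L) ⟩
  h * h * sum E + (h * sum (λ j → sign j * (N zero j * det (minor M j)) + sign j * (M zero j * D j)) + det M)
    ≡⟨ cong (λ s → h * h * sum E + (h * s + det M)) (trans
         (∑-distrib-+ (λ j → sign j * (N zero j * det (minor M j))) (λ j → sign j * (M zero j * D j)))
         (cong (_+_ (sum (λ j → sign j * (N zero j * det (minor M j))))) lower-rows)) ⟩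
  h * h * sum E + (h * sum (λ i → det (M [ i ≔ N i ])) + det M)
    ≡⟨ solve 3 (λ a b c → a :+ (b :+ c) := c :+ b :+ a) refl (h * h * sum E) (h * sum (λ i → det (M [ i ≔ N i ]))) (det M) ⟩
  det M + h * sum (λ i → det (M [ i ≔ N i ])) + h * h * sum E ∎)
  where
  open ≡-Reasoning
  IH = λ j → det-derivative (minor M j) (minor N j) h
  D E P L : Fin (suc n) → ℤ
  D j = sum (λ i → det (minor M j [ i ≔ minor N j i ]))
  E j = sign j * (M zero j * proj₁ (IH j)) + sign j * (N zero j * D j) + h * (sign j * (N zero j * proj₁ (IH j)))

  P j = sign j * (N zero j * det (minor M j)) + sign j * (M zero j * D j)
  L j = sign j * (M zero j * det (minor M j))

  lower-rows : sum (λ j → sign j * (M zero j * D j)) ≡ sum (λ i → det (M [ suc i ≔ N (suc i) ]))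
  lower-rows = begin
    sum (λ j → sign j * (M zero j * D j))
      ≡⟨ sum-cong (λ j → *-distribˡ-sum² (sign j) (M zero j) (λ i → det (minor M j [ i ≔ minor N j i ]))) ⟩
    sum (λ j → sum (λ i → sign j * (M zero j * det (minor M j [ i ≔ minor N j i ]))))
      ≡⟨ ∑-comm (λ j i → sign j * (M zero j * det (minor M j [ i ≔ minor N j i ]))) ⟩
    sum (λ i → sum (λ j → sign j * (M zero j * det (minor M j [ i ≔ minor N j i ]))))
      ≡⟨ sum-cong (λ i → sum-cong λ j → cong (λ d → sign j * (M zero j * d))
          (det-cong ([≔]-submatrix (M ∘ suc) i (N (suc i)) (punchIn j)))) ⟨
    sum (λ i → det (M [ suc i ≔ N (suc i) ])) ∎

-- The characteristic polynomial determines the traces of powers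

mat : ∀ {n} → Matrix n → Vector n → Vector n
mat Y x i = sum (λ j → Y i j * x j)

power : ∀ {n} → Matrix n → ℕ → Vector n → Vector n
power Y zero x = x
power Y (suc i) x = power Y i (mat Y x)

trace-power : ∀ {n} → Matrix n → ℕ → ℤ
trace-power Y i = sum (λ a → power Y i (unit a) a)

mat-cong : ∀ {n} (Y : Matrix n) {x y} → (∀ j → x j ≡ y j) → ∀ i → mat Y x i ≡ mat Y y i
mat-cong Y x≗y i = sum-cong λ j → cong (Y i j *_) (x≗y j)

mat-linear : ∀ {n} (Y : Matrix n) c x y i → mat Y (λ j → c * x j + y j) i ≡ c * mat Y x i + mat Y y i
mat-linear Y c x y i = trans
  (sum-cong λ j → solve 4 (λ a c x y → a :* (c :* x :+ y) := c :* (a :* x) :+ a :* y) refl (Y i j) c (x j) (y j))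
  (sum-linear c (λ j → Y i j * x j) (λ j → Y i j * y j))

power-cong : ∀ {n} (Y : Matrix n) k {x y} → (∀ j → x j ≡ y j) → ∀ i → power Y k x i ≡ power Y k y i
power-cong Y zero x≗y = x≗y
power-cong Y (suc k) x≗y = power-cong Y k (mat-cong Y x≗y)

power-linear : ∀ {n} (Y : Matrix n) k c x y i →
          power Y k (λ j → c * x j + y j) i ≡ c * power Y k x i + power Y k y i
power-linear Y zero c x y i = refl
power-linear Y (suc k) c x y i = trans (power-cong Y k (mat-linear Y c x y) i) (power-linear Y k c (mat Y x) (mat Y y) i)

power-scale : ∀ {n} (Y : Matrix n) k c x i → power Y k (λ j → c * x j) i ≡ c * power Y k x i
power-scale Y zero c x i = refl
power-scale Y (suc k) c x i = trans
  (power-cong Y k (λ j → trans (sum-cong λ l → solve 3 (λ a c x → a :* (c :* x) := c :* (a :* x)) refl (Y j l) c (x l))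
          (sym (*-distribˡ-sum c (λ l → Y j l * x l)))) i)
  (power-scale Y k c (mat Y x) i)

charMatrix : ∀ {n} → Matrix n → ℤ → Matrix n
charMatrix Y t i j = t * identity i j - Y i j

-- The trace of the adjugate of tI - Y times the k-th power of Y.
adjTrace : ∀ {n} → Matrix n → ℕ → ℤ → ℤ
adjTrace Y k t = sum (λ a → power Y k (cofactor (charMatrix Y t) a) a)

sum-unit : ∀ {n} (k : Fin n) (x : Vector n) → sum (λ j → unit k j * x j) ≡ x k
sum-unit zero x = trans
  (cong₂ _+_ (ℤ.*-identityˡ (x zero)) (sum-zero (λ j → 0ℤ * x (suc j)) (λ j → ℤ.*-zeroˡ (x (suc j)))))
  (ℤ.+-identityʳ (x zero))
sum-unit (suc k) x = trans
  (cong₂ _+_ (ℤ.*-zeroˡ (x zero)) (trans (sum-cong λ j → cong (_* x (suc j)) (unit-suc k j)) (sum-unit k (x ∘ suc))))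
  (ℤ.+-identityˡ (x (suc k)))

charMatrix-cofactor : ∀ {n} (Y : Matrix n) t a k →
  t * cofactor (charMatrix Y t) a k ≡ charPoly Y t * unit a k + mat Y (cofactor (charMatrix Y t) a) k
charMatrix-cofactor Y t a k = begin
  t * c k
    ≡⟨ cong (t *_) (sum-unit k c) ⟨
  t * sum (λ j → unit k j * c j)
    ≡⟨ solve 2 (λ a b → a := a :+ con (- 1ℤ) :* b :+ b) refl (t * sum (λ j → unit k j * c j)) (mat Y c k) ⟩
  t * sum (λ j → unit k j * c j) + - 1ℤ * mat Y c k + mat Y c k
    ≡⟨ cong (λ s → t * sum (λ j → unit k j * c j) + s + mat Y c k) (*-distribˡ-sum (- 1ℤ) (λ j → Y k j * c j)) ⟩
  t * sum (λ j → unit k j * c j) + sum (λ j → - 1ℤ * (Y k j * c j)) + mat Y c k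
    ≡⟨ cong (_+ mat Y c k) (sum-linear t (λ j → unit k j * c j) (λ j → - 1ℤ * (Y k j * c j))) ⟨
  sum (λ j → t * (unit k j * c j) + - 1ℤ * (Y k j * c j)) + mat Y c k
    ≡⟨ cong (_+ mat Y c k) (sum-cong λ j → solve 4 (λ t u y c → t :* (u :* c) :+ con (- 1ℤ) :* (y :* c) := (t :* u :- y) :* c) refl
         t (unit k j) (Y k j) (c j)) ⟩
  sum (λ j → charMatrix Y t k j * c j) + mat Y c k
    ≡⟨ cong (_+ mat Y c k) (cofactor-inverse (charMatrix Y t) a k) ⟩
  charPoly Y t * unit a k + mat Y c k ∎
  where
  open ≡-Reasoning
  c = cofactor (charMatrix Y t) a

-- Since `adjTrace Y k t` is tr (Y^k (t - Y)⁻¹) times the characteristic polynomial, this is one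
-- step of the expansion of the resolvent in powers of 1/t.
adjTrace-suc : ∀ {n} (Y : Matrix n) k t → t * adjTrace Y k t ≡ charPoly Y t * trace-power Y k + adjTrace Y (suc k) t
adjTrace-suc Y k t = begin
  t * adjTrace Y k t
    ≡⟨ *-distribˡ-sum t (λ a → power Y k (c a) a) ⟩
  sum (λ a → t * power Y k (c a) a)
    ≡⟨ sum-cong (λ a → begin
         t * power Y k (c a) a ≡⟨ power-scale Y k t (c a) a ⟨
         power Y k (λ j → t * c a j) a ≡⟨ power-cong Y k (charMatrix-cofactor Y t a) a ⟩
         power Y k (λ j → charPoly Y t * unit a j + mat Y (c a) j) a ≡⟨ power-linear Y k (charPoly Y t) (unit a) (mat Y (c a)) a ⟩
         charPoly Y t * power Y k (unit a) a + power Y (suc k) (c a) a ∎) ⟩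
  sum (λ a → charPoly Y t * power Y k (unit a) a + power Y (suc k) (c a) a)
    ≡⟨ sum-linear (charPoly Y t) (λ a → power Y k (unit a) a) (λ a → power Y (suc k) (c a) a) ⟩
  charPoly Y t * trace-power Y k + adjTrace Y (suc k) t ∎
  where
  open ≡-Reasoning
  c = cofactor (charMatrix Y t)

-- Growth of the characteristic polynomial at large integers

∣i-j∣≤∣i∣+∣j∣ : ∀ i j → ‖ i - j ‖ ≤ ‖ i ‖ ℕ.+ ‖ j ‖
∣i-j∣≤∣i∣+∣j∣ i j = subst (‖ i - j ‖ ≤_) (cong (‖ i ‖ ℕ.+_) (ℤ.∣-i∣≡∣i∣ j)) (ℤ.∣i+j∣≤∣i∣+∣j∣ i (- j))

multiple-bounded⇒0 : ∀ δ K → (ℕ.suc K) ℕ.* ‖ δ ‖ ≤ K → δ ≡ 0ℤ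
multiple-bounded⇒0 δ K le with ‖ δ ‖ in eq
... | zero = ℤ.∣i∣≡0⇒i≡0 eq
... | suc d = contradiction (ℕ.≤-trans (ℕ.m≤m*n (suc K) (suc d)) le) (ℕ.<⇒≱ ℕ.≤-refl)

-- The derivative of det (tI - Y) is the trace of the adjugate, because the rows of `identity` turn
-- the row replacements of `det-derivative` into diagonal cofactors.
adjTrace₀-expansion : ∀ {n} (Y : Matrix n) t h →
  ∃[ e ] (charPoly Y (t + h) ≡ charPoly Y t + h * adjTrace Y 0 t + h * h * e)
adjTrace₀-expansion Y t h = let e , eq = det-derivative (charMatrix Y t) identity h in e , trans
  (det-cong λ i j → solve 4 (λ t h u y → (t :+ h) :* u :- y := t :* u :- y :+ h :* u) refl t h (identity i j) (Y i j)) eq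

sum-bound : ∀ {n} (f : Vector n) b → (∀ j → ‖ f j ‖ ≤ b) → ‖ sum f ‖ ≤ n ℕ.* b
sum-bound {zero} f b f≤b = ℕ.z≤n
sum-bound {suc n} f b f≤b = ℕ.≤-trans (ℤ.∣i+j∣≤∣i∣+∣j∣ (f zero) (sum (f ∘ suc))) (ℕ.+-mono-≤ (f≤b zero) (sum-bound (f ∘ suc) b (f≤b ∘ suc)))

∣sign∣ : ∀ {n} (j : Fin n) → ‖ sign j ‖ ≡ 1
∣sign∣ zero = refl
∣sign∣ (suc j) = trans (ℤ.abs-* (- 1ℤ) (sign j)) (cong (1 ℕ.*_) (∣sign∣ j))

∣sign*∣ : ∀ {n} (j : Fin n) x y → ‖ sign j * (x * y) ‖ ≡ ‖ x ‖ ℕ.* ‖ y ‖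
∣sign*∣ j x y = begin
  ‖ sign j * (x * y) ‖ ≡⟨ ℤ.abs-* (sign j) (x * y) ⟩
  ‖ sign j ‖ ℕ.* ‖ x * y ‖ ≡⟨ cong₂ ℕ._*_ (∣sign∣ j) (ℤ.abs-* x y) ⟩
  1 ℕ.* (‖ x ‖ ℕ.* ‖ y ‖) ≡⟨ ℕ.*-identityˡ _ ⟩
  ‖ x ‖ ℕ.* ‖ y ‖ ∎
  where open ≡-Reasoning

det-bound : ∀ {n} (M : Matrix n) b → (∀ i j → ‖ M i j ‖ ≤ b) → ‖ det M ‖ ≤ (n ℕ.!) ℕ.* b ℕ.^ n
det-bound {zero} M b M≤b = ℕ.≤-refl
det-bound {suc n} M b M≤b = ℕ.≤-trans
  (sum-bound (λ j → sign j * (M zero j * det (minor M j))) (b ℕ.* ((n ℕ.!) ℕ.* b ℕ.^ n)) λ j →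
    ℕ.≤-trans (ℕ.≤-reflexive (∣sign*∣ j (M zero j) (det (minor M j))))
      (ℕ.*-mono-≤ (M≤b zero j) (det-bound (minor M j) b (λ i k → M≤b (suc i) (punchIn j k)))))
  (ℕ.≤-reflexive (solveℕ 4 (λ s b f p → s ⊗ (b ⊗ (f ⊗ p)) ⊜ (s ⊗ f) ⊗ (b ⊗ p)) refl (suc n) b (n ℕ.!) (b ℕ.^ n)))

*-^ : ∀ a b n → (a ℕ.* b) ℕ.^ n ≡ a ℕ.^ n ℕ.* b ℕ.^ n
*-^ a b zero = refl
*-^ a b (suc n) = trans (cong (a ℕ.* b ℕ.*_) (*-^ a b n))
  (solveℕ 4 (λ a b p q → (a ⊗ b) ⊗ (p ⊗ q) ⊜ (a ⊗ p) ⊗ (b ⊗ q)) refl a b (a ℕ.^ n) (b ℕ.^ n))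

module Growth {n} (Y : Matrix n) (β : ℕ) (Y≤β : ∀ i j → ‖ Y i j ‖ ≤ β) where

  ∣unit∣≤1 : ∀ {n} (i j : Fin n) → ‖ identity i j ‖ ≤ 1
  ∣unit∣≤1 i j with i Fin.≟ j
  ... | yes _ = ℕ.≤-refl
  ... | no _ = ℕ.z≤n

  scaled-unit-bound : ∀ {n} t (i j : Fin n) → ‖ + t * identity i j ‖ ≤ t
  scaled-unit-bound t i j = begin
    ‖ + t * identity i j ‖ ≡⟨ ℤ.abs-* (+ t) (identity i j) ⟩
    t ℕ.* ‖ identity i j ‖ ≤⟨ ℕ.*-monoʳ-≤ t (∣unit∣≤1 i j) ⟩
    t ℕ.* 1 ≡⟨ ℕ.*-identityʳ t ⟩
    t ∎
    where open ℕ.≤-Reasoning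

  charMatrix-bound : ∀ {t} → β ≤ t → ∀ i j → ‖ charMatrix Y (+ t) i j ‖ ≤ 2 ℕ.* t
  charMatrix-bound {t} β≤t i j = begin
    ‖ + t * identity i j - Y i j ‖ ≤⟨ ∣i-j∣≤∣i∣+∣j∣ (+ t * identity i j) (Y i j) ⟩
    ‖ + t * identity i j ‖ ℕ.+ ‖ Y i j ‖ ≤⟨ ℕ.+-mono-≤ (scaled-unit-bound t i j) (ℕ.≤-trans (Y≤β i j) β≤t) ⟩
    t ℕ.+ t ≡⟨ cong (t ℕ.+_) (ℕ.+-identityʳ t) ⟨
    2 ℕ.* t ∎
    where open ℕ.≤-Reasoning

  F : ℕ
  F = (n ℕ.!) ℕ.* 2 ℕ.^ n

  F-bound : ∀ t → (n ℕ.!) ℕ.* (2 ℕ.* t) ℕ.^ n ≡ F ℕ.* t ℕ.^ n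
  F-bound t = trans (cong ((n ℕ.!) ℕ.*_) (*-^ 2 t n)) (sym (ℕ.*-assoc (n ℕ.!) (2 ℕ.^ n) (t ℕ.^ n)))

  charPoly-bound : ∀ {t} → β ≤ t → ‖ charPoly Y (+ t) ‖ ≤ F ℕ.* t ℕ.^ n
  charPoly-bound {t} β≤t = ℕ.≤-trans (det-bound (charMatrix Y (+ t)) (2 ℕ.* t) (charMatrix-bound β≤t)) (ℕ.≤-reflexive (F-bound t))

  -- Absorbing `t` into the unit row gives a matrix with all entries at most `2 * t`, so that the
  -- exponent is `n` and never `n - 1`.
  cofactor-bound : ∀ {t} → β ≤ t → ∀ a b → ‖ + t * cofactor (charMatrix Y (+ t)) a b ‖ ≤ F ℕ.* t ℕ.^ n
  cofactor-bound {t} β≤t a b = subst₂ _≤_ (cong ‖_‖ eq) (F-bound t)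
    (det-bound (M [ a ≔ (λ j → + t * unit b j) ]) (2 ℕ.* t) entry)
    where
    M = charMatrix Y (+ t)
    eq : det (M [ a ≔ (λ j → + t * unit b j) ]) ≡ + t * cofactor M a b
    eq = trans (sym (cofactor-expansion M a (λ j → + t * unit b j))) (trans
      (sum-cong λ j → ℤ.*-assoc (+ t) (unit b j) (cofactor M a j)) (trans
      (sym (*-distribˡ-sum (+ t) (λ j → unit b j * cofactor M a j)))
      (cong (+ t *_) (sum-unit b (cofactor M a)))))
    entry : ∀ i j → ‖ (M [ a ≔ (λ j → + t * unit b j) ]) i j ‖ ≤ 2 ℕ.* t
    entry i j with i Fin.≟ a
    ... | yes refl = subst (λ r → ‖ r j ‖ ≤ 2 ℕ.* t) (sym ([≔]-same M i (λ j → + t * unit b j)))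
          (ℕ.≤-trans (scaled-unit-bound t b j) (ℕ.m≤m+n t (t ℕ.+ 0)))
    ... | no i≢a = subst (λ r → ‖ r j ‖ ≤ 2 ℕ.* t) (sym ([≔]-other M a (λ j → + t * unit b j) i≢a)) (charMatrix-bound β≤t i j)

  power-bound : ∀ k x b → (∀ j → ‖ x j ‖ ≤ b) → ∀ i → ‖ power Y k x i ‖ ≤ (n ℕ.* β) ℕ.^ k ℕ.* b
  power-bound zero x b x≤b i = ℕ.≤-trans (x≤b i) (ℕ.≤-reflexive (sym (ℕ.+-identityʳ b)))
  power-bound (suc k) x b x≤b i = ℕ.≤-trans
    (power-bound k (mat Y x) (n ℕ.* (β ℕ.* b)) (λ j → sum-bound (λ l → Y j l * x l) (β ℕ.* b) λ l →
       ℕ.≤-trans (ℕ.≤-reflexive (ℤ.abs-* (Y j l) (x l))) (ℕ.*-mono-≤ (Y≤β j l) (x≤b l))) i)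
    (ℕ.≤-reflexive (solveℕ 4 (λ p n β b → p ⊗ (n ⊗ (β ⊗ b)) ⊜ (n ⊗ β ⊗ p) ⊗ b) refl ((n ℕ.* β) ℕ.^ k) n β b))

  adjTrace-bound : ∀ k {t} → β ≤ t →
    t ℕ.* ‖ adjTrace Y k (+ t) ‖ ≤ n ℕ.* ((n ℕ.* β) ℕ.^ k ℕ.* F) ℕ.* t ℕ.^ n
  adjTrace-bound k {t} β≤t = begin
    t ℕ.* ‖ adjTrace Y k (+ t) ‖ ≡⟨ ℤ.abs-* (+ t) (adjTrace Y k (+ t)) ⟨
    ‖ + t * adjTrace Y k (+ t) ‖ ≡⟨ cong ‖_‖ (*-distribˡ-sum (+ t) (λ a → power Y k (c a) a)) ⟩
    ‖ sum (λ a → + t * power Y k (c a) a) ‖ ≤⟨ sum-bound _ _ (λ a → ℕ.≤-trans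
          (ℕ.≤-reflexive (cong ‖_‖ (sym (power-scale Y k (+ t) (c a) a))))
          (power-bound k (λ j → + t * c a j) (F ℕ.* t ℕ.^ n) (cofactor-bound β≤t a) a)) ⟩
    n ℕ.* (P ℕ.* (F ℕ.* t ℕ.^ n)) ≡⟨ (solveℕ 4 (λ n p f q → n ⊗ (p ⊗ (f ⊗ q)) ⊜ n ⊗ (p ⊗ f) ⊗ q) refl n P F (t ℕ.^ n)) ⟩
    n ℕ.* (P ℕ.* F) ℕ.* t ℕ.^ n ∎
    where
    open ℕ.≤-Reasoning
    c = cofactor (charMatrix Y (+ t))
    P = (n ℕ.* β) ℕ.^ k

-- The extra factor `t` avoids the exponent `n - 1`. In the expansion along the first row, only
-- column 0 contains `t`, multiplied by a smaller characteristic polynomial; every other term pairs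
-- an entry bounded by `β` with a minor of lower order.
leading-term : ∀ {n} (Y : Matrix n) β → (∀ i j → ‖ Y i j ‖ ≤ β) → ∃[ C ] (∀ t → β ≤ t →
  ‖ + t * charPoly Y (+ t) - + (t ℕ.^ suc n) ‖ ≤ C ℕ.* t ℕ.^ n)
leading-term {zero} Y β Y≤β = 0 , λ t _ → ℕ.≤-reflexive (cong ‖_‖ (begin
  + t * 1ℤ - + (t ℕ.* 1) ≡⟨ cong₂ _-_ (ℤ.*-identityʳ (+ t)) (cong +_ (ℕ.*-identityʳ t)) ⟩
  + t - + t ≡⟨ ℤ.+-inverseʳ (+ t) ⟩
  0ℤ ∎))
  where open ≡-Reasoning
leading-term {suc n} Y β Y≤β = C ℕ.+ β ℕ.* F ℕ.+ n ℕ.* (β ℕ.* F) , λ t β≤t → bound t β≤t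
  where
  Y′ : Matrix n
  Y′ i j = Y (suc i) (suc j)
  IH = leading-term Y′ β (λ i j → Y≤β (suc i) (suc j))
  C = proj₁ IH
  open Growth Y′ β (λ i j → Y≤β (suc i) (suc j)) using (F; F-bound; charPoly-bound)

  module _ (t : ℕ) (β≤t : β ≤ t) where
    M = charMatrix Y (+ t)
    d′ = charPoly Y′ (+ t)
    R = sum (λ j → sign (suc j) * (M zero (suc j) * det (minor M (suc j))))
    T = t ℕ.^ n

    split : charPoly Y (+ t) ≡ (+ t - Y zero zero) * d′ + R
    split = cong (_+ R) (trans (ℤ.*-identityˡ _) (cong₂ (λ a b → (a - Y zero zero) * b) (ℤ.*-identityʳ (+ t))
      (det-cong λ i k → cong (λ u → + t * u - Y (suc i) (suc k)) (unit-suc i k))))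

    R-bound : ‖ R ‖ ≤ n ℕ.* (β ℕ.* (F ℕ.* T))
    R-bound = sum-bound (λ j → sign (suc j) * (M zero (suc j) * det (minor M (suc j)))) (β ℕ.* (F ℕ.* T)) λ j →
      ℕ.≤-trans (ℕ.≤-reflexive (∣sign*∣ (suc j) (M zero (suc j)) (det (minor M (suc j)))))
        (ℕ.*-mono-≤
          (ℕ.≤-trans (ℕ.≤-reflexive (trans (cong ‖_‖ (solve 2 (λ t y → t :* num 0 :- y := :- y) refl (+ t) (Y zero (suc j))))
          (ℤ.∣-i∣≡∣i∣ (Y zero (suc j))))) (Y≤β zero (suc j)))
          (ℕ.≤-trans (det-bound (minor M (suc j)) (2 ℕ.* t) λ i k →
          Growth.charMatrix-bound Y β Y≤β β≤t (suc i) (punchIn (suc j) k)) (ℕ.≤-reflexive (F-bound t))))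

    bound : ‖ + t * charPoly Y (+ t) - + (t ℕ.* (t ℕ.* T)) ‖ ≤ (C ℕ.+ β ℕ.* F ℕ.+ n ℕ.* (β ℕ.* F)) ℕ.* (t ℕ.* T)
    bound = begin
      ‖ + t * charPoly Y (+ t) - + (t ℕ.* (t ℕ.* T)) ‖
        ≡⟨ cong ‖_‖ (trans (cong₂ (λ a b → + t * a - b) split (ℤ.pos-* t (t ℕ.* T)))
          (solve 5 (λ t y d r p → t :* ((t :- y) :* d :+ r) :- t :* p := t :* ((t :* d :- p) :+ (r :- y :* d))) refl
          (+ t) (Y zero zero) d′ R (+ (t ℕ.* T)))) ⟩
      ‖ + t * ((+ t * d′ - + (t ℕ.* T)) + (R - Y zero zero * d′)) ‖
        ≡⟨ ℤ.abs-* (+ t) _ ⟩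
      t ℕ.* ‖ (+ t * d′ - + (t ℕ.* T)) + (R - Y zero zero * d′) ‖
        ≤⟨ ℕ.*-monoʳ-≤ t (ℕ.≤-trans (ℤ.∣i+j∣≤∣i∣+∣j∣ (+ t * d′ - + (t ℕ.* T)) (R - Y zero zero * d′))
          (ℕ.+-mono-≤ (proj₂ IH t β≤t) (ℕ.≤-trans (∣i-j∣≤∣i∣+∣j∣ R (Y zero zero * d′))
          (ℕ.+-mono-≤ R-bound (ℕ.≤-trans (ℕ.≤-reflexive (ℤ.abs-* (Y zero zero) d′))
          (ℕ.*-mono-≤ (Y≤β zero zero) (charPoly-bound β≤t))))))) ⟩
      t ℕ.* (C ℕ.* T ℕ.+ (n ℕ.* (β ℕ.* (F ℕ.* T)) ℕ.+ β ℕ.* (F ℕ.* T)))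
        ≡⟨ (solveℕ 6 (λ t c T n b f → t ⊗ (c ⊗ T ⊕ (n ⊗ (b ⊗ (f ⊗ T)) ⊕ b ⊗ (f ⊗ T)))
          ⊜ (c ⊕ b ⊗ f ⊕ n ⊗ (b ⊗ f)) ⊗ (t ⊗ T)) refl t C T n β F) ⟩
      (C ℕ.+ β ℕ.* F ℕ.+ n ℕ.* (β ℕ.* F)) ℕ.* (t ℕ.* T) ∎
      where open ℕ.≤-Reasoning

charPoly-growth : ∀ {n} (Y : Matrix n) β → (∀ i j → ‖ Y i j ‖ ≤ β) →
  ∃[ T ] (∀ t → T ≤ t → 0 < t × β ≤ t × t ℕ.^ n ≤ 2 ℕ.* ‖ charPoly Y (+ t) ‖)
-- `suc β` makes `t` positive and at least `β`; `2 * C` makes the error `C * t ^ n` at most half of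
-- `t ^ suc n`.
charPoly-growth {n} Y β Y≤β = suc β ℕ.+ 2 ℕ.* C , λ t T≤t →
  let 1+β≤t = ℕ.≤-trans (ℕ.m≤m+n (suc β) (2 ℕ.* C)) T≤t
      2C≤t = ℕ.≤-trans (ℕ.m≤n+m (2 ℕ.* C) (suc β)) T≤t
      β≤t = ℕ.≤-trans (ℕ.n≤1+n β) 1+β≤t
      0<t = ℕ.≤-trans (ℕ.s≤s ℕ.z≤n) 1+β≤t
  in 0<t , β≤t , growth t 0<t β≤t 2C≤t
  where
  C = proj₁ (leading-term Y β Y≤β)
  growth : ∀ t → 0 < t → β ≤ t → 2 ℕ.* C ≤ t → t ℕ.^ n ≤ 2 ℕ.* ‖ charPoly Y (+ t) ‖
  growth t 0<t β≤t 2C≤t = ℕ.*-cancelˡ-≤ t {{ℕ.>-nonZero 0<t}} (ℕ.+-cancelʳ-≤ (t ℕ.* T) (t ℕ.* T) (t ℕ.* (2 ℕ.* d)) (begin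
    t ℕ.* T ℕ.+ t ℕ.* T ≡⟨ cong (t ℕ.* T ℕ.+_) (ℕ.+-identityʳ (t ℕ.* T)) ⟨
    2 ℕ.* (t ℕ.* T) ≤⟨ ℕ.*-monoʳ-≤ 2 upper ⟩
    2 ℕ.* (t ℕ.* d ℕ.+ C ℕ.* T) ≡⟨ (solveℕ 4 (λ t d c T → conℕ 2 ⊗ (t ⊗ d ⊕ c ⊗ T)
          ⊜ t ⊗ (conℕ 2 ⊗ d) ⊕ (conℕ 2 ⊗ c) ⊗ T) refl t d C T) ⟩
    t ℕ.* (2 ℕ.* d) ℕ.+ (2 ℕ.* C) ℕ.* T ≤⟨ ℕ.+-monoʳ-≤ (t ℕ.* (2 ℕ.* d)) (ℕ.*-monoˡ-≤ T 2C≤t) ⟩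
    t ℕ.* (2 ℕ.* d) ℕ.+ t ℕ.* T ∎))
    where
    open ℕ.≤-Reasoning
    T = t ℕ.^ n
    d = ‖ charPoly Y (+ t) ‖
    upper : t ℕ.* T ≤ t ℕ.* d ℕ.+ C ℕ.* T
    upper = begin
      t ℕ.* T
        ≡⟨ cong ‖_‖ (solve 2 (λ a b → a :- (a :- b) := b) refl (+ t * charPoly Y (+ t)) (+ (t ℕ.* T))) ⟨
      ‖ + t * charPoly Y (+ t) - (+ t * charPoly Y (+ t) - + (t ℕ.* T)) ‖
        ≤⟨ ∣i-j∣≤∣i∣+∣j∣ (+ t * charPoly Y (+ t)) _ ⟩
      ‖ + t * charPoly Y (+ t) ‖ ℕ.+ ‖ + t * charPoly Y (+ t) - + (t ℕ.* T) ‖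
        ≤⟨ ℕ.+-mono-≤ (ℕ.≤-reflexive (ℤ.abs-* (+ t) (charPoly Y (+ t)))) (proj₂ (leading-term Y β Y≤β) t β≤t) ⟩
      t ℕ.* d ℕ.+ C ℕ.* T ∎

-- In terms of limits, `adjTrace` divided by the characteristic polynomial is O(1/t).
adjTrace-dominated : ∀ {n} (Y : Matrix n) β → (∀ i j → ‖ Y i j ‖ ≤ β) → ∀ k → ∃[ K ] ∃[ T ] (∀ t → T ≤ t →
  0 < ‖ charPoly Y (+ t) ‖ × t ℕ.* ‖ adjTrace Y k (+ t) ‖ ≤ K ℕ.* ‖ charPoly Y (+ t) ‖)
adjTrace-dominated {n} Y β Y≤β k = K ℕ.* 2 , T , λ t T≤t →
  let 0<t , β≤t , t^n≤2d = grow t T≤t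
      d = ‖ charPoly Y (+ t) ‖
  in ℕ.*-cancelˡ-< 2 0 d (ℕ.<-≤-trans (ℕ.>-nonZero⁻¹ (t ℕ.^ n) {{ℕ.m^n≢0 t n {{ℕ.>-nonZero 0<t}}}}) t^n≤2d) ,
     ℕ.≤-trans (Growth.adjTrace-bound Y β Y≤β k β≤t)
       (ℕ.≤-trans (ℕ.*-monoʳ-≤ K t^n≤2d) (ℕ.≤-reflexive (sym (ℕ.*-assoc K 2 d))))
  where
  T = proj₁ (charPoly-growth Y β Y≤β)
  grow = proj₂ (charPoly-growth Y β Y≤β)
  K = n ℕ.* ((n ℕ.* β) ℕ.^ k ℕ.* Growth.F Y β Y≤β)

entry-bound : ∀ {n} (f : Vector n) → ∃[ b ] (∀ j → ‖ f j ‖ ≤ b)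
entry-bound {zero} f = 0 , λ ()
entry-bound {suc n} f = let b , f≤b = entry-bound (f ∘ suc) in ‖ f zero ‖ ℕ.+ b ,
  λ { zero → ℕ.m≤m+n ‖ f zero ‖ b ; (suc j) → ℕ.≤-trans (f≤b j) (ℕ.m≤n+m b ‖ f zero ‖) }

matrix-bound : ∀ {m n} (M : Fin m → Vector n) → ∃[ b ] (∀ i j → ‖ M i j ‖ ≤ b)
matrix-bound {zero} M = 0 , λ ()
matrix-bound {suc m} M =
  let b , M≤b = matrix-bound (M ∘ suc)
      c , r≤c = entry-bound (M zero)
  in c ℕ.+ b , λ { zero j → ℕ.≤-trans (r≤c j) (ℕ.m≤m+n c b) ; (suc i) j → ℕ.≤-trans (M≤b i j) (ℕ.m≤n+m b c) }

-- The orders `m` and `n` may differ a priori; their equality is the case `k = 0` of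
-- `trace-power-equal`.
module SameCharPoly {m n} (Y : Matrix m) (Z : Matrix n) (same : ∀ t → charPoly Y t ≡ charPoly Z t) where

  -- By the expansions at `t + h`, the difference of the two derivatives is a multiple of `h`, for
  -- every nonzero `h`. An `h` exceeding its absolute value by one makes it zero.
  adjTrace₀-equal : ∀ t → adjTrace Y 0 t ≡ adjTrace Z 0 t
  adjTrace₀-equal t = ℤ.i-j≡0⇒i≡j y z (multiple-bounded⇒0′ (y - z) h refl (e′ - e) (ℤ.*-cancelˡ-≡ h (y - z) (h * (e′ - e)) (begin
    h * (y - z)
      ≡⟨ solve 5 (λ h y z d e → h :* (y :- z) := (d :+ h :* y :+ h :* h :* e) :- (d :+ h :* z :+ h :* h :* e)) refl h y z (charPoly Y t) e ⟩
    (charPoly Y t + h * y + h * h * e) - (charPoly Y t + h * z + h * h * e)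
      ≡⟨ cong₂ (λ a b → a - (b + h * z + h * h * e)) (sym eq) (same t) ⟩
    charPoly Y (t + h) - (charPoly Z t + h * z + h * h * e)
      ≡⟨ cong (_- (charPoly Z t + h * z + h * h * e)) (trans (same (t + h)) eq′) ⟩
    (charPoly Z t + h * z + h * h * e′) - (charPoly Z t + h * z + h * h * e)
      ≡⟨ solve 5 (λ h d z e e′ → (d :+ h :* z :+ h :* h :* e′) :- (d :+ h :* z :+ h :* h :* e) := h :* (h :* (e′ :- e))) refl h (charPoly Z t) z e e′ ⟩
    h * (h * (e′ - e)) ∎)))
    where
    open ≡-Reasoning
    y = adjTrace Y 0 t
    z = adjTrace Z 0 t
    h = + suc ‖ y - z ‖
    e = proj₁ (adjTrace₀-expansion Y t h)
    eq = proj₂ (adjTrace₀-expansion Y t h)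
    e′ = proj₁ (adjTrace₀-expansion Z t h)
    eq′ = proj₂ (adjTrace₀-expansion Z t h)

    multiple-bounded⇒0′ : ∀ δ h → h ≡ + suc ‖ δ ‖ → ∀ q → δ ≡ h * q → δ ≡ 0ℤ
    multiple-bounded⇒0′ δ h refl q δ≡hq = trans δ≡hq (trans (cong (h *_) (multiple-bounded⇒0 q ‖ δ ‖
      (ℕ.≤-reflexive (trans (sym (ℤ.abs-* h q)) (cong ‖_‖ (sym δ≡hq)))))) (ℤ.*-zeroʳ h))

  -- By `adjTrace-suc`, `(τ - σ) * d` is a difference of two adjugate traces, each at most a
  -- constant times `d` over `t`. For `t` beyond the sum of the constants this leaves `τ - σ` no
  -- nonzero integer value.
  trace-step : ∀ k → (∀ t → adjTrace Y k t ≡ adjTrace Z k t) → trace-power Y k ≡ trace-power Z k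
  trace-step k eq = ℤ.i-j≡0⇒i≡j τ σ (multiple-bounded⇒0 (τ - σ) K′ (ℕ.≤-trans (ℕ.*-monoˡ-≤ ‖ τ - σ ‖ K′<t)
    (ℕ.*-cancelʳ-≤ (t ℕ.* ‖ τ - σ ‖) K′ ‖ d ‖ {{ℕ.>-nonZero (proj₁ boundY)}} (begin
      t ℕ.* ‖ τ - σ ‖ ℕ.* ‖ d ‖
        ≡⟨ trans (ℕ.*-assoc t ‖ τ - σ ‖ ‖ d ‖) (cong (t ℕ.*_) (sym (ℤ.abs-* (τ - σ) d))) ⟩
      t ℕ.* ‖ (τ - σ) * d ‖
        ≡⟨ cong (λ x → t ℕ.* ‖ x ‖) diff ⟩
      t ℕ.* ‖ z - y ‖
        ≤⟨ ℕ.*-monoʳ-≤ t (∣i-j∣≤∣i∣+∣j∣ z y) ⟩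
      t ℕ.* (‖ z ‖ ℕ.+ ‖ y ‖)
        ≡⟨ ℕ.*-distribˡ-+ t ‖ z ‖ ‖ y ‖ ⟩
      t ℕ.* ‖ z ‖ ℕ.+ t ℕ.* ‖ y ‖
        ≤⟨ ℕ.+-mono-≤ (proj₂ boundZ) (proj₂ boundY) ⟩
      L ℕ.* ‖ charPoly Z (+ t) ‖ ℕ.+ K ℕ.* ‖ d ‖
        ≡⟨ cong (λ x → L ℕ.* ‖ x ‖ ℕ.+ K ℕ.* ‖ d ‖) (sym (same (+ t))) ⟩
      L ℕ.* ‖ d ‖ ℕ.+ K ℕ.* ‖ d ‖
        ≡⟨ ℕ.*-distribʳ-+ ‖ d ‖ L K ⟨
      K′ ℕ.* ‖ d ‖ ∎))))
    where
    open ℕ.≤-Reasoning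
    bY = matrix-bound Y
    bZ = matrix-bound Z
    domY = adjTrace-dominated Y (proj₁ bY) (proj₂ bY) (suc k)
    domZ = adjTrace-dominated Z (proj₁ bZ) (proj₂ bZ) (suc k)
    K = proj₁ domY
    L = proj₁ domZ
    K′ = L ℕ.+ K
    TY = proj₁ (proj₂ domY)
    TZ = proj₁ (proj₂ domZ)
    t = suc K′ ℕ.+ (TY ℕ.+ TZ)
    K′<t : suc K′ ≤ t
    K′<t = ℕ.m≤m+n (suc K′) (TY ℕ.+ TZ)
    boundY = proj₂ (proj₂ domY) t (ℕ.≤-trans (ℕ.m≤m+n TY TZ) (ℕ.m≤n+m (TY ℕ.+ TZ) (suc K′)))
    boundZ = proj₂ (proj₂ domZ) t (ℕ.≤-trans (ℕ.m≤n+m TZ TY) (ℕ.m≤n+m (TY ℕ.+ TZ) (suc K′)))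
    d = charPoly Y (+ t)
    τ = trace-power Y k
    σ = trace-power Z k
    y = adjTrace Y (suc k) (+ t)
    z = adjTrace Z (suc k) (+ t)
    diff : (τ - σ) * d ≡ z - y
    diff = trans (solve 5 (λ τ σ d y z → (τ :- σ) :* d := (d :* τ :+ y) :- (d :* σ :+ z) :+ (z :- y)) refl τ σ d y z)
      (trans (cong₂ (λ a b → a - b + (z - y)) (sym (adjTrace-suc Y k (+ t)))
        (trans (cong (λ x → x * σ + z) (same (+ t))) (sym (adjTrace-suc Z k (+ t)))))
      (trans (cong (λ x → + t * x - + t * adjTrace Z k (+ t) + (z - y)) (eq (+ t)))
        (solve 2 (λ a b → a :- a :+ b := b) refl (+ t * adjTrace Z k (+ t)) (z - y))))

  adjTrace-equal : ∀ k t → adjTrace Y k t ≡ adjTrace Z k t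
  adjTrace-equal zero t = adjTrace₀-equal t
  adjTrace-equal (suc k) t = begin
    adjTrace Y (suc k) t
      ≡⟨ solve 2 (λ a b → b := (a :+ b) :- a) refl (charPoly Y t * trace-power Y k) (adjTrace Y (suc k) t) ⟩
    (charPoly Y t * trace-power Y k + adjTrace Y (suc k) t) - charPoly Y t * trace-power Y k
      ≡⟨ cong₂ _-_ (sym (adjTrace-suc Y k t)) (cong₂ _*_ (same t) (trace-step k (adjTrace-equal k))) ⟩
    t * adjTrace Y k t - charPoly Z t * trace-power Z k
      ≡⟨ cong (λ x → t * x - charPoly Z t * trace-power Z k) (adjTrace-equal k t) ⟩
    t * adjTrace Z k t - charPoly Z t * trace-power Z k
      ≡⟨ cong (_- charPoly Z t * trace-power Z k) (adjTrace-suc Z k t) ⟩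
    (charPoly Z t * trace-power Z k + adjTrace Z (suc k) t) - charPoly Z t * trace-power Z k
      ≡⟨ solve 2 (λ a b → b := (a :+ b) :- a) refl (charPoly Z t * trace-power Z k) (adjTrace Z (suc k) t) ⟨
    adjTrace Z (suc k) t ∎
    where open ≡-Reasoning

  trace-power-equal : ∀ k → trace-power Y k ≡ trace-power Z k
  trace-power-equal k = trace-step k (adjTrace-equal k)

-- From real to integer characteristic polynomials

-- The second argument of `mkℚᵘ` is the denominator minus one. Going through unnormalised fractions
-- keeps reduction to lowest terms out of the homomorphism laws.
integer : ℤ → ℚ.ℚ
integer z = ℚ.fromℚᵘ (ℚᵘ.mkℚᵘ z 0)

integer-+ : ∀ a b → integer (a + b) ≡ integer a ℚ.+ integer b
integer-+ a b = ℚ.toℚᵘ-injective (begin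
  ℚ.toℚᵘ (integer (a + b)) ≈⟨ ℚ.toℚᵘ-fromℚᵘ _ ⟩
  ℚᵘ.mkℚᵘ (a + b) 0 ≈⟨ ℚᵘ.*≡* (solve 2 (λ a b → (a :+ b) :* num 1 := (a :* num 1 :+ b :* num 1) :* num 1) refl a b) ⟩
  ℚᵘ.mkℚᵘ a 0 ℚᵘ.+ ℚᵘ.mkℚᵘ b 0 ≈⟨ ℚᵘ.+-cong (ℚ.toℚᵘ-fromℚᵘ (ℚᵘ.mkℚᵘ a 0)) (ℚ.toℚᵘ-fromℚᵘ (ℚᵘ.mkℚᵘ b 0)) ⟨
  ℚ.toℚᵘ (integer a) ℚᵘ.+ ℚ.toℚᵘ (integer b) ≈⟨ ℚ.toℚᵘ-homo-+ (integer a) (integer b) ⟨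
  ℚ.toℚᵘ (integer a ℚ.+ integer b) ∎)
  where open ℚᵘ.≃-Reasoning

integer-* : ∀ a b → integer (a * b) ≡ integer a ℚ.* integer b
integer-* a b = ℚ.toℚᵘ-injective (begin
  ℚ.toℚᵘ (integer (a * b)) ≈⟨ ℚ.toℚᵘ-fromℚᵘ _ ⟩
  ℚᵘ.mkℚᵘ a 0 ℚᵘ.* ℚᵘ.mkℚᵘ b 0 ≈⟨ ℚᵘ.*-cong (ℚ.toℚᵘ-fromℚᵘ (ℚᵘ.mkℚᵘ a 0)) (ℚ.toℚᵘ-fromℚᵘ (ℚᵘ.mkℚᵘ b 0)) ⟨
  ℚ.toℚᵘ (integer a) ℚᵘ.* ℚ.toℚᵘ (integer b) ≈⟨ ℚ.toℚᵘ-homo-* (integer a) (integer b) ⟨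
  ℚ.toℚᵘ (integer a ℚ.* integer b) ∎)
  where open ℚᵘ.≃-Reasoning

integer-neg : ∀ a → integer (- a) ≡ ℚ.- integer a
integer-neg a = ℚ.toℚᵘ-injective (begin
  ℚ.toℚᵘ (integer (- a)) ≈⟨ ℚ.toℚᵘ-fromℚᵘ _ ⟩
  ℚᵘ.- ℚᵘ.mkℚᵘ a 0 ≈⟨ ℚᵘ.-‿cong (ℚ.toℚᵘ-fromℚᵘ _) ⟨
  ℚᵘ.- ℚ.toℚᵘ (integer a) ≈⟨ ℚ.toℚᵘ-homo‿- (integer a) ⟨
  ℚ.toℚᵘ (ℚ.- integer a) ∎)
  where open ℚᵘ.≃-Reasoning

integer-injective : ∀ a b → integer a ≡ integer b → a ≡ b
integer-injective a b eq with ℚᵘ.≃-trans (ℚᵘ.≃-sym (ℚ.toℚᵘ-fromℚᵘ (ℚᵘ.mkℚᵘ a 0)))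
          (ℚᵘ.≃-trans (ℚᵘ.≃-reflexive (cong ℚ.toℚᵘ eq)) (ℚ.toℚᵘ-fromℚᵘ (ℚᵘ.mkℚᵘ b 0)))
... | ℚᵘ.*≡* a1≡b1 = trans (sym (ℤ.*-identityʳ a)) (trans a1≡b1 (ℤ.*-identityʳ b))

pointwise-≈ : ∀ x y → (∀ n → seq x n ≡ seq y n) → x ≈ y
pointwise-≈ x y x≗y = mk≈ (mkClose λ ε 0<ε →
  let N , close′ = near (cauchy x) ε 0<ε
  in N , λ m n N≤m N≤n → subst (λ q → ℚ.∣ seq x m ℚ.- q ∣ ℚ.< ε) (x≗y n) (close′ m n N≤m N≤n))

ι : ℤ → ℝ
ι z = fromℚ (integer z)

-- Constant sequences never come closer than `∣ p - q ∣`, and decidable equality on ℚ makes this a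
-- positive ε when `p` and `q` differ.
fromℚ-injective : ∀ p q → fromℚ p ≈ fromℚ q → p ≡ q
fromℚ-injective p q p≈q with p ℚ.≟ q
... | yes p≡q = p≡q
... | no p≢q = contradiction (proj₂ far N N ℕ.≤-refl ℕ.≤-refl) (ℚ.<-irrefl refl)
  where
  0<∣p-q∣ : ℚ.0ℚ ℚ.< ℚ.∣ p ℚ.- q ∣
  0<∣p-q∣ = ℚ.≰⇒> λ ∣p-q∣≤0 →
    p≢q (trans (p≡[p-q]+q p q) (trans (cong (ℚ._+ q) (ℚ.∣p∣≡0⇒p≡0 (p ℚ.- q) (ℚ.≤-antisym ∣p-q∣≤0 (ℚ.0≤∣p∣ (p ℚ.- q))))) (ℚ.+-identityˡ q)))
    where
    p≡[p-q]+q : ∀ p q → p ≡ (p ℚ.- q) ℚ.+ q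
    p≡[p-q]+q p q = sym (trans (ℚ.+-assoc p (ℚ.- q) q) (trans (cong (p ℚ.+_) (ℚ.+-inverseˡ q)) (ℚ.+-identityʳ p)))
  far = near (_≈_.close p≈q) ℚ.∣ p ℚ.- q ∣ 0<∣p-q∣
  N = proj₁ far

ι-injective : ∀ a b → ι a ≈ ι b → a ≡ b
ι-injective a b ιa≈ιb = integer-injective a b (fromℚ-injective (integer a) (integer b) ιa≈ιb)

ι-+ : ∀ a b → ι (a + b) ≈ ι a R.+ ι b
ι-+ a b = pointwise-≈ _ _ λ _ → integer-+ a b

ι-* : ∀ a b → ι (a * b) ≈ ι a R.* ι b
ι-* a b = pointwise-≈ _ _ λ _ → integer-* a b

ι-neg : ∀ a → ι (- a) ≈ R.- ι a
ι-neg a = pointwise-≈ _ _ λ _ → integer-neg a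

ι-sum : ∀ {n} (f : Vector n) (g : Fin n → ℝ) → (∀ i → g i ≈ ι (f i)) → ℝΣ.sum g ≈ ι (sum f)
ι-sum {zero} f g eq = R.refl
ι-sum {suc n} f g eq = R.trans (R.+-cong (eq zero) (ι-sum (f ∘ suc) (g ∘ suc) (eq ∘ suc))) (R.sym (ι-+ (f zero) (sum (f ∘ suc))))

ι-sign : ∀ {n} (j : Fin n) → (R.- R.1#) ℝE.^ toℕ j ≈ ι (sign j)
ι-sign zero = R.refl
ι-sign (suc j) = R.trans (R.*-cong (R.sym (ι-neg 1ℤ)) (ι-sign j)) (R.sym (ι-* (- 1ℤ) (sign j)))

ι-det : ∀ {n} (M : Matrix n) (N : ℝM.Matrix n) → (∀ i j → N i j ≈ ι (M i j)) → ℝM.det N ≈ ι (det M)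
ι-det {zero} M N eq = R.refl
ι-det {suc n} M N eq = ι-sum (λ j → sign j * (M zero j * det (minor M j))) _ λ j → R.trans
  (R.*-cong (ι-sign j) (R.trans
    (R.*-cong (eq zero j) (ι-det (minor M j) (λ i k → N (suc i) (punchIn j k)) λ i k → eq (suc i) (punchIn j k)))
    (R.sym (ι-* (M zero j) (det (minor M j))))))
  (R.sym (ι-* (sign j) (M zero j * det (minor M j))))

adjacency : (G : Graph) → Matrix (Graph.order G)
adjacency G i j = if ⌊ from i ∼? from j ⌋ then 1ℤ else 0ℤ
  where
  open Graph G
  open Inverse enum using (from)

ι-if : ∀ b → (if b then R.1# else R.0#) ≈ ι (if b then 1ℤ else 0ℤ)
ι-if true = R.refl
ι-if false = R.refl

ι-charPoly : ∀ G t → ℝM.charPoly (adjacencyMatrix G) (ι t) ≈ ι (charPoly (adjacency G) t)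
ι-charPoly G t = ι-det (charMatrix (adjacency G) t) _ λ i j → R.sym (R.trans
  (ι-+ (t * identity i j) (- adjacency G i j))
  (R.+-cong
    (R.trans (ι-* t (identity i j)) (R.*-cong R.refl (R.sym (ι-if ⌊ i Fin.≟ j ⌋))))
    (R.trans (ι-neg (adjacency G i j)) (R.-‿cong (R.sym (ι-if ⌊ from i ∼? from j ⌋))))))
  where
  open Graph G
  open Inverse enum using (from)

root-product : ℝ → List ℝ → ℝ
root-product t = foldr (λ θ p → (t R.- θ) R.* p) R.1#

root-product-↭ : ∀ t {θs ηs} → θs ↭ ηs → root-product t θs ≈ root-product t ηs
root-product-↭ t (Permutation.refl eq) = pointwise eq
  where
  pointwise : ∀ {θs ηs} → Pointwise _≈_ θs ηs → root-product t θs ≈ root-product t ηs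
  pointwise [] = R.refl
  pointwise (eq ∷ eqs) = R.*-cong (R.+-cong R.refl (R.-‿cong eq)) (pointwise eqs)
root-product-↭ t (Permutation.prep eq p) = R.*-cong (R.+-cong R.refl (R.-‿cong eq)) (root-product-↭ t p)
root-product-↭ t (Permutation.swap {x = x} {y} {x′} {y′} eq₁ eq₂ p) = R.trans
  (R.sym (R.*-assoc _ _ _)) (R.trans
  (R.*-cong (R.trans (R.*-comm _ _) (R.*-cong (R.+-cong R.refl (R.-‿cong eq₂)) (R.+-cong R.refl (R.-‿cong eq₁)))) (root-product-↭ t p))
  (R.*-assoc _ _ _))
root-product-↭ t (Permutation.trans p q) = R.trans (root-product-↭ t p) (root-product-↭ t q)

cospectral-charPoly : ∀ G H → Cospectral G H → ∀ t → charPoly (adjacency G) t ≡ charPoly (adjacency H) t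
cospectral-charPoly G H (θs , ηs , specG , specH , θs↭ηs) t = ι-injective _ _
  (R.trans (R.sym (ι-charPoly G t)) (R.trans (specG (ι t)) (R.trans (root-product-↭ (ι t) θs↭ηs)
    (R.trans (R.sym (specH (ι t))) (ι-charPoly H t)))))

-- Polynomials in a symmetric matrix

dot : ∀ {n} → Vector n → Vector n → ℤ
dot x y = sum (λ i → x i * y i)

dot-cong : ∀ {n} {x x′ y y′ : Vector n} → (∀ i → x i ≡ x′ i) → (∀ i → y i ≡ y′ i) → dot x y ≡ dot x′ y′
dot-cong x≗x′ y≗y′ = sum-cong λ i → cong₂ _*_ (x≗x′ i) (y≗y′ i)

dot-comm : ∀ {n} (x y : Vector n) → dot x y ≡ dot y x
dot-comm x y = sum-cong λ i → ℤ.*-comm (x i) (y i)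

dot-linearʳ : ∀ {n} c (x y z : Vector n) → dot x (λ i → c * y i + z i) ≡ c * dot x y + dot x z
dot-linearʳ c x y z = trans
  (sum-cong λ i → solve 4 (λ c x y z → x :* (c :* y :+ z) := c :* (x :* y) :+ x :* z) refl c (x i) (y i) (z i))
  (sum-linear c (λ i → x i * y i) (λ i → x i * z i))

dot-linearˡ : ∀ {n} c (x y z : Vector n) → dot (λ i → c * x i + y i) z ≡ c * dot x z + dot y z
dot-linearˡ c x y z = trans (dot-comm (λ i → c * x i + y i) z)
  (trans (dot-linearʳ c z x y) (cong₂ (λ s t → c * s + t) (dot-comm z x) (dot-comm z y)))

dot-unit : ∀ {n} (i : Fin n) x → dot x (unit i) ≡ x i
dot-unit i x = trans (dot-comm x (unit i)) (sum-unit i x)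

infix 4 0≤_

0≤_ : ℤ → Set
0≤ i = 0ℤ ℤ.≤ i

0≤i*i : ∀ i → 0≤ i * i
0≤i*i (+ n) = subst 0≤_ (ℤ.pos-* n n) (ℤ.+≤+ ℕ.z≤n)
0≤i*i ℤ.-[1+ n ] = ℤ.+≤+ ℕ.z≤n

sum-nonneg : ∀ {n} (f : Vector n) → (∀ i → 0≤ f i) → 0≤ sum f
sum-nonneg {zero} f 0≤f = ℤ.≤-refl
sum-nonneg {suc n} f 0≤f = ℤ.+-mono-≤ (0≤f zero) (sum-nonneg (f ∘ suc) (0≤f ∘ suc))

nonneg-sum-zero : ∀ {i j} → 0≤ i → 0≤ j → i + j ≡ 0ℤ → i ≡ 0ℤ × j ≡ 0ℤ
nonneg-sum-zero {i} {j} 0≤i 0≤j eq =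
  ℤ.≤-antisym (ℤ.≤-trans (ℤ.≤-reflexive (sym (ℤ.+-identityʳ i))) (ℤ.≤-trans (ℤ.+-monoʳ-≤ i 0≤j) (ℤ.≤-reflexive eq))) 0≤i ,
  ℤ.≤-antisym (ℤ.≤-trans (ℤ.≤-reflexive (sym (ℤ.+-identityˡ j))) (ℤ.≤-trans (ℤ.+-monoˡ-≤ j 0≤i) (ℤ.≤-reflexive eq))) 0≤j

sum-zero⇒zero : ∀ {n} (f : Vector n) → (∀ i → 0≤ f i) → sum f ≡ 0ℤ → ∀ i → f i ≡ 0ℤ
sum-zero⇒zero {suc n} f 0≤f eq zero = proj₁ (nonneg-sum-zero (0≤f zero) (sum-nonneg (f ∘ suc) (0≤f ∘ suc)) eq)
sum-zero⇒zero {suc n} f 0≤f eq (suc i) = sum-zero⇒zero (f ∘ suc) (0≤f ∘ suc)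
  (proj₂ (nonneg-sum-zero (0≤f zero) (sum-nonneg (f ∘ suc) (0≤f ∘ suc)) eq)) i

i*i≡0⇒i≡0 : ∀ i → i * i ≡ 0ℤ → i ≡ 0ℤ
i*i≡0⇒i≡0 i eq with ℤ.i*j≡0⇒i≡0∨j≡0 i eq
... | inj₁ i≡0 = i≡0
... | inj₂ i≡0 = i≡0

dot-self-nonneg : ∀ {n} (x : Vector n) → 0≤ dot x x
dot-self-nonneg x = sum-nonneg (λ i → x i * x i) (λ i → 0≤i*i (x i))

dot-self-zero : ∀ {n} (x : Vector n) → dot x x ≡ 0ℤ → ∀ i → x i ≡ 0ℤ
dot-self-zero x eq i = i*i≡0⇒i≡0 (x i) (sum-zero⇒zero (λ i → x i * x i) (λ i → 0≤i*i (x i)) eq i)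

-- apply Y (c₁ ∷ … ∷ cₖ ∷ []) x is (Y - c₁) ⋯ (Y - cₖ) x.
apply : ∀ {n} → Matrix n → List ℤ → Vector n → Vector n
apply Y [] x = x
apply Y (c ∷ cs) x i = - c * apply Y cs x i + mat Y (apply Y cs x) i

apply-cong : ∀ {n} (Y : Matrix n) cs {x y} → (∀ j → x j ≡ y j) → ∀ i → apply Y cs x i ≡ apply Y cs y i
apply-cong Y [] x≗y = x≗y
apply-cong Y (c ∷ cs) x≗y i = cong₂ (λ a b → - c * a + b) (apply-cong Y cs x≗y i) (mat-cong Y (apply-cong Y cs x≗y) i)

apply-linear : ∀ {n} (Y : Matrix n) cs k x y i →
          apply Y cs (λ j → k * x j + y j) i ≡ k * apply Y cs x i + apply Y cs y i
apply-linear Y [] k x y i = refl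
apply-linear Y (c ∷ cs) k x y i = trans
  (cong₂ (λ a b → - c * a + b) (apply-linear Y cs k x y i)
    (trans (mat-cong Y (apply-linear Y cs k x y) i) (mat-linear Y k (apply Y cs x) (apply Y cs y) i)))
  (solve 6 (λ c k p q r s → :- c :* (k :* p :+ q) :+ (k :* r :+ s) := k :* (:- c :* p :+ r) :+ (:- c :* q :+ s)) refl
    c k (apply Y cs x i) (apply Y cs y i) (mat Y (apply Y cs x) i) (mat Y (apply Y cs y) i))

-- The value of the functional yᵏ ↦ μ k at yᵏ (y - c₁) ⋯ (y - cₖ).
functional : (ℕ → ℤ) → ℕ → List ℤ → ℤ
functional μ k [] = μ k
functional μ k (c ∷ cs) = - c * functional μ k cs + functional μ (suc k) cs

functionalₚ : ∀ {n} → (ℕ → Polynomial n) → ℕ → List (Polynomial n) → Polynomial n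
functionalₚ μ k [] = μ k
functionalₚ μ k (c ∷ cs) = :- c :* functionalₚ μ k cs :+ functionalₚ μ (suc k) cs

functional-cong : ∀ {μ ν} → (∀ k → μ k ≡ ν k) → ∀ k cs → functional μ k cs ≡ functional ν k cs
functional-cong eq k [] = eq k
functional-cong eq k (c ∷ cs) = cong₂ (λ a b → - c * a + b) (functional-cong eq k cs) (functional-cong eq (suc k) cs)

sum-functional : ∀ {n} (μ : Fin n → ℕ → ℤ) k cs →
          sum (λ a → functional (μ a) k cs) ≡ functional (λ k → sum (λ a → μ a k)) k cs
sum-functional μ k [] = refl
sum-functional μ k (c ∷ cs) = trans
  (sum-linear (- c) (λ a → functional (μ a) k cs) (λ a → functional (μ a) (suc k) cs))
  (cong₂ (λ a b → - c * a + b) (sum-functional μ k cs) (sum-functional μ (suc k) cs))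

module Symmetric {n} (Y : Matrix n) (Y-sym : ∀ i j → Y i j ≡ Y j i) where

  mat-adjoint : ∀ x y → dot (mat Y x) y ≡ dot x (mat Y y)
  mat-adjoint x y = begin
    sum (λ i → mat Y x i * y i)
      ≡⟨ sum-cong (λ i → *-distribʳ-sum (y i) (λ j → Y i j * x j)) ⟩
    sum (λ i → sum (λ j → Y i j * x j * y i))
      ≡⟨ ∑-comm (λ i j → Y i j * x j * y i) ⟩
    sum (λ j → sum (λ i → Y i j * x j * y i))
      ≡⟨ sum-cong (λ j → sum-cong λ i → trans (cong (λ a → a * x j * y i) (Y-sym i j))
          (solve 3 (λ a x y → a :* x :* y := x :* (a :* y)) refl (Y j i) (x j) (y i))) ⟩
    sum (λ j → sum (λ i → x j * (Y j i * y i)))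
      ≡⟨ sum-cong (λ j → *-distribˡ-sum (x j) (λ i → Y j i * y i)) ⟨
    dot x (mat Y y) ∎
    where open ≡-Reasoning

  mat-power : ∀ k x i → mat Y (power Y k x) i ≡ power Y k (mat Y x) i
  mat-power zero x i = refl
  mat-power (suc k) x i = mat-power k (mat Y x) i

  moment : Vector n → ℕ → ℤ
  moment x k = dot (power Y k x) x

  -- Symmetry moves every factor across the inner product, so that only moments remain and
  -- polynomial identities become ring identities between them.
  dot-power-apply : ∀ k cs x → dot (power Y k x) (apply Y cs x) ≡ functional (moment x) k cs
  dot-power-apply k [] x = refl
  dot-power-apply k (c ∷ cs) x = trans (dot-linearʳ (- c) (power Y k x) (apply Y cs x) (mat Y (apply Y cs x)))
    (cong₂ (λ a b → - c * a + b) (dot-power-apply k cs x) (begin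
      dot (power Y k x) (mat Y (apply Y cs x)) ≡⟨ mat-adjoint (power Y k x) (apply Y cs x) ⟨
      dot (mat Y (power Y k x)) (apply Y cs x) ≡⟨ dot-cong (mat-power k x) (λ _ → refl) ⟩
      dot (power Y (suc k) x) (apply Y cs x) ≡⟨ dot-power-apply (suc k) cs x ⟩
      functional (moment x) (suc k) cs ∎))
    where open ≡-Reasoning

  dot-power-apply-apply : ∀ k cs ds x → dot (power Y k (apply Y cs x)) (apply Y ds x) ≡ functional (moment x) k (cs ++ ds)
  dot-power-apply-apply k [] ds x = dot-power-apply k ds x
  dot-power-apply-apply k (c ∷ cs) ds x = begin
    dot (power Y k (apply Y (c ∷ cs) x)) (apply Y ds x)
      ≡⟨ dot-cong (power-linear Y k (- c) (apply Y cs x) (mat Y (apply Y cs x))) (λ _ → refl) ⟩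
    dot (λ i → - c * power Y k (apply Y cs x) i + power Y (suc k) (apply Y cs x) i) (apply Y ds x)
      ≡⟨ dot-linearˡ (- c) (power Y k (apply Y cs x)) (power Y (suc k) (apply Y cs x)) (apply Y ds x) ⟩
    - c * dot (power Y k (apply Y cs x)) (apply Y ds x) + dot (power Y (suc k) (apply Y cs x)) (apply Y ds x)
      ≡⟨ cong₂ (λ a b → - c * a + b) (dot-power-apply-apply k cs ds x) (dot-power-apply-apply (suc k) cs ds x) ⟩
    functional (moment x) k (c ∷ cs ++ ds) ∎
    where open ≡-Reasoning

  functional-square : ∀ cs x → functional (moment x) 0 (cs ++ cs) ≡ dot (apply Y cs x) (apply Y cs x)
  functional-square cs x = sym (dot-power-apply-apply 0 cs cs x)

  functional-square-nonneg : ∀ cs x → 0≤ functional (moment x) 0 (cs ++ cs)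
  functional-square-nonneg cs x = subst 0≤_ (sym (functional-square cs x)) (dot-self-nonneg (apply Y cs x))

  trace-square : ∀ cs → sum (λ a → dot (apply Y cs (unit a)) (apply Y cs (unit a))) ≡ functional (trace-power Y) 0 (cs ++ cs)
  trace-square cs = begin
    sum (λ a → dot (apply Y cs (unit a)) (apply Y cs (unit a)))
      ≡⟨ sum-cong (λ a → functional-square cs (unit a)) ⟨
    sum (λ a → functional (moment (unit a)) 0 (cs ++ cs))
      ≡⟨ sum-functional (λ a → moment (unit a)) 0 (cs ++ cs) ⟩
    functional (λ k → sum (λ a → moment (unit a) k)) 0 (cs ++ cs)
      ≡⟨ functional-cong (λ k → sum-cong λ a → dot-unit a (power Y k (unit a))) 0 (cs ++ cs) ⟩
    functional (trace-power Y) 0 (cs ++ cs) ∎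
    where open ≡-Reasoning

  -- The hypothesis is a vanishing sum of squared norms of columns; it kills unit vectors, and
  -- linearity does the rest. Being a condition on traces, it can be transferred between cospectral
  -- matrices.
  apply-zero : ∀ cs → functional (trace-power Y) 0 (cs ++ cs) ≡ 0ℤ → ∀ x i → apply Y cs x i ≡ 0ℤ
  apply-zero cs tr≡0 x i = begin
    apply Y cs x i
      ≡⟨ linear-expansion (λ x → apply Y cs x i) (λ x≗y → apply-cong Y cs x≗y i) (λ k x y → apply-linear Y cs k x y i) x ⟨
    sum (λ a → x a * apply Y cs (unit a) i)
      ≡⟨ sum-zero (λ a → x a * apply Y cs (unit a) i) (λ a → trans (cong (x a *_) (vanish a)) (ℤ.*-zeroʳ (x a))) ⟩
    0ℤ ∎
    where
    open ≡-Reasoning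
    vanish : ∀ a → apply Y cs (unit a) i ≡ 0ℤ
    vanish a = dot-self-zero (apply Y cs (unit a))
      (sum-zero⇒zero (λ a → dot (apply Y cs (unit a)) (apply Y cs (unit a)))
        (λ a → dot-self-nonneg (apply Y cs (unit a))) (trans (trace-square cs) tr≡0) a) i

-- Positivity for a symmetric matrix annihilated by a quartic

0≤-cancel : ∀ k i → 0ℤ ℤ.< k → 0≤ k * i → 0≤ i
0≤-cancel k i 0<k 0≤ki = ℤ.*-cancelˡ-≤-pos 0ℤ i k {{ℤ.positive 0<k}} (subst (ℤ._≤ k * i) (sym (ℤ.*-zeroʳ k)) 0≤ki)

0≤-+ : ∀ {i j} → 0≤ i → 0≤ j → 0≤ i + j
0≤-+ = ℤ.+-mono-≤

0≤-* : ∀ {i j} → 0≤ i → 0≤ j → 0≤ i * j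
0≤-* {+ m} {+ n} _ _ = subst 0≤_ (ℤ.pos-* m n) (ℤ.+≤+ ℕ.z≤n)

module FourRoots {n} (Y : Matrix n) (Y-sym : ∀ i j → Y i j ≡ Y j i) (a b c : ℤ)
  (root : ∀ x i → apply Y (c ∷ 0ℤ ∷ a ∷ b ∷ []) x i ≡ 0ℤ)
  (0<κ : 0ℤ ℤ.< a * (b - a) * (c - a)) (0<σ : 0ℤ ℤ.< b * (c - b)) (0<c : 0ℤ ℤ.< c) (0≤ε : 0≤ c - b - a) where

  open Symmetric Y Y-sym

  annihilated : ∀ x k → functional (moment x) k (c ∷ 0ℤ ∷ a ∷ b ∷ []) ≡ 0ℤ
  annihilated x k = trans (sym (dot-power-apply k (c ∷ 0ℤ ∷ a ∷ b ∷ []) x))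
    (sum-zero (λ i → power Y k x i * apply Y (c ∷ 0ℤ ∷ a ∷ b ∷ []) x i)
      (λ i → trans (cong (power Y k x i *_) (root x i)) (ℤ.*-zeroʳ (power Y k x i))))

  -- `functional` peels factors from the head; with `a` in front, the tail is the polynomial `w` of
  -- the next lemma.
  annihilated′ : ∀ x k → functional (moment x) k (a ∷ b ∷ c ∷ 0ℤ ∷ []) ≡ 0ℤ
  annihilated′ x k = trans (solve 8
    (λ a b c m₀ m₁ m₂ m₃ m₄ →
      let ℓ = functionalₚ λ { 0 → m₀ ; 1 → m₁ ; 2 → m₂ ; 3 → m₃ ; _ → m₄ }
      in ℓ 0 (a ∷ b ∷ c ∷ num 0 ∷ []) := ℓ 0 (c ∷ num 0 ∷ a ∷ b ∷ []))
    refl a b c (μ k) (μ (1 ℕ.+ k)) (μ (2 ℕ.+ k)) (μ (3 ℕ.+ k)) (μ (4 ℕ.+ k))) (annihilated x k)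
    where μ = moment x

  -- w = y (y - b) (y - c) vanishes at every root but a, so that w² is a
  -- positive multiple of w modulo the minimal polynomial.
  w-nonneg : ∀ x → 0≤ functional (moment x) 0 (b ∷ c ∷ 0ℤ ∷ [])
  w-nonneg x = 0≤-cancel (a * (b - a) * (c - a)) (ℓ 0 w) 0<κ (subst 0≤_ (w² 0) (functional-square-nonneg w x))
    where
    w = b ∷ c ∷ 0ℤ ∷ []
    ℓ = functional (moment x)
    -- `(y - a) w` is the annihilated quartic, so `y` acts on `w` as the scalar `a`, and every
    -- further factor `y - d` as `a - d`.
    0w : ∀ k → ℓ k (0ℤ ∷ w) ≡ a * ℓ k w
    0w k = trans (solve 3 (λ a p q → :- num 0 :* p :+ q := (:- a :* p :+ q) :+ a :* p) refl a (ℓ k w) (ℓ (suc k) w))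
      (trans (cong (_+ a * ℓ k w) (annihilated′ x k)) (ℤ.+-identityˡ (a * ℓ k w)))
    scale : ∀ d m cs → (∀ k → ℓ k cs ≡ m * ℓ k w) → ∀ k → ℓ k (d ∷ cs) ≡ (a - d) * m * ℓ k w
    scale d m cs eq k = trans (cong₂ (λ p q → - d * p + q) (eq k) (eq (suc k)))
      (trans (solve 5 (λ a d m p q → :- d :* (m :* p) :+ m :* q := (a :- d) :* m :* p :+ m :* (:- a :* p :+ q)) refl a d m (ℓ k w) (ℓ (suc k) w))
        (trans (cong (λ z → (a - d) * m * ℓ k w + m * z) (annihilated′ x k))
          (solve 2 (λ p m → p :+ m :* num 0 := p) refl ((a - d) * m * ℓ k w) m)))
    w² : ∀ k → ℓ k (b ∷ c ∷ 0ℤ ∷ w) ≡ a * (b - a) * (c - a) * ℓ k w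
    w² k = trans (scale b ((a - c) * a) (c ∷ 0ℤ ∷ w) (scale c a (0ℤ ∷ w) 0w) k)
      (cong (_* ℓ k w) (solve 3 (λ a b c → (a :- b) :* ((a :- c) :* a) := a :* (b :- a) :* (c :- a)) refl a b c))

  -- s = y (c - y) vanishes at 0 and c, and s² = b (c - b) s - (c - b - a) w.
  s-nonneg : ∀ x → 0≤ - functional (moment x) 0 (c ∷ 0ℤ ∷ [])
  s-nonneg x = 0≤-cancel (b * (c - b)) (- functional μ 0 (c ∷ 0ℤ ∷ [])) 0<σ
    (subst 0≤_ eq (0≤-+ (functional-square-nonneg (c ∷ 0ℤ ∷ []) x) (0≤-* 0≤ε (w-nonneg x))))
    where
    μ = moment x
    W = functional μ 0 (b ∷ c ∷ 0ℤ ∷ [])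
    ρ = functional μ 0 (c ∷ 0ℤ ∷ a ∷ b ∷ [])
    eq : functional μ 0 (c ∷ 0ℤ ∷ c ∷ 0ℤ ∷ []) + (c - b - a) * W ≡ b * (c - b) * (- functional μ 0 (c ∷ 0ℤ ∷ []))
    eq = trans
      (solve 8 (λ a b c m₀ m₁ m₂ m₃ m₄ →
        let o = num 0
            ℓ = functionalₚ λ { 0 → m₀ ; 1 → m₁ ; 2 → m₂ ; 3 → m₃ ; _ → m₄ }
        in ℓ 0 (c ∷ o ∷ c ∷ o ∷ []) :+ (c :- b :- a) :* ℓ 0 (b ∷ c ∷ o ∷ []) :=
          b :* (c :- b) :* (:- ℓ 0 (c ∷ o ∷ [])) :+ ℓ 0 (c ∷ o ∷ a ∷ b ∷ []))
        refl a b c (μ 0) (μ 1) (μ 2) (μ 3) (μ 4))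
      (trans (cong (_+_ (b * (c - b) * (- functional μ 0 (c ∷ 0ℤ ∷ [])))) (annihilated x 0)) (ℤ.+-identityʳ _))

  -- From `c y = y² + y (c - y)`: the first term is a square, the second is `s`.
  positive-semidefinite : ∀ x → 0≤ dot (mat Y x) x
  positive-semidefinite x = 0≤-cancel c (moment x 1) 0<c
    (subst 0≤_ eq (0≤-+ (functional-square-nonneg (0ℤ ∷ []) x) (s-nonneg x)))
    where
    eq : functional (moment x) 0 (0ℤ ∷ 0ℤ ∷ []) + - functional (moment x) 0 (c ∷ 0ℤ ∷ []) ≡ c * moment x 1
    eq = solve 4 (λ c m₀ m₁ m₂ →
      let o = num 0
          ℓ = functionalₚ λ { 0 → m₀ ; 1 → m₁ ; _ → m₂ }
      in ℓ 0 (o ∷ o ∷ []) :+ :- ℓ 0 (c ∷ o ∷ []) := c :* m₁) refl c (moment x 0) (moment x 1) (moment x 2)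

  -- c is the largest root, so only eigenvectors attain the bound c.
  largest-root-attained : ∀ x → dot (mat Y x) x ≡ c * dot x x → ∀ i → mat Y x i ≡ c * x i
  largest-root-attained x eq i = ℤ.i-j≡0⇒i≡j (mat Y x i) (c * x i) (trans
    (solve 3 (λ c y x → y :- c :* x := :- c :* x :+ y) refl c (mat Y x i) (x i))
    (dot-self-zero (apply Y (c ∷ []) x) (trans (sym (functional-square (c ∷ []) x))
      (proj₁ (nonneg-sum-zero (functional-square-nonneg (c ∷ []) x) (s-nonneg x) total))) i))
    where
    -- `(y - c)² + y (c - y) = c (c - y)`, which has value zero by hypothesis, so both nonnegative
    -- terms on the left vanish.
    total : functional (moment x) 0 (c ∷ c ∷ []) + - functional (moment x) 0 (c ∷ 0ℤ ∷ []) ≡ 0ℤ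
    total = trans
      (solve 4 (λ c m₀ m₁ m₂ →
        let ℓ = functionalₚ λ { 0 → m₀ ; 1 → m₁ ; _ → m₂ }
        in ℓ 0 (c ∷ c ∷ []) :+ :- ℓ 0 (c ∷ num 0 ∷ []) := c :* (c :* m₀ :- m₁)) refl c (moment x 0) (moment x 1) (moment x 2))
      (trans (cong (λ m → c * (c * moment x 0 - m)) eq)
        (solve 2 (λ c m → c :* (c :* m :- c :* m) := num 0) refl c (moment x 0)))

-- The Johnson graph J(v,3)

ind : ∀ {P : Set} → Dec P → ℤ
ind P? = if ⌊ P? ⌋ then 1ℤ else 0ℤ

ind-yes : ∀ {P : Set} (P? : Dec P) → P → ind P? ≡ 1ℤ
ind-yes (yes _) p = refl
ind-yes (no ¬p) p = contradiction p ¬p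

ind-no : ∀ {P : Set} (P? : Dec P) → ¬ P → ind P? ≡ 0ℤ
ind-no (yes p) ¬p = contradiction p ¬p
ind-no (no _) ¬p = refl

ind-cong : ∀ {P Q : Set} → (P → Q) → (Q → P) → (P? : Dec P) (Q? : Dec Q) → ind P? ≡ ind Q?
ind-cong to from (yes p) Q? = sym (ind-yes Q? (to p))
ind-cong to from (no ¬p) Q? = sym (ind-no Q? (¬p ∘ from))

ind-× : ∀ {P Q : Set} (P? : Dec P) (Q? : Dec Q) → ind P? * ind Q? ≡ ind (P? ×-dec Q?)
ind-× (yes _) (yes _) = refl
ind-× (yes _) (no _) = refl
ind-× (no _) (yes _) = refl
ind-× (no _) (no _) = refl

SubsetFunction : ℕ → Set
SubsetFunction v = Subset v → ℤ

_⁺ _⁻ : ∀ {v} → SubsetFunction (suc v) → SubsetFunction v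
f ⁺ = f ∘ (true ∷_)
f ⁻ = f ∘ (false ∷_)

Σₛ : ∀ {v} → SubsetFunction v → ℤ
Σₛ {zero} f = f []
Σₛ {suc v} f = Σₛ (f ⁺) + Σₛ (f ⁻)

Σₛ-cong : ∀ {v} {f g : SubsetFunction v} → (∀ s → f s ≡ g s) → Σₛ f ≡ Σₛ g
Σₛ-cong {zero} f≗g = f≗g []
Σₛ-cong {suc v} f≗g = cong₂ _+_ (Σₛ-cong (f≗g ∘ (true ∷_))) (Σₛ-cong (f≗g ∘ (false ∷_)))

Σₛ-zero : ∀ {v} (f : SubsetFunction v) → (∀ s → f s ≡ 0ℤ) → Σₛ f ≡ 0ℤ
Σₛ-zero {zero} f f≗0 = f≗0 []
Σₛ-zero {suc v} f f≗0 = cong₂ _+_ (Σₛ-zero (f ⁺) (f≗0 ∘ (true ∷_))) (Σₛ-zero (f ⁻) (f≗0 ∘ (false ∷_)))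

Σₛ-+ : ∀ {v} (f g : SubsetFunction v) → Σₛ (λ s → f s + g s) ≡ Σₛ f + Σₛ g
Σₛ-+ {zero} f g = refl
Σₛ-+ {suc v} f g = trans (cong₂ _+_ (Σₛ-+ (f ⁺) (g ⁺)) (Σₛ-+ (f ⁻) (g ⁻)))
  (solve 4 (λ a b c d → (a :+ b) :+ (c :+ d) := (a :+ c) :+ (b :+ d)) refl
    (Σₛ (f ⁺)) (Σₛ (g ⁺)) (Σₛ (f ⁻)) (Σₛ (g ⁻)))

Σₛ-* : ∀ {v} c (f : SubsetFunction v) → Σₛ (λ s → c * f s) ≡ c * Σₛ f
Σₛ-* {zero} c f = refl
Σₛ-* {suc v} c f = trans (cong₂ _+_ (Σₛ-* c (f ⁺)) (Σₛ-* c (f ⁻))) (sym (ℤ.*-distribˡ-+ c _ _))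

sum-Σₛ : ∀ {n v} (f : Fin n → SubsetFunction v) → sum (λ j → Σₛ (f j)) ≡ Σₛ (λ s → sum (λ j → f j s))
sum-Σₛ {n} {zero} f = refl
sum-Σₛ {n} {suc v} f = trans (∑-distrib-+ (λ j → Σₛ (f j ∘ (true ∷_))) (λ j → Σₛ (f j ∘ (false ∷_))))
  (cong₂ _+_ (sum-Σₛ (λ j → f j ∘ (true ∷_))) (sum-Σₛ (λ j → f j ∘ (false ∷_))))

_≟ₛ_ : ∀ {v} (s t : Subset v) → Dec (s ≡ t)
_≟ₛ_ = ≡-dec Bool._≟_

Σₛ-δ : ∀ {v} (f : SubsetFunction v) s → Σₛ (λ t → ind (t ≟ₛ s) * f t) ≡ f s
Σₛ-δ f [] = trans (cong (_* f []) (ind-yes ([] ≟ₛ []) refl)) (ℤ.*-identityˡ (f []))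
Σₛ-δ f (true ∷ s) = trans (cong₂ _+_
  (trans (Σₛ-cong λ t → cong (_* f (true ∷ t)) (ind-cong (λ { refl → refl }) (λ { refl → refl }) ((true ∷ t) ≟ₛ (true ∷ s)) (t ≟ₛ s)))
         (Σₛ-δ (f ⁺) s))
  (Σₛ-zero (λ t → ind ((false ∷ t) ≟ₛ (true ∷ s)) * f (false ∷ t))
    λ t → trans (cong (_* f (false ∷ t)) (ind-no ((false ∷ t) ≟ₛ (true ∷ s)) λ ())) (ℤ.*-zeroˡ (f (false ∷ t)))))
  (ℤ.+-identityʳ _)
Σₛ-δ f (false ∷ s) = trans (cong₂ _+_
  (Σₛ-zero (λ t → ind ((true ∷ t) ≟ₛ (false ∷ s)) * f (true ∷ t))
    λ t → trans (cong (_* f (true ∷ t)) (ind-no ((true ∷ t) ≟ₛ (false ∷ s)) λ ())) (ℤ.*-zeroˡ (f (true ∷ t))))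
  (trans (Σₛ-cong λ t → cong (_* f (false ∷ t)) (ind-cong (λ { refl → refl }) (λ { refl → refl }) ((false ∷ t) ≟ₛ (false ∷ s)) (t ≟ₛ s)))
         (Σₛ-δ (f ⁻) s)))
  (ℤ.+-identityˡ _)

-- The incidence operators of the Boolean lattice, for all sizes at once: `up` sums over deletions
-- of one element, `down` over additions. Recursion on the ground set turns each identity below into
-- an induction on `v`.
up down : ∀ {v} → SubsetFunction v → SubsetFunction v
up f [] = 0ℤ
up f (true ∷ s) = f (false ∷ s) + up (f ⁺) s
up f (false ∷ s) = up (f ⁻) s
down f [] = 0ℤ
down f (true ∷ s) = down (f ⁺) s
down f (false ∷ s) = f (true ∷ s) + down (f ⁻) s

up-linear : ∀ {v} c (f g : SubsetFunction v) s → up (λ t → c * f t + g t) s ≡ c * up f s + up g s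
up-linear c f g [] = solve 1 (λ c → num 0 := c :* num 0 :+ num 0) refl c
up-linear c f g (true ∷ s) = trans (cong (_+_ (c * f (false ∷ s) + g (false ∷ s))) (up-linear c (f ⁺) (g ⁺) s))
  (solve 5 (λ c p q r s → (c :* p :+ q) :+ (c :* r :+ s) := c :* (p :+ r) :+ (q :+ s)) refl
    c (f (false ∷ s)) (g (false ∷ s)) (up (f ⁺) s) (up (g ⁺) s))
up-linear c f g (false ∷ s) = up-linear c (f ⁻) (g ⁻) s

down-linear : ∀ {v} c (f g : SubsetFunction v) s → down (λ t → c * f t + g t) s ≡ c * down f s + down g s
down-linear c f g [] = solve 1 (λ c → num 0 := c :* num 0 :+ num 0) refl c
down-linear c f g (true ∷ s) = down-linear c (f ⁺) (g ⁺) s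
down-linear c f g (false ∷ s) = trans (cong (_+_ (c * f (true ∷ s) + g (true ∷ s))) (down-linear c (f ⁻) (g ⁻) s))
  (solve 5 (λ c p q r s → (c :* p :+ q) :+ (c :* r :+ s) := c :* (p :+ r) :+ (q :+ s)) refl
    c (f (true ∷ s)) (g (true ∷ s)) (down (f ⁻) s) (down (g ⁻) s))

up-level-cong : ∀ {v} {f g : SubsetFunction v} s → (∀ t → suc ∣ t ∣ ≡ ∣ s ∣ → f t ≡ g t) → up f s ≡ up g s
up-level-cong [] eq = refl
up-level-cong (true ∷ s) eq = cong₂ _+_ (eq (false ∷ s) refl) (up-level-cong s λ t l → eq (true ∷ t) (cong suc l))
up-level-cong (false ∷ s) eq = up-level-cong s λ t l → eq (false ∷ t) l

down-level-cong : ∀ {v} {f g : SubsetFunction v} s → (∀ t → ∣ t ∣ ≡ suc ∣ s ∣ → f t ≡ g t) → down f s ≡ down g s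
down-level-cong [] eq = refl
down-level-cong (true ∷ s) eq = down-level-cong s λ t l → eq (true ∷ t) (cong suc l)
down-level-cong (false ∷ s) eq = cong₂ _+_ (eq (true ∷ s) refl) (down-level-cong s λ t l → eq (false ∷ t) l)

-- Adding and then deleting a point differs from deleting and then adding only in the returns to
-- `s`, of which there are `v - ∣ s ∣` in the first case and `∣ s ∣` in the second.
down-up : ∀ {v} (f : SubsetFunction v) s → down (up f) s ≡ up (down f) s + (+ v - + 2 * + ∣ s ∣) * f s
down-up f [] = refl
down-up {suc v} f (true ∷ s) = begin
  down (λ s → f (false ∷ s) + up (f ⁺) s) s
    ≡⟨ down-level-cong s (λ t _ → cong (_+ up (f ⁺) t) (sym (ℤ.*-identityˡ (f (false ∷ t))))) ⟩
  down (λ s → 1ℤ * f (false ∷ s) + up (f ⁺) s) s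
    ≡⟨ down-linear 1ℤ (f ⁻) (up (f ⁺)) s ⟩
  1ℤ * down (f ⁻) s + down (up (f ⁺)) s
    ≡⟨ cong (_+_ (1ℤ * down (f ⁻) s)) (down-up (f ⁺) s) ⟩
  1ℤ * down (f ⁻) s + (up (down (f ⁺)) s + (+ v - + 2 * + ∣ s ∣) * f (true ∷ s))
    ≡⟨ solve 5 (λ d u v k x → num 1 :* d :+ (u :+ (v :- num 2 :* k) :* x)
         := x :+ d :+ u :+ (num 1 :+ v :- num 2 :* (num 1 :+ k)) :* x) refl
         (down (f ⁻) s) (up (down (f ⁺)) s) (+ v) (+ ∣ s ∣) (f (true ∷ s)) ⟩
  f (true ∷ s) + down (f ⁻) s + up (down (f ⁺)) s + (+ suc v - + 2 * + suc ∣ s ∣) * f (true ∷ s) ∎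
  where open ≡-Reasoning
down-up {suc v} f (false ∷ s) = begin
  f (false ∷ s) + up (f ⁺) s + down (up (f ⁻)) s
    ≡⟨ cong (_+_ (f (false ∷ s) + up (f ⁺) s)) (down-up (f ⁻) s) ⟩
  f (false ∷ s) + up (f ⁺) s + (up (down (f ⁻)) s + (+ v - + 2 * + ∣ s ∣) * f (false ∷ s))
    ≡⟨ solve 5 (λ d u v k x → x :+ u :+ (d :+ (v :- num 2 :* k) :* x)
         := num 1 :* u :+ d :+ (num 1 :+ v :- num 2 :* k) :* x) refl
         (up (down (f ⁻)) s) (up (f ⁺) s) (+ v) (+ ∣ s ∣) (f (false ∷ s)) ⟩
  1ℤ * up (f ⁺) s + up (down (f ⁻)) s + (+ suc v - + 2 * + ∣ s ∣) * f (false ∷ s)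
    ≡⟨ cong (_+ (+ suc v - + 2 * + ∣ s ∣) * f (false ∷ s)) (up-linear 1ℤ (f ⁺) (down (f ⁻)) s) ⟨
  up (λ s → 1ℤ * f (true ∷ s) + down (f ⁻) s) s + (+ suc v - + 2 * + ∣ s ∣) * f (false ∷ s)
    ≡⟨ cong (_+ (+ suc v - + 2 * + ∣ s ∣) * f (false ∷ s))
         (up-level-cong s (λ t _ → cong (_+ down (f ⁻) t) (ℤ.*-identityˡ (f (true ∷ t))))) ⟩
  up (λ s → f (true ∷ s) + down (f ⁻) s) s + (+ suc v - + 2 * + ∣ s ∣) * f (false ∷ s) ∎
  where open ≡-Reasoning

up-down-adjoint : ∀ {v} (f g : SubsetFunction v) → Σₛ (λ s → g s * down f s) ≡ Σₛ (λ s → up g s * f s)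
up-down-adjoint {zero} f g = trans (ℤ.*-zeroʳ (g [])) (sym (ℤ.*-zeroˡ (f [])))
up-down-adjoint {suc v} f g = begin
  Σₛ (λ s → g₁ s * down f₁ s) + Σₛ (λ s → g₀ s * (f₁ s + down f₀ s))
    ≡⟨ cong₂ _+_ (up-down-adjoint f₁ g₁) (trans (Σₛ-cong λ s → ℤ.*-distribˡ-+ (g₀ s) (f₁ s) (down f₀ s))
         (Σₛ-+ (λ s → g₀ s * f₁ s) (λ s → g₀ s * down f₀ s))) ⟩
  Σₛ (λ s → up g₁ s * f₁ s) + (Σₛ (λ s → g₀ s * f₁ s) + Σₛ (λ s → g₀ s * down f₀ s))
    ≡⟨ cong (λ z → Σₛ (λ s → up g₁ s * f₁ s) + (Σₛ (λ s → g₀ s * f₁ s) + z)) (up-down-adjoint f₀ g₀) ⟩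
  Σₛ (λ s → up g₁ s * f₁ s) + (Σₛ (λ s → g₀ s * f₁ s) + Σₛ (λ s → up g₀ s * f₀ s))
    ≡⟨ solve 3 (λ a b c → a :+ (b :+ c) := (b :+ a) :+ c) refl (Σₛ (λ s → up g₁ s * f₁ s)) (Σₛ (λ s → g₀ s * f₁ s)) (Σₛ (λ s → up g₀ s * f₀ s)) ⟩
  (Σₛ (λ s → g₀ s * f₁ s) + Σₛ (λ s → up g₁ s * f₁ s)) + Σₛ (λ s → up g₀ s * f₀ s)
    ≡⟨ cong (_+ Σₛ (λ s → up g₀ s * f₀ s)) (trans (sym (Σₛ-+ (λ s → g₀ s * f₁ s) (λ s → up g₁ s * f₁ s)))
         (Σₛ-cong λ s → sym (ℤ.*-distribʳ-+ (f₁ s) (g₀ s) (up g₁ s)))) ⟩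
  Σₛ (λ s → (g₀ s + up g₁ s) * f₁ s) + Σₛ (λ s → up g₀ s * f₀ s) ∎
  where
  open ≡-Reasoning
  f₀ = f ⁻
  f₁ = f ⁺
  g₀ = g ⁻
  g₁ = g ⁺

-- With `suc ∣ t ∣` as argument, `φ` is evaluated at the size of `s` itself, and the induction can
-- pass to `φ ∘ suc`.
up-of-size : ∀ {v} (φ : ℕ → ℤ) (s : Subset v) → up (λ t → φ (suc ∣ t ∣)) s ≡ + ∣ s ∣ * φ ∣ s ∣
up-of-size φ [] = sym (ℤ.*-zeroˡ (φ 0))
up-of-size φ (true ∷ s) = trans (cong (_+_ (φ (suc ∣ s ∣))) (up-of-size (φ ∘ suc) s))
  (solve 2 (λ k x → x :+ k :* x := (num 1 :+ k) :* x) refl (+ ∣ s ∣) (φ (suc ∣ s ∣)))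
up-of-size φ (false ∷ s) = up-of-size φ s

up-const : ∀ {v} (g : SubsetFunction v) k c → (∀ t → ∣ t ∣ ≡ k → g t ≡ c) → ∀ s → ∣ s ∣ ≡ suc k → up g s ≡ + suc k * c
up-const g k c eq s refl′ = trans (up-level-cong s (λ t l → eq t (ℕ.suc-injective (trans l refl′))))
  (trans (up-of-size (λ _ → c) s) (cong (λ n → + n * c) refl′))

down-one : ∀ {v} (s : Subset v) → down (λ _ → 1ℤ) s ≡ + v - + ∣ s ∣
down-one [] = refl
down-one {suc v} (true ∷ s) = trans (down-one s) (solve 2 (λ v k → v :- k := num 1 :+ v :- (num 1 :+ k)) refl (+ v) (+ ∣ s ∣))
down-one {suc v} (false ∷ s) = trans (cong (λ z → 1ℤ + z) (down-one s)) (sym (ℤ.+-assoc 1ℤ (+ v) (- (+ ∣ s ∣))))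

levelSum : ∀ {v} → ℕ → SubsetFunction v → ℤ
levelSum k f = Σₛ (λ s → ind (∣ s ∣ ℕ.≟ k) * f s)

levelSum-down : ∀ {v} k (f : SubsetFunction v) → levelSum k (down f) ≡ + suc k * levelSum (suc k) f
levelSum-down k f = begin
  Σₛ (λ s → ind (∣ s ∣ ℕ.≟ k) * down f s)
    ≡⟨ up-down-adjoint f (λ s → ind (∣ s ∣ ℕ.≟ k)) ⟩
  Σₛ (λ s → up (λ t → ind (∣ t ∣ ℕ.≟ k)) s * f s)
    ≡⟨ Σₛ-cong (λ s → begin
         up (λ t → ind (∣ t ∣ ℕ.≟ k)) s * f s
          ≡⟨ cong (_* f s) (trans
          (up-level-cong s (λ t _ → ind-cong (cong suc) ℕ.suc-injective (∣ t ∣ ℕ.≟ k) (suc ∣ t ∣ ℕ.≟ suc k)))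
          (up-of-size (λ m → ind (m ℕ.≟ suc k)) s)) ⟩
         + ∣ s ∣ * ind (∣ s ∣ ℕ.≟ suc k) * f s
          ≡⟨ cong (_* f s) (weight ∣ s ∣) ⟩
         + suc k * ind (∣ s ∣ ℕ.≟ suc k) * f s
          ≡⟨ ℤ.*-assoc (+ suc k) (ind (∣ s ∣ ℕ.≟ suc k)) (f s) ⟩
         + suc k * (ind (∣ s ∣ ℕ.≟ suc k) * f s) ∎) ⟩
  Σₛ (λ s → + suc k * (ind (∣ s ∣ ℕ.≟ suc k) * f s))
    ≡⟨ Σₛ-* (+ suc k) (λ s → ind (∣ s ∣ ℕ.≟ suc k) * f s) ⟩
  + suc k * levelSum (suc k) f ∎
  where
  open ≡-Reasoning
  weight : ∀ m → + m * ind (m ℕ.≟ suc k) ≡ + suc k * ind (m ℕ.≟ suc k)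
  weight m with m ℕ.≟ suc k
  ... | yes refl = refl
  ... | no _ = trans (ℤ.*-zeroʳ (+ m)) (sym (ℤ.*-zeroʳ (+ suc k)))

levelSum-zero : ∀ {v} (f : SubsetFunction v) s → ∣ s ∣ ≡ 0 → f s ≡ levelSum 0 f
levelSum-zero f [] eq = sym (ℤ.*-identityˡ (f []))
levelSum-zero f (false ∷ s) eq = trans (levelSum-zero (f ⁻) s eq) (sym (trans
  (cong (_+ levelSum 0 (f ⁻)) (Σₛ-zero (λ t → ind (suc ∣ t ∣ ℕ.≟ 0) * f (true ∷ t))
    λ t → trans (cong (_* f (true ∷ t)) (ind-no (suc ∣ t ∣ ℕ.≟ 0) λ ())) (ℤ.*-zeroˡ (f (true ∷ t)))))
  (ℤ.+-identityˡ _)))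

-- 36 is (3!)²: the empty set and a 3-set are joined by 3! chains, and the composite runs through
-- them once downwards and once upwards.
up³-down³ : ∀ {v} (f : SubsetFunction v) s → ∣ s ∣ ≡ 3 → up (up (up (down (down (down f))))) s ≡ + 36 * levelSum 3 f
up³-down³ f = λ s l → trans (up-const _ 2 _ (up-const _ 1 _ (up-const _ 0 _ base)) s l)
  (solve 1 (λ x → num 3 :* (num 2 :* (num 1 :* (num 6 :* x))) := num 36 :* x) refl (levelSum 3 f))
  where
  base : ∀ s → ∣ s ∣ ≡ 0 → down (down (down f)) s ≡ + 6 * levelSum 3 f
  base s l = begin
    down (down (down f)) s ≡⟨ levelSum-zero _ s l ⟩
    levelSum 0 (down (down (down f))) ≡⟨ levelSum-down 0 (down (down f)) ⟩
    1ℤ * levelSum 1 (down (down f)) ≡⟨ cong (1ℤ *_) (levelSum-down 1 (down f)) ⟩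
    1ℤ * (+ 2 * levelSum 2 (down f)) ≡⟨ cong (λ z → 1ℤ * (+ 2 * z)) (levelSum-down 2 f) ⟩
    1ℤ * (+ 2 * (+ 3 * levelSum 3 f)) ≡⟨ solve 1 (λ x → num 1 :* (num 2 :* (num 3 :* x)) := num 6 :* x) refl (levelSum 3 f) ⟩
    + 6 * levelSum 3 f ∎
    where open ≡-Reasoning

full-intersection : ∀ {v} (s t : Subset v) → ∣ t ∣ ≡ ∣ s ∣ → ∣ s ∩ t ∣ ≡ ∣ s ∣ → t ≡ s
full-intersection [] [] _ _ = refl
full-intersection (true ∷ s) (true ∷ t) e₁ e₂ = cong (true ∷_) (full-intersection s t (ℕ.suc-injective e₁) (ℕ.suc-injective e₂))
full-intersection (true ∷ s) (false ∷ t) e₁ e₂ = contradiction (∣p∩q∣≤∣p∣ s t) (ℕ.<⇒≱ (ℕ.≤-reflexive (sym e₂)))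
full-intersection (false ∷ s) (true ∷ t) e₁ e₂ = contradiction (∣p∩q∣≤∣q∣ s t) (ℕ.<⇒≱ (ℕ.≤-reflexive (trans e₁ (sym e₂))))
full-intersection (false ∷ s) (false ∷ t) e₁ e₂ = cong (false ∷_) (full-intersection s t e₁ e₂)

Σₛ-ind-cong : ∀ {v} {P Q : Subset v → Set} (P? : ∀ t → Dec (P t)) (Q? : ∀ t → Dec (Q t)) (f : SubsetFunction v) →
  (∀ {t} → P t → Q t) → (∀ {t} → Q t → P t) → Σₛ (λ t → ind (P? t) * f t) ≡ Σₛ (λ t → ind (Q? t) * f t)
Σₛ-ind-cong P? Q? f to from = Σₛ-cong λ t → cong (_* f t) (ind-cong to from (P? t) (Q? t))

Σₛ-ind-empty : ∀ {v} {P : Subset v → Set} (P? : ∀ t → Dec (P t)) (f : SubsetFunction v) → (∀ t → ¬ P t) → Σₛ (λ t → ind (P? t) * f t) ≡ 0ℤ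
Σₛ-ind-empty P? f ¬P = Σₛ-zero (λ t → ind (P? t) * f t) λ t → trans (cong (_* f t) (ind-no (P? t) (¬P t))) (ℤ.*-zeroˡ (f t))

-- `t` is `s` itself, `s` with a point added, with a point removed, or with a point exchanged.
-- Stated by cardinalities, these are decidable and stable under prepending the same bit to both
-- sets; `suc` on the left avoids subtraction.
Same Above Below Beside : ∀ {v} → Subset v → Subset v → Set
Same s t = ∣ t ∣ ≡ ∣ s ∣ × ∣ s ∩ t ∣ ≡ ∣ s ∣
Above s t = ∣ t ∣ ≡ suc ∣ s ∣ × ∣ s ∩ t ∣ ≡ ∣ s ∣
Below s t = suc ∣ t ∣ ≡ ∣ s ∣ × suc ∣ s ∩ t ∣ ≡ ∣ s ∣
Beside s t = ∣ t ∣ ≡ ∣ s ∣ × suc ∣ s ∩ t ∣ ≡ ∣ s ∣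

same? : ∀ {v} (s t : Subset v) → Dec (Same s t)
same? s t = ∣ t ∣ ℕ.≟ ∣ s ∣ ×-dec ∣ s ∩ t ∣ ℕ.≟ ∣ s ∣

above? : ∀ {v} (s t : Subset v) → Dec (Above s t)
above? s t = ∣ t ∣ ℕ.≟ suc ∣ s ∣ ×-dec ∣ s ∩ t ∣ ℕ.≟ ∣ s ∣

below? : ∀ {v} (s t : Subset v) → Dec (Below s t)
below? s t = suc ∣ t ∣ ℕ.≟ ∣ s ∣ ×-dec suc ∣ s ∩ t ∣ ℕ.≟ ∣ s ∣

beside? : ∀ {v} (s t : Subset v) → Dec (Beside s t)
beside? s t = ∣ t ∣ ℕ.≟ ∣ s ∣ ×-dec suc ∣ s ∩ t ∣ ℕ.≟ ∣ s ∣

same-kernel : ∀ {v} (f : SubsetFunction v) s → Σₛ (λ t → ind (same? s t) * f t) ≡ f s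
same-kernel f s = trans
  (Σₛ-ind-cong (same? s) (_≟ₛ s) f (λ { (e₁ , e₂) → full-intersection s _ e₁ e₂ }) (λ { refl → refl , cong ∣_∣ (∩-idem s) }))
  (Σₛ-δ f s)

suc-injective² : ∀ {k l m n : ℕ} → suc k ≡ suc l × suc m ≡ suc n → k ≡ l × m ≡ n
suc-injective² (p , q) = ℕ.suc-injective p , ℕ.suc-injective q

suc-cong² : ∀ {k l m n : ℕ} → k ≡ l × m ≡ n → suc k ≡ suc l × suc m ≡ suc n
suc-cong² (p , q) = cong suc p , cong suc q

suc-congˡ : ∀ {k l m n : ℕ} → k ≡ l × m ≡ n → suc k ≡ suc l × m ≡ n
suc-congˡ (p , q) = cong suc p , q

suc-congʳ : ∀ {k l m n : ℕ} → k ≡ l × m ≡ n → k ≡ l × suc m ≡ suc n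
suc-congʳ (p , q) = p , cong suc q

∣s∩t∣≢1+∣s∣ : ∀ {v} (s t : Subset v) → ∣ s ∩ t ∣ ≢ suc ∣ s ∣
∣s∩t∣≢1+∣s∣ s t eq = ℕ.<⇒≱ (ℕ.≤-reflexive (sym eq)) (∣p∩q∣≤∣p∣ s t)

∣s∩t∣≢1+∣t∣ : ∀ {v} (s t : Subset v) → ∣ s ∩ t ∣ ≢ suc ∣ t ∣
∣s∩t∣≢1+∣t∣ s t eq = ℕ.<⇒≱ (ℕ.≤-reflexive (sym eq)) (∣p∩q∣≤∣q∣ s t)

down-kernel : ∀ {v} (f : SubsetFunction v) s → down f s ≡ Σₛ (λ t → ind (above? s t) * f t)
down-kernel f [] = sym (ℤ.*-zeroˡ (f []))
down-kernel f (true ∷ s) = sym (trans (cong₂ _+_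
  (trans (Σₛ-ind-cong (above? (true ∷ s) ∘ (true ∷_)) (above? s) (f ⁺) suc-injective² suc-cong²)
         (sym (down-kernel (f ⁺) s)))
  (Σₛ-ind-empty (above? (true ∷ s) ∘ (false ∷_)) (f ⁻) λ t (_ , e) → ∣s∩t∣≢1+∣s∣ s t e))
  (ℤ.+-identityʳ _))
down-kernel f (false ∷ s) = sym (cong₂ _+_
  (trans (Σₛ-ind-cong (above? (false ∷ s) ∘ (true ∷_)) (same? s) (f ⁺)
          (λ (p , q) → ℕ.suc-injective p , q) suc-congˡ)
         (same-kernel (f ⁺) s))
  (sym (down-kernel (f ⁻) s)))

up-kernel : ∀ {v} (f : SubsetFunction v) s → up f s ≡ Σₛ (λ t → ind (below? s t) * f t)
up-kernel f [] = sym (ℤ.*-zeroˡ (f []))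
up-kernel f (true ∷ s) = trans (ℤ.+-comm (f (false ∷ s)) (up (f ⁺) s)) (sym (cong₂ _+_
  (trans (Σₛ-ind-cong (below? (true ∷ s) ∘ (true ∷_)) (below? s) (f ⁺) suc-injective² suc-cong²)
         (sym (up-kernel (f ⁺) s)))
  (trans (Σₛ-ind-cong (below? (true ∷ s) ∘ (false ∷_)) (same? s) (f ⁻) suc-injective² suc-cong²)
         (same-kernel (f ⁻) s))))
up-kernel f (false ∷ s) = sym (trans (cong₂ _+_
  (Σₛ-ind-empty (below? (false ∷ s) ∘ (true ∷_)) (f ⁺) λ t (p , q) → ∣s∩t∣≢1+∣t∣ s t (ℕ.suc-injective (trans q (sym p))))
  (sym (up-kernel (f ⁻) s)))
  (ℤ.+-identityˡ _))

-- Deleting and then adding a point returns to `s` in `∣ s ∣` ways and reaches each set with one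
-- point exchanged exactly once. At size 3 this is 3I + A for the Johnson graph.
up-down-kernel : ∀ {v} (f : SubsetFunction v) s → up (down f) s ≡ + ∣ s ∣ * f s + Σₛ (λ t → ind (beside? s t) * f t)
up-down-kernel f [] = sym (cong₂ _+_ (ℤ.*-zeroˡ (f [])) (ℤ.*-zeroˡ (f [])))
up-down-kernel f (true ∷ s) = begin
  f₁ s + down f₀ s + up (down f₁) s
    ≡⟨ cong₂ (λ p q → f₁ s + p + q)
         (trans (down-kernel f₀ s) (Σₛ-ind-cong (above? s) (beside? (true ∷ s) ∘ (false ∷_)) f₀
          suc-congʳ (λ (p , q) → p , ℕ.suc-injective q)))
         (trans (up-down-kernel f₁ s) (cong (_+_ (+ ∣ s ∣ * f₁ s))
          (Σₛ-ind-cong (beside? s) (beside? (true ∷ s) ∘ (true ∷_)) f₁ suc-cong² suc-injective²))) ⟩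
  f₁ s + X₀ + (+ ∣ s ∣ * f₁ s + X₁)
    ≡⟨ solve 4 (λ a b n c → a :+ b :+ (n :* a :+ c) := (num 1 :+ n) :* a :+ (c :+ b)) refl (f₁ s) X₀ (+ ∣ s ∣) X₁ ⟩
  + suc ∣ s ∣ * f₁ s + (X₁ + X₀) ∎
  where
  open ≡-Reasoning
  f₀ = f ⁻
  f₁ = f ⁺
  X₀ = Σₛ (λ t → ind (beside? (true ∷ s) (false ∷ t)) * f₀ t)
  X₁ = Σₛ (λ t → ind (beside? (true ∷ s) (true ∷ t)) * f₁ t)
up-down-kernel f (false ∷ s) = begin
  up (λ s → f₁ s + down f₀ s) s
    ≡⟨ up-level-cong s (λ t _ → cong (_+ down f₀ t) (sym (ℤ.*-identityˡ (f₁ t)))) ⟩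
  up (λ s → 1ℤ * f₁ s + down f₀ s) s
    ≡⟨ up-linear 1ℤ f₁ (down f₀) s ⟩
  1ℤ * up f₁ s + up (down f₀) s
    ≡⟨ cong₂ (λ p q → 1ℤ * p + q) (up-kernel f₁ s) (up-down-kernel f₀ s) ⟩
  1ℤ * X₁ + (+ ∣ s ∣ * f₀ s + X₀)
    ≡⟨ solve 3 (λ x a b → num 1 :* x :+ (a :+ b) := a :+ (x :+ b)) refl X₁ (+ ∣ s ∣ * f₀ s) X₀ ⟩
  + ∣ s ∣ * f₀ s + (X₁ + X₀) ∎
  where
  open ≡-Reasoning
  f₀ = f ⁻
  f₁ = f ⁺
  X₀ = Σₛ (λ t → ind (beside? s t) * f₀ t)
  X₁ = Σₛ (λ t → ind (below? s t) * f₁ t)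

sum-enumeration : ∀ {v n} (k : ℕ) (e : (Σ[ s ∈ Subset v ] ∣ s ∣ ≡ k) ↔ Fin n) (h : SubsetFunction v) →
          sum (λ j → h (proj₁ (Inverse.from e j))) ≡ levelSum k h
sum-enumeration {v} {n} k e h = begin
  sum (λ j → h (S j))
    ≡⟨ sum-cong (λ j → sym (Σₛ-δ h (S j))) ⟩
  sum (λ j → Σₛ (λ t → ind (t ≟ₛ S j) * h t))
    ≡⟨ sum-Σₛ (λ j t → ind (t ≟ₛ S j) * h t) ⟩
  Σₛ (λ t → sum (λ j → ind (t ≟ₛ S j) * h t))
    ≡⟨ Σₛ-cong (λ t → trans (sym (*-distribʳ-sum (h t) (λ j → ind (t ≟ₛ S j)))) (cong (_* h t) (count t))) ⟩
  levelSum k h ∎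
  where
  open ≡-Reasoning
  open Inverse e
  S : Fin n → Subset v
  S j = proj₁ (from j)
  count : ∀ t → sum (λ j → ind (t ≟ₛ S j)) ≡ ind (∣ t ∣ ℕ.≟ k)
  count t with ∣ t ∣ ℕ.≟ k
  ... | yes p = trans (sum-cong λ j → trans
          (ind-cong (λ { refl → trans (cong (λ q → to (t , q)) (ℕ.≡-irrelevant p (proj₂ (from j)))) (strictlyInverseˡ j) })
          (λ { refl → cong proj₁ (sym (strictlyInverseʳ (t , p))) }) (t ≟ₛ S j) (to (t , p) Fin.≟ j))
          (sym (ℤ.*-identityʳ _)))
        (sum-unit (to (t , p)) (λ _ → 1ℤ))
  ... | no ¬p = sum-zero (λ j → ind (t ≟ₛ S j)) λ j → ind-no (t ≟ₛ S j) λ { refl → ¬p (proj₂ (from j)) }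

-- The cubic identity for the Johnson graph

shifted : (G : Graph) → Matrix (Graph.order G)
shifted G i j = adjacency G i j + + 3 * identity i j

module Johnson (v : ℕ) where

  private
    module J = Graph (johnson₃ v)
    Y = shifted (johnson₃ v)
    open Inverse J.enum

  n : ℕ
  n = J.order

  S : Fin n → Subset v
  S i = proj₁ (from i)

  ∣S∣ : ∀ i → ∣ S i ∣ ≡ 3
  ∣S∣ i = proj₂ (from i)

  Restricts : SubsetFunction v → Vector n → Set
  Restricts f x = ∀ i → x i ≡ f (S i)

  restricts-mat : ∀ f x → Restricts f x → Restricts (up (down f)) (mat Y x)
  restricts-mat f x f↾x i = begin
    sum (λ j → (adjacency (johnson₃ v) i j + + 3 * identity i j) * x j)
      ≡⟨ sum-cong (λ j → solve 3 (λ a u x → (a :+ num 3 :* u) :* x := num 3 :* (u :* x) :+ a :* x) refl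
          (adjacency (johnson₃ v) i j) (identity i j) (x j)) ⟩
    sum (λ j → + 3 * (unit i j * x j) + adjacency (johnson₃ v) i j * x j)
      ≡⟨ sum-linear (+ 3) (λ j → unit i j * x j) (λ j → adjacency (johnson₃ v) i j * x j) ⟩
    + 3 * sum (λ j → unit i j * x j) + sum (λ j → adjacency (johnson₃ v) i j * x j)
      ≡⟨ cong₂ (λ p q → + 3 * p + q) (trans (sum-unit i x) (f↾x i))
          (sum-cong λ j → cong (adjacency (johnson₃ v) i j *_) (f↾x j)) ⟩
    + 3 * f (S i) + sum (λ j → ind (∣ S i ∩ S j ∣ ℕ.≟ 2) * f (S j))
      ≡⟨ cong (_+_ (+ 3 * f (S i))) (sum-enumeration 3 J.enum (λ t → ind (∣ S i ∩ t ∣ ℕ.≟ 2) * f t)) ⟩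
    + 3 * f (S i) + Σₛ (λ t → ind (∣ t ∣ ℕ.≟ 3) * (ind (∣ S i ∩ t ∣ ℕ.≟ 2) * f t))
      ≡⟨ cong₂ (λ k m → + k * f (S i) + m) (sym (∣S∣ i)) (Σₛ-cong λ t →
          trans (sym (ℤ.*-assoc (ind (∣ t ∣ ℕ.≟ 3)) (ind (∣ S i ∩ t ∣ ℕ.≟ 2)) (f t)))
          (cong (_* f t) (trans (ind-× (∣ t ∣ ℕ.≟ 3) (∣ S i ∩ t ∣ ℕ.≟ 2))
          (ind-cong (λ (p , q) → trans p (sym (∣S∣ i)) , trans (cong suc q) (sym (∣S∣ i)))
          (λ (p , q) → trans p (∣S∣ i) , ℕ.suc-injective (trans q (∣S∣ i)))
          (∣ t ∣ ℕ.≟ 3 ×-dec ∣ S i ∩ t ∣ ℕ.≟ 2) (beside? (S i) t))))) ⟩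
    + ∣ S i ∣ * f (S i) + Σₛ (λ t → ind (beside? (S i) t) * f t)
      ≡⟨ up-down-kernel f (S i) ⟨
    up (down f) (S i) ∎
    where open ≡-Reasoning

  row-sum : ∀ i → mat Y (λ _ → 1ℤ) i ≡ + 3 * (+ v - + 2)
  row-sum i = trans (restricts-mat (λ _ → 1ℤ) (λ _ → 1ℤ) (λ _ → refl) i)
    (up-const (down (λ _ → 1ℤ)) 2 (+ v - + 2) (λ t l → trans (down-one t) (cong (λ k → + v - + k) l)) (S i) (∣S∣ i))

  down-shift : ∀ (f : SubsetFunction v) c s → down (λ t → - c * f t + up (down f) t) s ≡
          (+ v - + 2 * + ∣ s ∣ - c) * down f s + up (down (down f)) s
  down-shift f c s = trans (down-linear (- c) f (up (down f)) s) (trans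
    (cong (_+_ (- c * down f s)) (down-up (down f) s))
    (solve 4 (λ c d u k → :- c :* d :+ (u :+ k :* d) := (k :- c) :* d :+ u) refl
      c (down f s) (up (down (down f)) s) (+ v - + 2 * + ∣ s ∣)))

  -- The coefficients `v - 2k` of `down-up` at sizes k = 2, 1, 0 have partial sums `v - 4`, `2v - 6`
  -- and `3v - 6`: these are `a`, `b` and the row sum.
  a b : ℤ
  a = + v - + 4
  b = + 2 * + v - + 6

  extension : Vector n → SubsetFunction v
  extension x t with ∣ t ∣ ℕ.≟ 3
  ... | yes p = x (to (t , p))
  -- An arbitrary default: `Restricts` reads functions on 3-sets only.
  ... | no _ = 0ℤ

  extension-restricts : ∀ x → Restricts (extension x) x
  extension-restricts x i with ∣ S i ∣ ℕ.≟ 3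
  ... | yes p = cong x (trans (sym (strictlyInverseˡ i)) (cong (λ q → to (S i , q)) (ℕ.≡-irrelevant (∣S∣ i) p)))
  ... | no ¬p = contradiction (∣S∣ i) ¬p

  -- When `down` is commuted past the `up` of each factor, scalar terms appear. The constant `b`
  -- cancels them in two stages, at sizes 2 and 1, and `a` cancels them at size 2; three downs
  -- followed by three ups are left.
  cubic : ∀ x i → apply Y (0ℤ ∷ a ∷ b ∷ []) x i ≡ + 36 * sum x
  cubic x i = begin
    apply Y (0ℤ ∷ a ∷ b ∷ []) x i
      ≡⟨ restricts-0 i ⟩
    - 0ℤ * f₂ (S i) + up (down f₂) (S i)
      ≡⟨ trans (cong (_+ up (down f₂) (S i)) (ℤ.*-zeroˡ (f₂ (S i)))) (ℤ.+-identityˡ _) ⟩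
    up (down f₂) (S i)
      ≡⟨ up-level-cong (S i) (λ t l → level₂ t (ℕ.suc-injective (trans l (∣S∣ i)))) ⟩
    up (up (up (down (down (down f))))) (S i)
      ≡⟨ up³-down³ f (S i) (∣S∣ i) ⟩
    + 36 * levelSum 3 f
      ≡⟨ cong (+ 36 *_) (trans (sum-cong (extension-restricts x)) (sum-enumeration 3 J.enum f)) ⟨
    + 36 * sum x ∎
    where
    open ≡-Reasoning
    f = extension x
    f₁ = λ t → - b * f t + up (down f) t
    f₂ = λ t → - a * f₁ t + up (down f₁) t

    restricts-1 : Restricts f₁ (apply Y (b ∷ []) x)
    restricts-1 j = cong₂ (λ p q → - b * p + q) (extension-restricts x j) (restricts-mat f x (extension-restricts x) j)
    restricts-2 : Restricts f₂ (apply Y (a ∷ b ∷ []) x)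
    restricts-2 j = cong₂ (λ p q → - a * p + q) (restricts-1 j) (restricts-mat f₁ _ restricts-1 j)
    restricts-0 : Restricts (λ t → - 0ℤ * f₂ t + up (down f₂) t) (apply Y (0ℤ ∷ a ∷ b ∷ []) x)
    restricts-0 j = cong₂ (λ p q → - 0ℤ * p + q) (restricts-2 j) (restricts-mat f₂ _ restricts-2 j)

    level₁ : ∀ t → ∣ t ∣ ≡ 2 → down f₁ t ≡ - (+ v - + 2) * down f t + up (down (down f)) t
    level₁ t l = trans (down-shift f b t) (cong (λ k → k * down f t + up (down (down f)) t)
      (trans (cong (λ k → + v - + 2 * + k - b) l)
        (solve 1 (λ v → v :- num 2 :* num 2 :- (num 2 :* v :- num 6) := :- (v :- num 2)) refl (+ v))))

    level₁′ : ∀ t → ∣ t ∣ ≡ 1 → down (down f₁) t ≡ up (down (down (down f))) t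
    level₁′ t l = trans (down-level-cong t (λ u l′ → level₁ u (trans l′ (cong suc l))))
      (trans (down-shift (down f) (+ v - + 2) t)
        (trans (cong (λ k → (+ v - + 2 * + k - (+ v - + 2)) * down (down f) t + up (down (down (down f))) t) l)
          (solve 3 (λ v x y → (v :- num 2 :* num 1 :- (v :- num 2)) :* x :+ y := y) refl
          (+ v) (down (down f) t) (up (down (down (down f))) t))))

    level₂ : ∀ t → ∣ t ∣ ≡ 2 → down f₂ t ≡ up (up (down (down (down f)))) t
    level₂ t l = trans (down-shift f₁ a t)
      (trans (cong (λ k → (+ v - + 2 * + k - a) * down f₁ t + up (down (down f₁)) t) l)
        (trans (solve 3 (λ v x y → (v :- num 2 :* num 2 :- (v :- num 4)) :* x :+ y := y) refl
          (+ v) (down f₁ t) (up (down (down f₁)) t))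
          (up-level-cong t (λ u l′ → level₁′ u (ℕ.suc-injective (trans l′ l))))))

-- Graphs cospectral with J(v,3)

one : ∀ {n} → Vector n
one _ = 1ℤ

unit-sym : ∀ {n} (i j : Fin n) → unit i j ≡ unit j i
unit-sym i j = ind-cong sym sym (i Fin.≟ j) (j Fin.≟ i)

unit-diag : ∀ {n} (i : Fin n) → unit i i ≡ 1ℤ
unit-diag i = ind-yes (i Fin.≟ i) refl

adjacency-sym : ∀ G i j → adjacency G i j ≡ adjacency G j i
adjacency-sym G i j = ind-cong ∼-sym ∼-sym (from i ∼? from j) (from j ∼? from i)
  where
  open Graph G
  open Inverse enum using (from)

adjacency-diag : ∀ G i → adjacency G i i ≡ 0ℤ
adjacency-diag G i = ind-no (from i ∼? from i) (∼-irrefl refl)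
  where
  open Graph G
  open Inverse enum using (from)

shifted-sym : ∀ G i j → shifted G i j ≡ shifted G j i
shifted-sym G i j = cong₂ (λ p q → p + + 3 * q) (adjacency-sym G i j) (unit-sym i j)

shifted-diag : ∀ G i → shifted G i i ≡ + 3
shifted-diag G i = cong₂ (λ p q → p + + 3 * q) (adjacency-diag G i) (unit-diag i)

shifted-off-diag : ∀ G {i j} → i ≢ j → shifted G i j ≡ adjacency G i j
shifted-off-diag G {i} {j} i≢j = trans (cong (λ u → adjacency G i j + + 3 * u) (ind-no (i Fin.≟ j) i≢j)) (ℤ.+-identityʳ _)

ind-idem : ∀ {P : Set} (P? : Dec P) → ind P? * ind P? ≡ ind P?
ind-idem (yes _) = refl
ind-idem (no _) = refl

-- Entries are 0 or 1 off the diagonal and 3 on it, where 9 = 6 + 3. Hence row sums determine the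
-- norms of rows and tr Y².
shifted-square : ∀ G i j → shifted G i j * shifted G i j ≡ + 6 * unit i j + shifted G i j
shifted-square G i j = square i j (i Fin.≟ j)
  where
  open Graph G
  open Inverse enum using (from)
  square : ∀ i j → Dec (i ≡ j) → shifted G i j * shifted G i j ≡ + 6 * unit i j + shifted G i j
  square i .i (yes refl) = trans (cong₂ _*_ (shifted-diag G i) (shifted-diag G i))
    (sym (cong₂ (λ u y → + 6 * u + y) (unit-diag i) (shifted-diag G i)))
  square i j (no i≢j) = trans (cong₂ _*_ (shifted-off-diag G i≢j) (shifted-off-diag G i≢j))
    (trans (ind-idem (from i ∼? from j)) (sym (trans (cong₂ (λ u y → + 6 * u + y) (ind-no (i Fin.≟ j) i≢j) (shifted-off-diag G i≢j))
      (ℤ.+-identityˡ _))))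

mat-unit : ∀ {n} (Y : Matrix n) a j → mat Y (unit a) j ≡ Y j a
mat-unit Y a j = dot-unit a (Y j)

sum-unit-one : ∀ {n} (a : Fin n) → sum (unit a) ≡ 1ℤ
sum-unit-one a = trans (sum-cong λ j → sym (ℤ.*-identityʳ (unit a j))) (sum-unit a one)

row-square : ∀ G i → dot (shifted G i) (shifted G i) ≡ + 6 + sum (shifted G i)
row-square G i = trans (sum-cong {Graph.order G} (shifted-square G i)) (trans (sum-linear (+ 6) (unit i) (shifted G i))
  (cong (λ s → + 6 * s + sum (shifted G i)) (sum-unit-one i)))

sum-const : ∀ n k → sum {n} (λ _ → k) ≡ k * sum (one {n})
sum-const n k = trans (sum-cong {n} λ _ → sym (ℤ.*-identityʳ k)) (sym (*-distribˡ-sum k (one {n})))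

trace-power₀ : ∀ {n} (Y : Matrix n) → trace-power Y 0 ≡ sum (one {n})
trace-power₀ {n} Y = sum-cong {n} unit-diag

trace-power₂ : ∀ G → trace-power (shifted G) 2 ≡ + 6 * sum (one {Graph.order G}) + sum (λ i → sum (shifted G i))
trace-power₂ G = trans (sum-cong λ i → trans
    (sum-cong λ j → cong (shifted G i j *_) (trans (mat-unit (shifted G) i j) (shifted-sym G j i)))
    (row-square G i))
  (trans (∑-distrib-+ (λ _ → + 6) (λ i → sum (shifted G i))) (cong (_+ sum (λ i → sum (shifted G i))) (sum-const (Graph.order G) (+ 6))))

charPoly-shifted : ∀ G t → charPoly (shifted G) t ≡ charPoly (adjacency G) (t - + 3)
charPoly-shifted G t = det-cong λ i j →
  solve 3 (λ t u a → t :* u :- (a :+ num 3 :* u) := (t :- num 3) :* u :- a) refl t (identity i j) (adjacency G i j)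

mat-one : ∀ {n} (Y : Matrix n) i → mat Y one i ≡ sum (Y i)
mat-one Y i = sum-cong λ j → ℤ.*-identityʳ (Y i j)

mat-const : ∀ {n} (Y : Matrix n) c → (∀ i → sum (Y i) ≡ c) → ∀ k i → mat Y (λ _ → k) i ≡ k * c
mat-const Y c reg k i = trans (mat-cong Y (λ _ → sym (ℤ.*-identityʳ k)) i)
  (trans (power-scale Y 1 k one i) (cong (k *_) (trans (mat-one Y i) (reg i))))

-- The all-one vector is an eigenvector for `c`, and symmetry lets each factor act on it as the
-- scalar `c - d`.
dot-one-apply : ∀ {n} (Y : Matrix n) (Y-sym : ∀ i j → Y i j ≡ Y j i) c → (∀ i → sum (Y i) ≡ c) →
          ∀ d cs x → dot one (apply Y (d ∷ cs) x) ≡ (c - d) * dot one (apply Y cs x)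
dot-one-apply Y Y-sym c reg d cs x = trans (dot-linearʳ (- d) one (apply Y cs x) (mat Y (apply Y cs x)))
  (trans (cong (_+_ (- d * dot one (apply Y cs x))) (begin
      dot one (mat Y (apply Y cs x)) ≡⟨ Symmetric.mat-adjoint Y Y-sym one (apply Y cs x) ⟨
      dot (mat Y one) (apply Y cs x) ≡⟨ sum-cong (λ i → trans (cong (_* apply Y cs x i) (trans (mat-one Y i) (reg i)))
          (cong (c *_) (sym (ℤ.*-identityˡ (apply Y cs x i))))) ⟩
      sum (λ i → c * (1ℤ * apply Y cs x i)) ≡⟨ *-distribˡ-sum c (λ i → 1ℤ * apply Y cs x i) ⟨
      c * dot one (apply Y cs x) ∎))
    (solve 3 (λ c d s → :- d :* s :+ c :* s := (c :- d) :* s) refl c d (dot one (apply Y cs x))))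
  where open ≡-Reasoning

0<-* : ∀ {i j} → 0ℤ ℤ.< i → 0ℤ ℤ.< j → 0ℤ ℤ.< i * j
0<-* {+ suc m} {+ suc n} _ _ = ℤ.+<+ (ℕ.s≤s ℕ.z≤n)
0<-* {+ zero} (ℤ.+<+ ())
0<-* {+ suc m} {+ zero} _ (ℤ.+<+ ())

-- All that the combinatorial part takes from cospectrality. `cube-diagonal` is the diagonal of Y³,
-- which for constant degree fixes the number of triangles at a vertex.
record JohnsonLike (v : ℕ) {n} (Y : Matrix n) : Set where
  field
    positive-semidefinite : ∀ x → 0≤ dot (mat Y x) x
    row-sum : ∀ i → sum (Y i) ≡ + 3 * (+ v - + 2)
    cube-diagonal : ∀ i → dot (Y i) (mat Y (Y i)) ≡ + 3 * (+ v * + v) + + 12 * + v - + 36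

module CospectralToJohnson (v w : ℕ) (v≡7+w : v ≡ 7 ℕ.+ w) (G : Graph) (cospectral : Cospectral G (johnson₃ v)) where

  open Johnson v using (a; b; cubic)

  c : ℤ
  c = + 3 * (+ v - + 2)

  Z = shifted (johnson₃ v)
  Y = shifted G

  module SZ = Symmetric Z (shifted-sym (johnson₃ v))
  module SY = Symmetric Y (shifted-sym G)

  trace-equal : ∀ k → trace-power Y k ≡ trace-power Z k
  trace-equal = SameCharPoly.trace-power-equal Y Z λ t → trans (charPoly-shifted G t)
    (trans (cospectral-charPoly G (johnson₃ v) cospectral (t - + 3)) (sym (charPoly-shifted (johnson₃ v) t)))

  Z-regular : ∀ i → sum (Z i) ≡ c
  Z-regular i = trans (sym (mat-one Z i)) (Johnson.row-sum v i)

  quartic : ∀ x i → apply Z (c ∷ 0ℤ ∷ a ∷ b ∷ []) x i ≡ 0ℤ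
  quartic x i = begin
    - c * apply Z (0ℤ ∷ a ∷ b ∷ []) x i + mat Z (apply Z (0ℤ ∷ a ∷ b ∷ []) x) i
      ≡⟨ cong₂ (λ p q → - c * p + q) (cubic x i) (trans (mat-cong Z (cubic x) i) (mat-const Z c Z-regular (+ 36 * sum x) i)) ⟩
    - c * (+ 36 * sum x) + + 36 * sum x * c
      ≡⟨ solve 2 (λ c x → :- c :* x :+ x :* c := num 0) refl c (+ 36 * sum x) ⟩
    0ℤ ∎
    where open ≡-Reasoning

  root : ∀ x i → apply Y (c ∷ 0ℤ ∷ a ∷ b ∷ []) x i ≡ 0ℤ
  root = SY.apply-zero ps (trans (functional-cong trace-equal 0 (ps ++ ps)) (trans (sym (SZ.trace-square ps))
    (sum-zero (λ e → dot (apply Z ps (unit e)) (apply Z ps (unit e))) λ e →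
      sum-zero (λ i → apply Z ps (unit e) i * apply Z ps (unit e) i) λ i →
        trans (cong (_* apply Z ps (unit e) i) (quartic (unit e) i)) (ℤ.*-zeroˡ (apply Z ps (unit e) i)))))
    where ps = c ∷ 0ℤ ∷ a ∷ b ∷ []

  W = + w

  -- Substituting `v = 7 + w` turns each expression below into a visible successor.
  positive : ∀ (f : ℤ → ℤ) k → f (+ 7 + W) ≡ + suc k → 0ℤ ℤ.< f (+ v)
  positive f k eq = subst (0ℤ ℤ.<_) (sym (trans (cong (λ v → f (+ v)) v≡7+w) eq)) (ℤ.+<+ (ℕ.s≤s ℕ.z≤n))

  0<a : 0ℤ ℤ.< a
  0<a = positive (λ t → t - + 4) (2 ℕ.+ w) (solve 1 (λ w → num 7 :+ w :- num 4 := num 3 :+ w) refl W)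

  0<b-a : 0ℤ ℤ.< b - a
  0<b-a = positive (λ t → (+ 2 * t - + 6) - (t - + 4)) (4 ℕ.+ w) (solve 1 (λ w → (num 2 :* (num 7 :+ w) :- num 6) :- (num 7 :+ w :- num 4)
    := num 5 :+ w) refl W)

  0<b : 0ℤ ℤ.< b
  0<b = positive (λ t → + 2 * t - + 6) (7 ℕ.+ (w ℕ.+ w)) (solve 1 (λ w → num 2 :* (num 7 :+ w) :- num 6 := num 8 :+ (w :+ w)) refl W)

  0<c-a : 0ℤ ℤ.< c - a
  0<c-a = positive (λ t → + 3 * (t - + 2) - (t - + 4)) (11 ℕ.+ (w ℕ.+ w)) (solve 1 (λ w → (num 3 :* (num 7 :+ w :- num 2)) :- (num 7 :+ w :- num 4)
    := num 12 :+ (w :+ w)) refl W)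

  0<c-b : 0ℤ ℤ.< c - b
  0<c-b = positive (λ t → + 3 * (t - + 2) - (+ 2 * t - + 6)) (6 ℕ.+ w) (solve 1 (λ w → (num 3 :* (num 7 :+ w :- num 2)) :- (num 2 :* (num 7 :+ w) :- num 6)
    := num 7 :+ w) refl W)

  0<c : 0ℤ ℤ.< c
  0<c = positive (λ t → + 3 * (t - + 2)) (14 ℕ.+ (w ℕ.+ (w ℕ.+ w))) (solve 1 (λ w → num 3 :* (num 7 :+ w :- num 2) := num 15 :+ (w :+ (w :+ w))) refl W)

  0≤c-b-a : 0≤ c - b - a
  0≤c-b-a = subst 0≤_ (sym (solve 1 (λ v → (num 3 :* (v :- num 2)) :- (num 2 :* v :- num 6)
    :- (v :- num 4) := num 4) refl (+ v))) (ℤ.+≤+ ℕ.z≤n)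

  open FourRoots Y (shifted-sym G) a b c root (0<-* (0<-* 0<a 0<b-a) 0<c-a) (0<-* 0<b 0<c-b) 0<c 0≤c-b-a
    using (positive-semidefinite; largest-root-attained)

  m : ℕ
  m = Graph.order (johnson₃ v)

  N : ℤ
  N = sum (one {Graph.order G})

  N-equal : N ≡ sum (one {m})
  N-equal = trans (sym (trace-power₀ Y)) (trans (trace-equal 0) (trace-power₀ Z))

  total : sum (λ i → sum (Y i)) ≡ c * N
  total = ∙-cancelˡ (+ 6 * N) _ _ (begin
    + 6 * N + sum (λ i → sum (Y i)) ≡⟨ trace-power₂ G ⟨
    trace-power Y 2 ≡⟨ trace-equal 2 ⟩
    trace-power Z 2 ≡⟨ trace-power₂ (johnson₃ v) ⟩
    + 6 * sum (one {m}) + sum (λ i → sum (Z i)) ≡⟨ cong (_+_ (+ 6 * sum (one {m})))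
          (trans (sum-cong {m} Z-regular) (sum-const m c)) ⟩
    + 6 * sum (one {m}) + c * sum (one {m})
          ≡⟨ cong (λ x → + 6 * x + c * x) N-equal ⟨
    + 6 * N + c * N ∎)
    where open ≡-Reasoning

  -- tr Y² fixes the average row sum as `c`, the largest root; so the all-one vector attains the
  -- maximal Rayleigh quotient and is an eigenvector.
  Y-regular : ∀ i → sum (Y i) ≡ c
  Y-regular i = trans (sym (mat-one Y i)) (trans (largest-root-attained one (begin
    sum (λ i → mat Y one i * 1ℤ) ≡⟨ sum-cong (λ i → trans (ℤ.*-identityʳ (mat Y one i)) (mat-one Y i)) ⟩
    sum (λ i → sum (Y i)) ≡⟨ total ⟩
    c * N ∎) i) (ℤ.*-identityʳ c))
    where open ≡-Reasoning

  qs : List ℤ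
  qs = 0ℤ ∷ a ∷ b ∷ []

  Q : ℤ
  Q = (c - 0ℤ) * ((c - a) * (c - b))

  dot-one-cubic : ∀ {n} (M : Matrix n) → (∀ i j → M i j ≡ M j i) → (∀ i → sum (M i) ≡ c) → ∀ e → dot one (apply M qs (unit e)) ≡ Q
  dot-one-cubic M M-sym reg e = begin
    dot one (apply M qs (unit e))
      ≡⟨ dot-one-apply M M-sym c reg 0ℤ (a ∷ b ∷ []) (unit e) ⟩
    (c - 0ℤ) * dot one (apply M (a ∷ b ∷ []) (unit e))
      ≡⟨ cong ((c - 0ℤ) *_) (dot-one-apply M M-sym c reg a (b ∷ []) (unit e)) ⟩
    (c - 0ℤ) * ((c - a) * dot one (apply M (b ∷ []) (unit e)))
      ≡⟨ cong (λ z → (c - 0ℤ) * ((c - a) * z)) (dot-one-apply M M-sym c reg b [] (unit e)) ⟩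
    (c - 0ℤ) * ((c - a) * ((c - b) * dot one (unit e)))
      ≡⟨ cong (λ z → (c - 0ℤ) * ((c - a) * z)) (trans (cong ((c - b) *_) (dot-unit e one)) (ℤ.*-identityʳ (c - b))) ⟩
    Q ∎
    where open ≡-Reasoning

  cubic-unit : ∀ e i → apply Z qs (unit e) i ≡ + 36
  cubic-unit e i = trans (cubic (unit e) i) (trans (cong (+ 36 *_) (sum-unit-one e)) refl)

  sum²-const : ∀ k → sum {m} (λ _ → sum {m} (λ _ → k)) ≡ k * N * N
  sum²-const k = trans (sum-const m (sum {m} (λ _ → k))) (trans (cong (_* sum (one {m})) (sum-const m k))
    (cong (λ x → k * x * x) (sym N-equal)))

  -- The entries of the cubic in `Z` are summed twice: column by column through the eigenvector
  -- `one`, and as constants 36.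
  Q-value : Q * N ≡ + 36 * N * N
  Q-value = begin
    Q * N ≡⟨ cong (Q *_) N-equal ⟩
    Q * sum (one {m}) ≡⟨ sum-const m Q ⟨
    sum {m} (λ e → Q) ≡⟨ sum-cong {m} (dot-one-cubic Z (shifted-sym (johnson₃ v)) Z-regular) ⟨
    sum {m} (λ e → dot one (apply Z qs (unit e))) ≡⟨ sum-cong {m} (λ e → sum-cong {m} λ i →
          trans (ℤ.*-identityˡ (apply Z qs (unit e) i)) (cubic-unit e i)) ⟩
    sum {m} (λ _ → sum {m} (λ _ → + 36)) ≡⟨ sum²-const (+ 36) ⟩
    + 36 * N * N ∎
    where open ≡-Reasoning

  Q-squares : sum (λ e → dot (apply Y qs (unit e)) (apply Y qs (unit e))) ≡ + 36 * + 36 * N * N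
  Q-squares = begin
    sum (λ e → dot (apply Y qs (unit e)) (apply Y qs (unit e))) ≡⟨ SY.trace-square qs ⟩
    functional (trace-power Y) 0 (qs ++ qs) ≡⟨ functional-cong trace-equal 0 (qs ++ qs) ⟩
    functional (trace-power Z) 0 (qs ++ qs) ≡⟨ SZ.trace-square qs ⟨
    sum (λ e → dot (apply Z qs (unit e)) (apply Z qs (unit e))) ≡⟨ sum-cong {m} (λ e → sum-cong {m} λ i → cong₂ _*_ (cubic-unit e i) (cubic-unit e i)) ⟩
    sum {m} (λ _ → sum {m} (λ _ → + 36 * + 36)) ≡⟨ sum²-const (+ 36 * + 36) ⟩
    + 36 * + 36 * N * N ∎
    where open ≡-Reasoning

  -- With z ranging over the entries of the cubic in `Y`, the sum of (z - 36)² is Σ z² - 72 Σ z +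
  -- 36² N². Here Σ z² is a trace and Σ z follows from regularity, so both have their values for the
  -- Johnson graph, where every z is 36.
  Y-cubic : ∀ e i → apply Y qs (unit e) i ≡ + 36
  Y-cubic e i = ℤ.i-j≡0⇒i≡j _ _ (trans (solve 1 (λ z → z :- num 36 := con (- (+ 36)) :* num 1 :+ z) refl (apply Y qs (unit e) i))
    (dot-self-zero (D e) (sum-zero⇒zero (λ e → dot (D e) (D e)) (λ e → dot-self-nonneg (D e)) distance e) i))
    where
    D : ∀ e → Vector (Graph.order G)
    D e i = - (+ 36) * 1ℤ + apply Y qs (unit e) i

    open ≡-Reasoning
    expand : ∀ e → dot (D e) (D e) ≡ (+ 36 * + 36 * N + - (+ 72) * Q) + dot (apply Y qs (unit e)) (apply Y qs (unit e))
    expand e = begin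
      dot (D e) (D e)
        ≡⟨ dot-linearʳ (- (+ 36)) (D e) one z ⟩
      - (+ 36) * dot (D e) one + dot (D e) z
        ≡⟨ cong₂ (λ p q → - (+ 36) * p + q) (dot-linearˡ (- (+ 36)) one z one) (dot-linearˡ (- (+ 36)) one z z) ⟩
      - (+ 36) * (- (+ 36) * N + dot z one) + (- (+ 36) * dot one z + dot z z)
        ≡⟨ cong₂ (λ p q → - (+ 36) * (- (+ 36) * N + p) + (- (+ 36) * q + dot z z)) (trans (dot-comm z one) Q≡) Q≡ ⟩
      - (+ 36) * (- (+ 36) * N + Q) + (- (+ 36) * Q + dot z z)
        ≡⟨ solve 3 (λ n q z → con (- (+ 36)) :* (con (- (+ 36)) :* n :+ q) :+ (con (- (+ 36)) :* q :+ z)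
          := (num 36 :* num 36 :* n :+ con (- (+ 72)) :* q) :+ z) refl N Q (dot z z) ⟩
      (+ 36 * + 36 * N + - (+ 72) * Q) + dot z z ∎
      where
      z = apply Y qs (unit e)
      Q≡ = dot-one-cubic Y (shifted-sym G) Y-regular e

    distance : sum (λ e → dot (D e) (D e)) ≡ 0ℤ
    distance = begin
      sum (λ e → dot (D e) (D e))
        ≡⟨ sum-cong expand ⟩
      sum (λ e → (+ 36 * + 36 * N + - (+ 72) * Q) + dot (apply Y qs (unit e)) (apply Y qs (unit e)))
        ≡⟨ ∑-distrib-+ (λ _ → + 36 * + 36 * N + - (+ 72) * Q) (λ e → dot (apply Y qs (unit e)) (apply Y qs (unit e))) ⟩
      sum {Graph.order G} (λ _ → + 36 * + 36 * N + - (+ 72) * Q) + sum (λ e → dot (apply Y qs (unit e)) (apply Y qs (unit e)))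
        ≡⟨ cong₂ _+_ (sum-const (Graph.order G) (+ 36 * + 36 * N + - (+ 72) * Q)) Q-squares ⟩
      (+ 36 * + 36 * N + - (+ 72) * Q) * N + + 36 * + 36 * N * N
        ≡⟨ solve 2 (λ n q → (num 36 :* num 36 :* n :+ con (- (+ 72)) :* q) :* n :+ num 36 :* num 36 :* n :* n
          := num 72 :* (num 36 :* n :* n :- q :* n)) refl N Q ⟩
      + 72 * (+ 36 * N * N - Q * N)
        ≡⟨ cong (λ z → + 72 * (+ 36 * N * N - z)) Q-value ⟩
      + 72 * (+ 36 * N * N - + 36 * N * N)
        ≡⟨ solve 1 (λ z → num 72 :* (z :- z) := num 0) refl (+ 36 * N * N) ⟩
      0ℤ ∎

  Y-cube : ∀ e → dot (Y e) (mat Y (Y e)) ≡ + 3 * (+ v * + v) + + 12 * + v - + 36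
  Y-cube e = begin
    m₃
      ≡⟨ solve 5 (λ a b m₁ m₂ m₃ → m₃ := ((:- num 0 :* (:- a :* (:- b :* num 1 :+ m₁) :+ (:- b :* m₁ :+ m₂)))
          :+ (:- a :* (:- b :* m₁ :+ m₂) :+ (:- b :* m₂ :+ m₃))) :+ (a :+ b) :* m₂ :- a :* b :* m₁) refl a b (+ 3) (+ 6 + c) m₃ ⟩
    ((- 0ℤ * (- a * (- b * 1ℤ + + 3) + (- b * + 3 + (+ 6 + c)))) + (- a * (- b * + 3 + (+ 6 + c)) + (- b * (+ 6 + c) + m₃)))
      + (a + b) * (+ 6 + c) - a * b * + 3
      ≡⟨ cong (λ z → z + (a + b) * (+ 6 + c) - a * b * + 3) value ⟩
    + 36 + (a + b) * (+ 6 + c) - a * b * + 3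
      ≡⟨ solve 1 (λ v → let a = v :- num 4 ; b = num 2 :* v :- num 6 ; c = num 3 :* (v :- num 2) in
          num 36 :+ (a :+ b) :* (num 6 :+ c) :- a :* b :* num 3
          := num 3 :* (v :* v) :+ num 12 :* v :- num 36) refl (+ v) ⟩
    + 3 * (+ v * + v) + + 12 * + v - + 36 ∎
    where
    open ≡-Reasoning
    m₃ = dot (Y e) (mat Y (Y e))
    μ = SY.moment (unit e)
    column : ∀ j → mat Y (unit e) j ≡ Y e j
    column j = trans (mat-unit Y e j) (shifted-sym G j e)
    μ₀ : μ 0 ≡ 1ℤ
    μ₀ = trans (dot-unit e (unit e)) (unit-diag e)
    μ₁ : μ 1 ≡ + 3
    μ₁ = trans (dot-unit e (mat Y (unit e))) (trans (column e) (shifted-diag G e))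
    μ₂ : μ 2 ≡ + 6 + c
    μ₂ = trans (dot-unit e (mat Y (mat Y (unit e)))) (trans (sum-cong λ j → cong (Y e j *_) (column j))
      (trans (row-square G e) (cong (_+_ (+ 6)) (Y-regular e))))
    μ₃ : μ 3 ≡ m₃
    μ₃ = trans (dot-unit e (mat Y (mat Y (mat Y (unit e))))) (sum-cong λ j → cong (Y e j *_) (mat-cong Y column j))
    value : ((- 0ℤ * (- a * (- b * 1ℤ + + 3) + (- b * + 3 + (+ 6 + c)))) + (- a * (- b * + 3 + (+ 6 + c)) + (- b * (+ 6 + c) + m₃))) ≡ + 36
    value = begin
      (- 0ℤ * (- a * (- b * 1ℤ + + 3) + (- b * + 3 + (+ 6 + c)))) + (- a * (- b * + 3 + (+ 6 + c)) + (- b * (+ 6 + c) + m₃))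
        -- Four factors of lists only reach the moments 0 to 3; from 4 on the true moments are kept,
        -- so that agreement there is `refl`.
        ≡⟨ functional-cong {μ = λ { 0 → 1ℤ ; 1 → + 3 ; 2 → + 6 + c ; 3 → m₃ ; k@(suc (suc (suc (suc _)))) → μ k }} {ν = μ}
          (λ { 0 → sym μ₀ ; 1 → sym μ₁ ; 2 → sym μ₂ ; 3 → sym μ₃ ; (suc (suc (suc (suc _)))) → refl }) 0 qs ⟩
      functional μ 0 qs
        ≡⟨ SY.dot-power-apply 0 qs (unit e) ⟨
      dot (unit e) (apply Y qs (unit e))
        ≡⟨ sum-unit e (apply Y qs (unit e)) ⟩
      apply Y qs (unit e) e
        ≡⟨ Y-cubic e e ⟩
      + 36 ∎

  johnsonLike : JohnsonLike v Y
  johnsonLike = record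
    { positive-semidefinite = positive-semidefinite
    ; row-sum = Y-regular
    ; cube-diagonal = Y-cube
    }

-- Large cliques

length-filter-split : ∀ {A : Set} {P : A → Set} (P? : ∀ x → Dec (P x)) xs →
          length (filter P? xs) ℕ.+ length (filter (¬? ∘ P?) xs) ≡ length xs
length-filter-split P? [] = refl
length-filter-split P? (x ∷ xs) with P? x
... | yes _ = cong suc (length-filter-split P? xs)
... | no _ = trans (ℕ.+-suc _ _) (cong suc (length-filter-split P? xs))

-- Lists of distinct elements stand for finite sets. The predicate `P` is carried along so that the
-- recursion can record adjacency or nonadjacency to `x`, by which the list found is extended.
Ramsey : ℕ → ℕ → ℕ → Set₁
Ramsey s t R = ∀ {A : Set} {_∼_ : A → A → Set} (_∼?_ : ∀ x y → Dec (x ∼ y)) (P : A → Set) xs →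
  AllPairs _≢_ xs → All P xs → R ≤ length xs →
  (∃[ ys ] (length ys ≡ s × AllPairs _∼_ ys × All P ys)) ⊎
  (∃[ ys ] (length ys ≡ t × AllPairs (λ x y → x ≢ y × ¬ (x ∼ y)) ys × All P ys))

abstract
  -- The usual recursion, splitting by adjacency to the first element. It is abstract so that the
  -- enormous number for 915 and 10 is never evaluated.
  ramsey : ∀ s t → ∃[ R ] Ramsey s t R
  ramsey zero t = 0 , λ _∼?_ P xs u ps le → inj₁ ([] , refl , [] , [])
  ramsey (suc s) zero = 0 , λ _∼?_ P xs u ps le → inj₂ ([] , refl , [] , [])
  ramsey (suc s) (suc t) = suc (R₁ ℕ.+ R₂) , step
    where
    R₁ R₂ : ℕ
    R₁ = proj₁ (ramsey s (suc t))
    R₂ = proj₁ (ramsey (suc s) t)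
    step : Ramsey (suc s) (suc t) (suc (R₁ ℕ.+ R₂))
    step {_∼_ = _∼_} _∼?_ P (x ∷ xs) (x≢xs ∷ u) (px ∷ pxs) (ℕ.s≤s le) with ℕ.≤-total R₁ (length (filter (x ∼?_) xs))
    ... | inj₁ R₁≤ with proj₂ (ramsey s (suc t)) _∼?_ (λ y → P y × x ∼ y) (filter (x ∼?_) xs) (AllPairs.filter⁺ (x ∼?_) u)
          (All.zip (All.filter⁺ (x ∼?_) pxs , All.all-filter (x ∼?_) xs)) R₁≤
    ... | inj₁ (ys , l , c , ps) = inj₁ (x ∷ ys , cong suc l , All.map proj₂ ps ∷ c , px ∷ All.map proj₁ ps)
    ... | inj₂ (ys , l , c , ps) = inj₂ (ys , l , c , All.map proj₁ ps)
    step {_∼_ = _∼_} _∼?_ P (x ∷ xs) (x≢xs ∷ u) (px ∷ pxs) (ℕ.s≤s le) | inj₂ ≤R₁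
      with proj₂ (ramsey (suc s) t) _∼?_ (λ y → P y × (x ≢ y × ¬ (x ∼ y))) (filter (¬? ∘ (x ∼?_)) xs) (AllPairs.filter⁺ (¬? ∘ (x ∼?_)) u)
          (All.zip (All.filter⁺ (¬? ∘ (x ∼?_)) pxs ,
          All.zip (All.filter⁺ (¬? ∘ (x ∼?_)) x≢xs , All.all-filter (¬? ∘ (x ∼?_)) xs)))
          (ℕ.+-cancelˡ-≤ R₁ _ _ (ℕ.≤-trans le (ℕ.≤-trans (ℕ.≤-reflexive (sym (length-filter-split (x ∼?_) xs))) (ℕ.+-monoˡ-≤ _ ≤R₁))))
    ... | inj₁ (ys , l , c , ps) = inj₁ (ys , l , c , All.map proj₁ ps)
    ... | inj₂ (ys , l , c , ps) = inj₂ (x ∷ ys , cong suc l , All.map proj₂ ps ∷ c , px ∷ All.map proj₁ ps)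

-- Sums over lists and inequalities as nonnegativity

Σˡ : ∀ {A : Set} → (A → ℤ) → List A → ℤ
Σˡ f [] = 0ℤ
Σˡ f (x ∷ xs) = f x + Σˡ f xs

size : ∀ {A : Set} → List A → ℤ
size xs = + length xs

Σˡ-linear : ∀ {A : Set} c (f g : A → ℤ) xs → Σˡ (λ x → c * f x + g x) xs ≡ c * Σˡ f xs + Σˡ g xs
Σˡ-linear c f g [] = solve 1 (λ c → num 0 := c :* num 0 :+ num 0) refl c
Σˡ-linear c f g (x ∷ xs) = trans (cong (_+_ (c * f x + g x)) (Σˡ-linear c f g xs))
  (solve 5 (λ c p q r s → (c :* p :+ q) :+ (c :* r :+ s) := c :* (p :+ r) :+ (q :+ s)) refl c (f x) (g x) (Σˡ f xs) (Σˡ g xs))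

Σˡ-cong : ∀ {A : Set} {f g : A → ℤ} {xs} → All (λ x → f x ≡ g x) xs → Σˡ f xs ≡ Σˡ g xs
Σˡ-cong [] = refl
Σˡ-cong (e ∷ es) = cong₂ _+_ e (Σˡ-cong es)

Σˡ-nonneg : ∀ {A : Set} {f : A → ℤ} {xs} → All (λ x → 0≤ f x) xs → 0≤ Σˡ f xs
Σˡ-nonneg [] = ℤ.≤-refl
Σˡ-nonneg (p ∷ ps) = 0≤-+ p (Σˡ-nonneg ps)

Σˡ-const : ∀ {A : Set} c (xs : List A) → Σˡ (λ _ → c) xs ≡ c * size xs
Σˡ-const c [] = sym (ℤ.*-zeroʳ c)
Σˡ-const c (x ∷ xs) = trans (cong (_+_ c) (Σˡ-const c xs)) (solve 2 (λ c n → c :+ c :* n := c :* (num 1 :+ n)) refl c (size xs))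

Σˡ-lower : ∀ {A : Set} {f : A → ℤ} {xs} k → All (λ x → 0≤ f x - k) xs → 0≤ Σˡ f xs - k * size xs
Σˡ-lower {f = f} {xs} k ps = subst 0≤_
  (trans (Σˡ-cong (All.universal (λ x → solve 2 (λ p k → p :- k := num 1 :* p :+ :- k) refl (f x) k) xs))
    (trans (Σˡ-linear 1ℤ f (λ _ → - k) xs) (trans (cong (_+_ (1ℤ * Σˡ f xs)) (Σˡ-const (- k) xs))
      (solve 3 (λ s k n → num 1 :* s :+ :- k :* n := s :- k :* n) refl (Σˡ f xs) k (size xs)))))
  (Σˡ-nonneg ps)

Σˡ-upper : ∀ {A : Set} {f : A → ℤ} {xs} k → All (λ x → 0≤ k - f x) xs → 0≤ k * size xs - Σˡ f xs
Σˡ-upper {f = f} {xs} k ps = subst 0≤_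
  (trans (Σˡ-cong (All.universal (λ x → solve 2 (λ p k → k :- p := con (- 1ℤ) :* p :+ k) refl (f x) k) xs))
    (trans (Σˡ-linear (- 1ℤ) f (λ _ → k) xs) (trans (cong (_+_ (- 1ℤ * Σˡ f xs)) (Σˡ-const k xs))
      (solve 3 (λ s k n → con (- 1ℤ) :* s :+ k :* n := k :* n :- s) refl (Σˡ f xs) k (size xs)))))
  (Σˡ-nonneg ps)

-- Over ℤ the failure of an inequality gives a full unit of slack and is again a nonnegativity
-- statement, ready to be added to others.
sign-cases : ∀ z → 0≤ z ⊎ 0≤ - 1ℤ - z
sign-cases (+ n) = inj₁ (ℤ.+≤+ ℕ.z≤n)
sign-cases ℤ.-[1+ n ] = inj₂ (ℤ.+≤+ ℕ.z≤n)

-- Inequalities are refuted by a sum of products of nonnegative terms that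
-- is identically a negative constant.
absurd-nonneg : ∀ {e} k → 0≤ e → e ≡ ℤ.-[1+ k ] → ⊥
absurd-nonneg k () refl

0≤+ : ∀ n → 0≤ + n
0≤+ n = ℤ.+≤+ ℕ.z≤n

-- The quadratic form of a positive semidefinite matrix

module Form {n} (B : Matrix n) (B-sym : ∀ i j → B i j ≡ B j i) (positive-semidefinite : ∀ x → 0≤ dot (mat B x) x) where

  form : Vector n → Vector n → ℤ
  form x y = dot x (mat B y)

  form-comm : ∀ x y → form x y ≡ form y x
  form-comm x y = trans (sym (Symmetric.mat-adjoint B B-sym x y)) (dot-comm (mat B x) y)

  form-linearʳ : ∀ c x y z → form x (λ i → c * y i + z i) ≡ c * form x y + form x z
  form-linearʳ c x y z = trans (dot-cong {x = x} (λ _ → refl) (mat-linear B c y z)) (dot-linearʳ c x (mat B y) (mat B z))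

  form-linearˡ : ∀ c x y z → form (λ i → c * x i + y i) z ≡ c * form x z + form y z
  form-linearˡ c x y z = dot-linearˡ c x y (mat B z)

  norm-linear : ∀ c x z → form (λ i → c * x i + z i) (λ i → c * x i + z i) ≡ c * c * form x x + + 2 * c * form x z + form z z
  norm-linear c x z = trans (form-linearˡ c x z (λ i → c * x i + z i)) (trans
    (cong₂ (λ p q → c * p + q) (form-linearʳ c x x z) (trans (form-linearʳ c z x z) (cong (λ p → c * p + form z z) (form-comm z x))))
    (solve 4 (λ c p q r → c :* (c :* p :+ q) :+ (c :* q :+ r) := c :* c :* p :+ num 2 :* c :* q :+ r) refl c (form x x) (form x z) (form z z)))

  form-unit : ∀ i j → form (unit i) (unit j) ≡ B i j
  form-unit i j = trans (sum-unit i (mat B (unit j))) (mat-unit B j i)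

  -- With `s` the inner product of `unit y` and `u`, the vector `3u - s unit y` has norm
  -- `3 (3 ⟨u,u⟩ - s²)`; the factor 3 clears the denominator of the projection.
  cauchy-schwarz : ∀ y u → B y y ≡ + 3 → 0≤ + 3 * form u u - form (unit y) u * form (unit y) u
  cauchy-schwarz y u Byy = 0≤-cancel (+ 3) _ (ℤ.+<+ (ℕ.s≤s ℕ.z≤n)) (subst 0≤_ eq
    (subst 0≤_ (dot-comm (mat B x) x) (positive-semidefinite x)))
    where
    s = form (unit y) u
    u₃ x : Vector n
    -- `3u` in the shape `c * x + z` that `norm-linear` expands.
    u₃ i = + 2 * u i + u i
    x i = - s * unit y i + u₃ i
    eq : form x x ≡ + 3 * (+ 3 * form u u - s * s)
    eq = trans (norm-linear (- s) (unit y) u₃) (trans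
      (cong₂ (λ p q → p + q) (cong₂ (λ p q → - s * - s * p + + 2 * - s * q) (trans (form-unit y y) Byy) (form-linearʳ (+ 2) (unit y) u u))
        (norm-linear (+ 2) u u))
      (solve 2 (λ s N → (:- s :* :- s :* num 3 :+ num 2 :* :- s :* (num 2 :* s :+ s))
          :+ (num 2 :* num 2 :* N :+ num 2 :* num 2 :* N :+ N)
        := num 3 :* (num 3 :* N :- s :* s)) refl s (form u u)))

  comb : (Fin n → ℤ) → List (Fin n) → Vector n
  comb w [] = λ _ → 0ℤ
  comb w (q ∷ qs) = λ i → w q * unit q i + comb w qs i

  form-zeroʳ : ∀ x → form x (λ _ → 0ℤ) ≡ 0ℤ
  form-zeroʳ x = sum-zero (λ i → x i * mat B (λ _ → 0ℤ) i) λ i →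
    trans (cong (x i *_) (sum-zero (λ j → B i j * 0ℤ) λ j → ℤ.*-zeroʳ (B i j))) (ℤ.*-zeroʳ (x i))

  form-comb : ∀ x w qs → form x (comb w qs) ≡ Σˡ (λ q → w q * form x (unit q)) qs
  form-comb x w [] = form-zeroʳ x
  form-comb x w (q ∷ qs) = trans (form-linearʳ (w q) x (unit q) (comb w qs)) (cong (_+_ (w q * form x (unit q))) (form-comb x w qs))

  form-unit-comb : ∀ y w qs → form (unit y) (comb w qs) ≡ Σˡ (λ q → w q * B y q) qs
  form-unit-comb y w qs = trans (form-comb (unit y) w qs) (Σˡ-cong (All.universal (λ q → cong (w q *_) (form-unit y q)) qs))

record ShiftedAdjacency {n} (B : Matrix n) : Set₁ where
  infix 4 _∼_ _∼?_
  field
    B-sym : ∀ i j → B i j ≡ B j i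
    positive-semidefinite : ∀ x → 0≤ dot (mat B x) x
    B-diag : ∀ i → B i i ≡ + 3
    _∼_ : Fin n → Fin n → Set
    _∼?_ : ∀ i j → Dec (i ∼ j)
    ∼-sym : ∀ {i j} → i ∼ j → j ∼ i
    ∼-irrefl : ∀ {i j} → i ∼ j → i ≢ j
    B-adjacent : ∀ {i j} → i ∼ j → B i j ≡ 1ℤ
    B-nonadjacent : ∀ {i j} → i ≢ j → ¬ (i ∼ j) → B i j ≡ 0ℤ

module Lines {n} {B : Matrix n} (S : ShiftedAdjacency B) where

  open ShiftedAdjacency S
  open Form B B-sym positive-semidefinite public

  Clique : List (Fin n) → Set
  Clique = AllPairs _∼_

  B-cases : ∀ i j → i ≡ j ⊎ (i ∼ j) ⊎ (i ≢ j × ¬ (i ∼ j))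
  B-cases i j with i Fin.≟ j | i ∼? j
  ... | yes i≡j | _ = inj₁ i≡j
  ... | no _ | yes i∼j = inj₂ (inj₁ i∼j)
  ... | no i≢j | no i≁j = inj₂ (inj₂ (i≢j , i≁j))

  B-nonneg : ∀ i j → 0≤ B i j
  B-nonneg i j with B-cases i j
  ... | inj₁ refl = subst 0≤_ (sym (B-diag i)) (0≤+ 3)
  ... | inj₂ (inj₁ i∼j) = subst 0≤_ (sym (B-adjacent i∼j)) (0≤+ 1)
  ... | inj₂ (inj₂ (i≢j , i≁j)) = subst 0≤_ (sym (B-nonadjacent i≢j i≁j)) (0≤+ 0)

  -- The inner product of y with the sum of the vertices of Q.
  D : Fin n → List (Fin n) → ℤ
  D y = Σˡ (B y)

  D-nonneg : ∀ y Q → 0≤ D y Q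
  D-nonneg y Q = Σˡ-nonneg (All.universal (B-nonneg y) Q)

  total : List (Fin n) → Vector n
  total = comb (λ _ → 1ℤ)

  form-unit-total : ∀ y Q → form (unit y) (total Q) ≡ D y Q
  form-unit-total y Q = trans (form-unit-comb y (λ _ → 1ℤ) Q) (Σˡ-cong (All.universal (λ q → ℤ.*-identityˡ (B y q)) Q))

  form-total-total : ∀ Q Q′ → form (total Q) (total Q′) ≡ Σˡ (λ q → D q Q) Q′
  form-total-total Q Q′ = trans (form-comb (total Q) (λ _ → 1ℤ) Q′) (Σˡ-cong (All.universal
    (λ q → trans (ℤ.*-identityˡ _) (trans (form-comm (total Q) (unit q)) (form-unit-total q Q))) Q′))

  -- On a clique the matrix `B` is J + 2I.
  weighted-clique-norm : ∀ w Q → Clique Q →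
    form (comb w Q) (comb w Q) ≡ Σˡ w Q * Σˡ w Q + + 2 * Σˡ (λ q → w q * w q) Q
  weighted-clique-norm w [] [] = form-zeroʳ (λ _ → 0ℤ)
  weighted-clique-norm w (q ∷ Q) (q∼Q ∷ cl) = trans (norm-linear (w q) (unit q) (comb w Q)) (trans
    (cong₂ _+_ (cong₂ (λ x y → w q * w q * x + + 2 * w q * y) (trans (form-unit q q) (B-diag q))
        (trans (form-unit-comb q w Q) (Σˡ-cong (All.map (λ {r} q∼r → trans (cong (w r *_) (B-adjacent q∼r)) (ℤ.*-identityʳ (w r))) q∼Q))))
      (weighted-clique-norm w Q cl))
    (solve 3 (λ x s t → (x :* x :* num 3 :+ num 2 :* x :* s) :+ (s :* s :+ num 2 :* t)
      := (x :+ s) :* (x :+ s) :+ num 2 :* (x :* x :+ t)) refl (w q) (Σˡ w Q) (Σˡ (λ q → w q * w q) Q)))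

  clique-norm : ∀ Q → Clique Q → form (total Q) (total Q) ≡ size Q * size Q + + 2 * size Q
  clique-norm Q cl = trans (weighted-clique-norm (λ _ → 1ℤ) Q cl)
    (cong (λ s → s * s + + 2 * s) (trans (Σˡ-const 1ℤ Q) (ℤ.*-identityˡ (size Q))))

  coclique-norm : ∀ Z → AllPairs (λ x y → x ≢ y × ¬ (x ∼ y)) Z → form (total Z) (total Z) ≡ + 3 * size Z
  coclique-norm [] [] = form-zeroʳ (λ _ → 0ℤ)
  coclique-norm (z ∷ Z) (z≁Z ∷ co) = trans (norm-linear 1ℤ (unit z) (total Z)) (trans
    (cong₂ _+_ (cong₂ (λ x y → 1ℤ * 1ℤ * x + + 2 * 1ℤ * y) (trans (form-unit z z) (B-diag z))
        (trans (form-unit-total z Z) (trans (Σˡ-cong (All.map (λ { (z≢r , z≁r) → B-nonadjacent z≢r z≁r }) z≁Z)) (Σˡ-const 0ℤ Z))))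
      (coclique-norm Z co))
    (solve 1 (λ s → (num 1 :* num 1 :* num 3 :+ num 2 :* num 1 :* (num 0 :* s)) :+ num 3 :* s
      := num 3 :* (num 1 :+ s)) refl (size Z)))

  D-neighbours : ∀ {x Q} → All (x ∼_) Q → D x Q ≡ size Q
  D-neighbours {x} {Q} x∼Q = trans (Σˡ-cong (All.map B-adjacent x∼Q)) (trans (Σˡ-const 1ℤ Q) (ℤ.*-identityˡ (size Q)))

  -- Ten orthogonal vectors of norm 3, each with inner product 1 with `x`, would contradict
  -- Cauchy-Schwarz, as 3 · 30 < 10².
  no-large-claw : ∀ x Z → AllPairs (λ x y → x ≢ y × ¬ (x ∼ y)) Z → All (x ∼_) Z → length Z ≢ 10
  no-large-claw x Z co x∼Z |Z|≡10 = absurd-nonneg 9 (cauchy-schwarz x (total Z) (B-diag x)) (trans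
    (cong₂ (λ p q → + 3 * p - q * q) (coclique-norm Z co) (trans (form-unit-total x Z) (D-neighbours x∼Z)))
    (cong (λ k → + 3 * (+ 3 * + k) - + k * + k) |Z|≡10))

  -- A vertex outside a clique of size L, with D neighbours in it, satisfies D (L - D) ≤ 6L. For L ≥
  -- 25 this excludes 13 ≤ D ≤ L - 13, since 13 · 12 > 6 · 25; hence the constants 12, 13 and 25.
  Near : List (Fin n) → Fin n → Set
  Near Q y = 0≤ D y Q - + 13

  near? : ∀ Q y → Dec (Near Q y)
  near? Q y = 0ℤ ℤ.≤? (D y Q - + 13)

  far-bound : ∀ Q y → ¬ Near Q y → 0≤ + 12 - D y Q
  far-bound Q y far with sign-cases (D y Q - + 13)
  ... | inj₁ near = contradiction near far
  ... | inj₂ p = subst 0≤_ (solve 1 (λ d → con (- 1ℤ) :- (d :- num 13) := num 12 :- d) refl (D y Q)) p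

  clique-member : ∀ {y Q} → Clique Q → y ∈ Q → All (λ q → 0≤ B y q - 1ℤ) Q
  clique-member {y} (q∼Q ∷ cl) (here refl) = subst (λ b → 0≤ b - 1ℤ) (sym (B-diag y)) (0≤+ 2)
    ∷ All.map (λ y∼q → subst (λ b → 0≤ b - 1ℤ) (sym (B-adjacent y∼q)) (0≤+ 0)) q∼Q
  clique-member (q∼Q ∷ cl) (there y∈Q) = subst (λ b → 0≤ b - 1ℤ) (sym (B-adjacent (∼-sym (All.lookup q∼Q y∈Q)))) (0≤+ 0)
    ∷ clique-member cl y∈Q

  member-bound : ∀ {y Q} → All (λ q → 0≤ B y q - 1ℤ) Q → 0≤ D y Q - size Q
  member-bound {y} {Q} ps = subst 0≤_ (cong (λ s → D y Q - s) (ℤ.*-identityˡ (size Q))) (Σˡ-lower 1ℤ ps)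

  _∈?_ : ∀ (y : Fin n) Q → Dec (y ∈ Q)
  _∈?_ = Membership._∈?_ Fin._≟_

  outside : ∀ {y : Fin n} {Q} → ¬ (y ∈ Q) → All (y ≢_) Q
  outside {Q = []} y∉Q = []
  outside {Q = q ∷ Q} y∉Q = (y∉Q ∘ here) ∷ outside (y∉Q ∘ there)

  B-idem : ∀ {y q} → y ≢ q → B y q * B y q ≡ B y q
  B-idem {y} {q} y≢q with B-cases y q
  ... | inj₁ y≡q = contradiction y≡q y≢q
  ... | inj₂ (inj₁ y∼q) = trans (cong (λ b → b * b) (B-adjacent y∼q)) (sym (B-adjacent y∼q))
  ... | inj₂ (inj₂ (_ , y≁q)) = trans (cong (λ b → b * b) (B-nonadjacent y≢q y≁q)) (sym (B-nonadjacent y≢q y≁q))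

  -- The weights B y q - D y Q / |Q| on a clique Q sum to zero, which
  -- makes the norm of the weighted sum small.
  near-bound : ∀ Q y → Clique Q → 0≤ size Q - + 25 → Near Q y → 0≤ D y Q - size Q + + 12
  near-bound Q y cl 0≤l near with y ∈? Q
  ... | yes y∈Q = 0≤-+ (member-bound (clique-member cl y∈Q)) (0≤+ 12)
  ... | no y∉Q with sign-cases (D y Q - size Q + + 12)
  ... | inj₁ p = p
  -- Here `E = U + 156` and `E - 6L = V + 6`, so `E (6L - E)` equals `-(U + 156)(V + 6)` and is at
  -- most -936.
  ... | inj₂ p = ⊥-elim (absurd-nonneg 935
          (0≤-+ (0≤-+ (0≤-+ 0≤E[6L-E] (0≤-* 0≤U 0≤V)) (0≤-* (0≤+ 6) 0≤U)) (0≤-* (0≤+ 156) 0≤V))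
          (solve 2 (λ D L → let E = L :* D :- D :* D
                                X = (D :- num 13) :* (con (- 1ℤ) :- (D :- L :+ num 12))
                                U = X :+ num 13 :* (L :- num 25)
                                V = X :+ num 7 :* (L :- num 25) in
          E :* (num 6 :* L :- E) :+ U :* V :+ num 6 :* U :+ num 156 :* V := con ℤ.-[1+ 935 ]) refl d L))
    where
    d = D y Q
    L = size Q
    E = L * d - d * d
    X = (d - + 13) * (- 1ℤ - (d - L + + 12))
    0≤X : 0≤ X
    0≤X = 0≤-* near p
    0≤U : 0≤ X + + 13 * (L - + 25)
    0≤U = 0≤-+ 0≤X (0≤-* (0≤+ 13) 0≤l)
    0≤V : 0≤ X + + 7 * (L - + 25)
    0≤V = 0≤-+ 0≤X (0≤-* (0≤+ 7) 0≤l)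
    w : Fin n → ℤ
    w q = L * B y q + - d
    y≢Q = outside y∉Q
    sum-w : Σˡ w Q ≡ 0ℤ
    sum-w = trans (Σˡ-linear L (B y) (λ _ → - d) Q) (trans (cong (_+_ (L * d)) (Σˡ-const (- d) Q))
      (solve 2 (λ L d → L :* d :+ :- d :* L := num 0) refl L d))
    sum-w² : Σˡ (λ q → w q * w q) Q ≡ L * E
    sum-w² = trans (Σˡ-cong (All.map (λ {q} y≢q → trans
        (solve 3 (λ L b d → (L :* b :+ :- d) :* (L :* b :+ :- d) := L :* L :* (b :* b) :+ (:- (num 2 :* L :* d) :* b :+ d :* d)) refl L (B y q) d)
        (cong (λ b → L * L * b + (- (+ 2 * L * d) * B y q + d * d)) (B-idem y≢q))) y≢Q))
      (trans (Σˡ-linear (L * L) (B y) (λ q → - (+ 2 * L * d) * B y q + d * d) Q)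
        (trans (cong (_+_ (L * L * d)) (trans (Σˡ-linear (- (+ 2 * L * d)) (B y) (λ _ → d * d) Q)
          (cong (_+_ (- (+ 2 * L * d) * d)) (Σˡ-const (d * d) Q))))
          (solve 2 (λ L d → L :* L :* d :+ (:- (num 2 :* L :* d) :* d :+ d :* d :* L) := L :* (L :* d :- d :* d)) refl L d)))
    sum-wB : Σˡ (λ q → w q * B y q) Q ≡ E
    sum-wB = trans (Σˡ-cong (All.map (λ {q} y≢q → trans
        (solve 3 (λ L b d → (L :* b :+ :- d) :* b := L :* (b :* b) :+ :- d :* b) refl L (B y q) d)
        (trans (cong (λ b → L * b + - d * B y q) (B-idem y≢q))
          (solve 3 (λ L b d → L :* b :+ :- d :* b := (L :- d) :* b :+ num 0) refl L (B y q) d))) y≢Q))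
      (trans (Σˡ-linear (L - d) (B y) (λ _ → 0ℤ) Q) (trans (cong (_+_ ((L - d) * d)) (Σˡ-const 0ℤ Q))
        (solve 2 (λ L d → (L :- d) :* d :+ num 0 :* L := L :* d :- d :* d) refl L d)))
    0≤E[6L-E] : 0≤ E * (+ 6 * L - E)
    0≤E[6L-E] = subst 0≤_ (trans
      (cong₂ (λ p q → + 3 * p - q * q)
        (trans (weighted-clique-norm w Q cl) (cong₂ (λ s t → s * s + + 2 * t) sum-w sum-w²))
        (trans (form-unit-comb y w Q) sum-wB))
      (solve 2 (λ L E → num 3 :* (num 0 :* num 0 :+ num 2 :* (L :* E)) :- E :* E := E :* (num 6 :* L :- E)) refl L E))
      (cauchy-schwarz y (comb w Q) (B-diag y))

  clique-⊆ : ∀ {S Q} → S ⊆ Q → Clique Q → Clique S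
  clique-⊆ [] [] = []
  clique-⊆ (q ∷ʳ sub) (q∼Q ∷ cl) = clique-⊆ sub cl
  clique-⊆ (refl ∷ sub) (q∼Q ∷ cl) = All-resp-⊆ sub q∼Q ∷ clique-⊆ sub cl

  D-⊆ : ∀ {S Q} y → S ⊆ Q → 0≤ D y Q - D y S
  D-⊆ y [] = ℤ.≤-refl
  D-⊆ {S} {q ∷ Q} y (q ∷ʳ sub) = subst 0≤_
    (solve 3 (λ b d e → b :+ (d :- e) := b :+ d :- e) refl (B y q) (D y Q) (D y S)) (0≤-+ (B-nonneg y q) (D-⊆ y sub))
  D-⊆ {q ∷ S} {q ∷ Q} y (refl ∷ sub) = subst 0≤_
    (solve 3 (λ b d e → d :- e := b :+ d :- (b :+ e)) refl (B y q) (D y Q) (D y S)) (D-⊆ y sub)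

  D-⊆-size : ∀ {S Q} y → All (y ≢_) Q → S ⊆ Q → 0≤ (D y S - size S) - (D y Q - size Q)
  D-⊆-size y _ [] = ℤ.≤-refl
  D-⊆-size {S} {q ∷ Q} y (y≢q ∷ y≢Q) (q ∷ʳ sub) = subst 0≤_
    (solve 5 (λ b d e s t → (num 1 :- b) :+ ((e :- s) :- (d :- t)) := (e :- s) :- (b :+ d :- (num 1 :+ t))) refl
      (B y q) (D y Q) (D y S) (size S) (size Q)) (0≤-+ 0≤1-B (D-⊆-size y y≢Q sub))
    where
    0≤1-B : 0≤ 1ℤ - B y q
    0≤1-B with B-cases y q
    ... | inj₁ y≡q = contradiction y≡q y≢q
    ... | inj₂ (inj₁ y∼q) = subst (λ b → 0≤ 1ℤ - b) (sym (B-adjacent y∼q)) (0≤+ 0)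
    ... | inj₂ (inj₂ (_ , y≁q)) = subst (λ b → 0≤ 1ℤ - b) (sym (B-nonadjacent y≢q y≁q)) (0≤+ 1)
  D-⊆-size {q ∷ S} {q ∷ Q} y (y≢q ∷ y≢Q) (refl ∷ sub) = subst 0≤_
    (solve 5 (λ b d e s t → (e :- s) :- (d :- t) := (b :+ e :- (num 1 :+ s)) :- (b :+ d :- (num 1 :+ t))) refl
      (B y q) (D y Q) (D y S) (size S) (size Q)) (D-⊆-size y y≢Q sub)

  near-⊆⁻ : ∀ {S Q} y → S ⊆ Q → Near S y → Near Q y
  near-⊆⁻ {S} {Q} y sub near = subst 0≤_
    (solve 2 (λ d e → (d :- e) :+ (e :- num 13) := d :- num 13) refl (D y Q) (D y S)) (0≤-+ (D-⊆ y sub) near)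

  -- A vertex outside `Q` misses at most 12 members of `Q`, hence of `S`, and 25 - 12 = 13. Members
  -- of `Q` are treated apart because their diagonal entry 3 spoils this count.
  near-⊆ : ∀ {S Q} y → Clique Q → 0≤ size Q - + 25 → 0≤ size S - + 25 → S ⊆ Q → Near Q y → Near S y
  near-⊆ {S} {Q} y cl 0≤Q 0≤S sub near with y ∈? Q
  ... | yes y∈Q = subst 0≤_
    (solve 2 (λ d s → (d :- s) :+ (s :- num 25) :+ num 12 := d :- num 13) refl (D y S) (size S))
    (0≤-+ (0≤-+ (member-bound (All-resp-⊆ sub (clique-member cl y∈Q))) 0≤S) (0≤+ 12))
  ... | no y∉Q = subst 0≤_
    (solve 4 (λ d e s t → ((e :- s) :- (d :- t)) :+ (d :- t :+ num 12) :+ (s :- num 25) := e :- num 13) refl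
      (D y Q) (D y S) (size S) (size Q))
    (0≤-+ (0≤-+ (D-⊆-size y (outside y∉Q) sub) (near-bound Q y cl 0≤Q near)) 0≤S)

  -- The sums of the two cliques differ by a vector of norm at most 28L, so at each vertex the
  -- squared difference of the two `D` is at most 84L. A vertex near one clique and far from the
  -- other needs a difference of L - 24, but (L - 24)² > 84L for L ≥ 150. Nearness thus depends on
  -- the line and not on the sample.
  module NearClique (Q Q′ : List (Fin n)) (cl : Clique Q) (cl′ : Clique Q′) (same : size Q′ ≡ size Q)
    (0≤l : 0≤ size Q - + 150) (all-near : All (Near Q) Q′) where

    L = size Q

    25≤L : 0≤ L - + 25
    25≤L = subst 0≤_ (solve 1 (λ l → l :- num 150 :+ num 125 := l :- num 25) refl L) (0≤-+ 0≤l (0≤+ 125))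

    I : ℤ
    I = Σˡ (λ q → D q Q) Q′

    0≤I : 0≤ I - (L - + 12) * L
    0≤I = subst (λ k → 0≤ I - (L - + 12) * k) same (Σˡ-lower (L - + 12)
      (All.map (λ {q} near → subst 0≤_ (solve 2 (λ d l → d :- l :+ num 12 := d :- (l :- num 12)) refl (D q Q) L)
        (near-bound Q q cl 25≤L near)) all-near))

    distance : ∀ z → 0≤ + 3 * (+ 2 * (L * L + + 2 * L) - + 2 * I) - (D z Q - D z Q′) * (D z Q - D z Q′)
    distance z = subst 0≤_ (trans
      (cong₂ (λ p q → + 3 * p - q * q)
        (trans (norm-linear (- 1ℤ) (total Q′) (total Q)) (cong₂ _+_ (cong₂ (λ p q → - 1ℤ * - 1ℤ * p + + 2 * - 1ℤ * q)
          (trans (clique-norm Q′ cl′) (cong (λ s → s * s + + 2 * s) same))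
          (trans (form-comm (total Q′) (total Q)) (form-total-total Q Q′)))
          (clique-norm Q cl)))
        (trans (form-linearʳ (- 1ℤ) (unit z) (total Q′) (total Q)) (cong₂ (λ p q → - 1ℤ * p + q) (form-unit-total z Q′) (form-unit-total z Q))))
      (solve 4 (λ N I d e → num 3 :* ((con (- 1ℤ) :* con (- 1ℤ) :* N :+ num 2 :* con (- 1ℤ) :* I) :+ N) :- (con (- 1ℤ) :* e :+ d) :* (con (- 1ℤ) :* e :+ d)
        := num 3 :* (num 2 :* N :- num 2 :* I) :- (d :- e) :* (d :- e)) refl (L * L + + 2 * L) I (D z Q) (D z Q′)))
      (cauchy-schwarz z (λ i → - 1ℤ * total Q′ i + total Q i) (B-diag z))

    separated : ∀ d e → 0≤ + 3 * (+ 2 * (L * L + + 2 * L) - + 2 * I) - (d - e) * (d - e) →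
          0≤ d - L + + 12 → 0≤ + 12 - e → ⊥
    separated d e dist 0≤p 0≤q = absurd-nonneg 3275
      (0≤-+ (0≤-+ (0≤-+ (0≤-+ (0≤-+ dist (0≤-* (0≤+ 6) 0≤I)) (0≤i*i f)) (0≤-* 0≤f (0≤-+ 0≤l (0≤+ 126)))) (0≤-* 0≤f (0≤-+ 0≤l (0≤+ 126))))
        (0≤-* 0≤l (0≤-+ 0≤l (0≤+ 168))))
      (solve 4 (λ d e L I → let f = (d :- L :+ num 12) :+ (num 12 :- e) ; l = L :- num 150 in
        num 3 :* (num 2 :* (L :* L :+ num 2 :* L) :- num 2 :* I) :- (d :- e) :* (d :- e)
          :+ num 6 :* (I :- (L :- num 12) :* L) :+ f :* f :+ f :* (l :+ num 126) :+ f :* (l :+ num 126)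
          :+ l :* (l :+ num 168) := con ℤ.-[1+ 3275 ]) refl d e L I)
      where
      f = (d - L + + 12) + (+ 12 - e)
      0≤f = 0≤-+ 0≤p 0≤q

    near⇒ : ∀ z → Near Q z → Near Q′ z
    near⇒ z near with near? Q′ z
    ... | yes near′ = near′
    ... | no far = ⊥-elim (separated (D z Q) (D z Q′) (distance z) (near-bound Q z cl 25≤L near) (far-bound Q′ z far))

    near⇐ : ∀ z → Near Q′ z → Near Q z
    near⇐ z near with near? Q z
    ... | yes near′ = near′
    ... | no far = ⊥-elim (separated (D z Q′) (D z Q)
      (subst 0≤_ (solve 3 (λ x d e → x :- (d :- e) :* (d :- e) := x :- (e :- d) :* (e :- d)) refl (+ 3 * (+ 2 * (L * L + + 2 * L) - + 2 * I)) (D z Q) (D z Q′)) (distance z))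
      (subst (λ s → 0≤ D z Q′ - s + + 12) same (near-bound Q′ z cl′ (subst (λ s → 0≤ s - + 25) (sym same) 25≤L) near)) (far-bound Q z far))

-- The three lines through a vertex

size-filter : ∀ {A : Set} {P : A → Set} (P? : ∀ x → Dec (P x)) xs → size (filter P? xs) ≡ Σˡ (ind ∘ P?) xs
size-filter P? [] = refl
size-filter P? (x ∷ xs) with P? x
... | yes _ = cong (λ s → 1ℤ + s) (size-filter P? xs)
... | no _ = trans (size-filter P? xs) (sym (ℤ.+-identityˡ _))

Σˡ-tabulate : ∀ {A : Set} {n} (f : A → ℤ) (g : Fin n → A) → Σˡ f (tabulate g) ≡ sum (f ∘ g)
Σˡ-tabulate {n = zero} f g = refl
Σˡ-tabulate {n = suc n} f g = cong (_+_ (f (g zero))) (Σˡ-tabulate f (g ∘ suc))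

size-filter-allFin : ∀ {n} {P : Fin n → Set} (P? : ∀ x → Dec (P x)) → size (filter P? (allFin n)) ≡ sum (ind ∘ P?)
size-filter-allFin P? = trans (size-filter P? (allFin _)) (Σˡ-tabulate (ind ∘ P?) id)

ind-nonneg : ∀ {P : Set} (P? : Dec P) → 0≤ ind P?
ind-nonneg (yes _) = 0≤+ 1
ind-nonneg (no _) = 0≤+ 0

ind-partition : ∀ {P Q R : Set} (P? : Dec P) (Q? : Dec Q) (R? : Dec R) →
  ind P? ≡ ind (P? ×-dec Q?) + (ind (P? ×-dec ¬? Q? ×-dec R?) + ind (P? ×-dec ¬? Q? ×-dec ¬? R?))
ind-partition (no _) _ _ = refl
ind-partition (yes _) (yes _) _ = refl
ind-partition (yes _) (no _) (yes _) = refl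
ind-partition (yes _) (no _) (no _) = refl

sum-mono : ∀ {n} {f g : Vector n} → (∀ i → 0≤ g i - f i) → 0≤ sum g - sum f
sum-mono {f = f} {g} le = subst 0≤_
  (trans (sum-cong λ i → solve 2 (λ f g → g :- f := con (- 1ℤ) :* f :+ g) refl (f i) (g i))
    (trans (sum-linear (- 1ℤ) f g) (solve 2 (λ f g → con (- 1ℤ) :* f :+ g := g :- f) refl (sum f) (sum g))))
  (sum-nonneg (λ i → g i - f i) le)

sum-without : ∀ {n} (f : Vector n) → (∀ i → 0≤ f i) → ∀ i → 0≤ sum f - f i
sum-without f 0≤f zero = subst 0≤_ (solve 2 (λ a s → s := a :+ s :- a) refl (f zero) (sum (f ∘ suc))) (sum-nonneg (f ∘ suc) (0≤f ∘ suc))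
sum-without f 0≤f (suc i) = subst 0≤_ (solve 3 (λ a s b → a :+ (s :- b) := a :+ s :- b) refl (f zero) (sum (f ∘ suc)) (f (suc i)))
  (0≤-+ (0≤f zero) (sum-without (f ∘ suc) (0≤f ∘ suc) i))

sum-without² : ∀ {n} (f : Vector n) → (∀ i → 0≤ f i) → ∀ {i j} → i ≢ j → 0≤ sum f - (f i + f j)
sum-without² f 0≤f {zero} {zero} i≢j = contradiction refl i≢j
sum-without² f 0≤f {zero} {suc j} i≢j = subst 0≤_ (solve 3 (λ a s b → s :- b := a :+ s :- (a :+ b)) refl (f zero) (sum (f ∘ suc)) (f (suc j)))
  (sum-without (f ∘ suc) (0≤f ∘ suc) j)
sum-without² f 0≤f {suc i} {zero} i≢j = subst (λ s → 0≤ sum f - s) (ℤ.+-comm (f zero) (f (suc i))) (sum-without² f 0≤f (i≢j ∘ sym))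
sum-without² f 0≤f {suc i} {suc j} i≢j = subst 0≤_
  (solve 4 (λ a s b c → a :+ (s :- (b :+ c)) := a :+ s :- (b :+ c)) refl (f zero) (sum (f ∘ suc)) (f (suc i)) (f (suc j)))
  (0≤-+ (0≤f zero) (sum-without² (f ∘ suc) (0≤f ∘ suc) (i≢j ∘ cong suc)))

-- A line is named by a vertex and one of three indices. By `on-agree` it has a name at each of its
-- vertices, which spares a quotient.
record ThreeLines {n} (_∼_ : Fin n → Fin n → Set) : Set₁ where
  field
    On : Fin n → Fin 3 → Fin n → Set
    on? : ∀ x i y → Dec (On x i y)
    on-self : ∀ x i → On x i x
    on-other : ∀ x i → ∃[ y ] (y ≢ x × On x i y)
    on-adjacent : ∀ {x i y} → y ≢ x → On x i y → x ∼ y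
    adjacent-on : ∀ {x y} → x ∼ y → ∃[ i ] On x i y
    on-unique : ∀ {x i j y} → i ≢ j → On x i y → On x j y → y ≡ x
    on-agree : ∀ {x i y} → On x i y → ∃[ j ] (∀ z → (On x i z → On y j z) × (On y j z → On x i z))

-- The bound 26 + 4R comes from `not-covered`: with s = s₁ + s₂ one needs s²/2 - R s ≤ 3v² + 12v -
-- 36, and for s = 3v - 9 - R the left side exceeds the right by (3/2) v (v - 26 - 4R) plus a
-- positive term.
module Stars {n} {B : Matrix n} (S : ShiftedAdjacency B) (v R : ℕ)
  (ramsey-R : Ramsey 915 10 R)
  (0≤t : 0≤ + v - + 26 - + 4 * + R)
  (row-sum : ∀ i → sum (B i) ≡ + 3 * (+ v - + 2))
  (cube-diagonal : ∀ i → dot (B i) (mat B (B i)) ≡ + 3 * (+ v * + v) + + 12 * + v - + 36) where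

  open ShiftedAdjacency S
  open Lines S

  -- A clique meeting three lines in 915 - 12 > 3 · 299 members has 300 of
  -- them near one line, and 300 members still identify a line.
  record LargeClique (P : Fin n → Set) : Set where
    field
      members : List (Fin n)
      order : length members ≡ 915
      clique : Clique members
      all : All P members

    size≡ : size members ≡ + 915
    size≡ = cong +_ order

    25≤size : 0≤ size members - + 25
    25≤size = subst (λ s → 0≤ s - + 25) (sym size≡) (0≤+ 890)

  open LargeClique

  find-clique : ∀ x {P : Fin n → Set} (P? : ∀ j → Dec (P j)) → (∀ {j} → P j → x ∼ j) →
          LargeClique P ⊎ 0≤ + R - sum (ind ∘ P?)
  find-clique x {P} P? P⇒∼ with ℕ.≤-total R (length (filter P? (allFin n)))
  ... | inj₂ ≤R = inj₂ (subst (λ s → 0≤ + R - s) (size-filter-allFin P?) (ℤ.i≤j⇒0≤j-i (ℤ.+≤+ ≤R)))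
  ... | inj₁ R≤ with ramsey-R _∼?_ P (filter P? (allFin n)) (AllPairs.filter⁺ P? (allFin⁺ n)) (All.all-filter P? (allFin n)) R≤
  ... | inj₁ (ys , l , c , ps) = inj₁ (record { members = ys ; order = l ; clique = c ; all = ps })
  ... | inj₂ (ys , l , c , ps) = ⊥-elim (no-large-claw x ys c (All.map P⇒∼ ps) l)

  B-row : ∀ x j → B x j ≡ ind (x ∼? j) + + 3 * unit x j
  B-row x j with B-cases x j
  ... | inj₁ refl = trans (B-diag x) (sym (cong₂ (λ p q → p + + 3 * q) (ind-no (x ∼? x) (λ x∼x → ∼-irrefl x∼x refl)) (unit-diag x)))
  ... | inj₂ (inj₁ x∼j) = trans (B-adjacent x∼j) (sym (cong₂ (λ p q → p + + 3 * q) (ind-yes (x ∼? j) x∼j) (ind-no (x Fin.≟ j) (∼-irrefl x∼j))))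
  ... | inj₂ (inj₂ (x≢j , x≁j)) = trans (B-nonadjacent x≢j x≁j) (sym (cong₂ (λ p q → p + + 3 * q) (ind-no (x ∼? j) x≁j) (ind-no (x Fin.≟ j) x≢j)))

  degree : ∀ x → sum (λ j → ind (x ∼? j)) ≡ + 3 * (+ v - + 2) - + 3
  degree x = trans (solve 1 (λ s → s := num 3 :* num 1 :+ s :- num 3) refl k)
    (cong (_- + 3) (trans (cong (λ u → + 3 * u + k) (sym (sum-unit-one x)))
      (trans (sym (sum-linear (+ 3) (unit x) (λ j → ind (x ∼? j))))
        (trans (sum-cong λ j → trans (ℤ.+-comm (+ 3 * unit x j) (ind (x ∼? j))) (sym (B-row x j))) (row-sum x)))))
    where k = sum (λ j → ind (x ∼? j))

  form-nonneg : ∀ {x y : Vector n} → (∀ i → 0≤ x i) → (∀ i → 0≤ y i) → 0≤ form x y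
  form-nonneg {x} {y} 0≤x 0≤y = sum-nonneg (λ i → x i * mat B y i) λ i →
    0≤-* (0≤x i) (sum-nonneg (λ j → B i j * y j) λ j → 0≤-* (B-nonneg i j) (0≤y j))

  -- The vertices near Q form a clique up to fewer than R exceptions each.
  module NearSet (x : Fin n) {T : Fin n → Set} (Q : LargeClique T) {P : Fin n → Set} (P? : ∀ j → Dec (P j))
    (P⇒∼ : ∀ {j} → P j → x ∼ j) (P⇒near : ∀ {j} → P j → Near (members Q) j) where

    χ : Vector n
    χ = ind ∘ P?

    Missed : Fin n → Fin n → Set
    Missed y j = P j × ¬ (y ∼ j) × y ≢ j

    missed? : ∀ y j → Dec (Missed y j)
    missed? y j = P? j ×-dec ¬? (y ∼? j) ×-dec ¬? (y Fin.≟ j)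

    -- Otherwise the missed vertices contain a large clique all of whose members are near `Q`. Then
    -- `y`, being near `Q`, is near that clique, although it is adjacent to none of its members.
    few-missed : ∀ y → Near (members Q) y → 0≤ + R - sum (ind ∘ missed? y)
    few-missed y near with find-clique x (missed? y) (P⇒∼ ∘ proj₁)
    ... | inj₂ few = few
    ... | inj₁ Q′ = ⊥-elim (absurd-nonneg 12 near′ (cong (_- + 13)
          (trans (Σˡ-cong (All.map (λ { (_ , y≁j , y≢j) → B-nonadjacent y≢j y≁j }) (all Q′))) (Σˡ-const 0ℤ (members Q′)))))
      where
      near′ : Near (members Q′) y
      near′ = NearClique.near⇒ (members Q) (members Q′) (clique Q) (clique Q′) (trans (size≡ Q′) (sym (size≡ Q)))
        (subst (λ s → 0≤ s - + 150) (sym (size≡ Q)) (0≤+ 765)) (All.map (P⇒near ∘ proj₁) (all Q′)) y near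

    row : ∀ y → Near (members Q) y → 0≤ mat B χ y - (sum χ - + R)
    row y near = subst 0≤_
      (solve 4 (λ g s m r → g :- (con (- 1ℤ) :* m :+ s) :+ (r :- m) := g :- (s :- r)) refl (mat B χ y) (sum χ) (sum (ind ∘ missed? y)) (+ R))
      (0≤-+ (subst (λ s → 0≤ mat B χ y - s) (sum-linear (- 1ℤ) (ind ∘ missed? y) χ)
        (sum-mono {f = λ j → - 1ℤ * ind (missed? y j) + χ j} {g = λ j → B y j * χ j} entry)) (few-missed y near))
      where
      0≤m = λ j → ind-nonneg (missed? y j)
      entry : ∀ j → 0≤ B y j * χ j - (- 1ℤ * ind (missed? y j) + χ j)
      entry j with B-cases y j
      ... | inj₁ refl = subst 0≤_
          (trans (solve 2 (λ c m → num 2 :* c :+ m := num 3 :* c :- (con (- 1ℤ) :* m :+ c)) refl (χ j) (ind (missed? y j)))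
          (cong (λ b → b * χ j - (- 1ℤ * ind (missed? y j) + χ j)) (sym (B-diag y))))
          (0≤-+ (0≤-* (0≤+ 2) (ind-nonneg (P? j))) (0≤m j))
      ... | inj₂ (inj₁ y∼j) = subst 0≤_
          (trans (solve 2 (λ c m → m := num 1 :* c :- (con (- 1ℤ) :* m :+ c)) refl (χ j) (ind (missed? y j)))
          (cong (λ b → b * χ j - (- 1ℤ * ind (missed? y j) + χ j)) (sym (B-adjacent y∼j))))
          (0≤m j)
      ... | inj₂ (inj₂ (y≢j , y≁j)) = ℤ.≤-reflexive (sym (trans
          (cong₂ (λ b m → b * χ j - (- 1ℤ * m + χ j)) (B-nonadjacent y≢j y≁j)
          (ind-cong proj₁ (λ p → p , y≁j , y≢j) (missed? y j) (P? j)))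
          (solve 1 (λ c → num 0 :* c :- (con (- 1ℤ) :* c :+ c) := num 0) refl (χ j))))

    quadratic : 0≤ form χ χ - (sum χ - + R) * sum χ
    quadratic = subst (λ s → 0≤ form χ χ - s) (sym (*-distribˡ-sum (sum χ - + R) χ))
      (sum-mono {f = λ y → (sum χ - + R) * χ y} {g = λ y → χ y * mat B χ y} entry)
      where
      entry : ∀ y → 0≤ χ y * mat B χ y - (sum χ - + R) * χ y
      entry y with P? y
      ... | no _ = ℤ.≤-reflexive (solve 2 (λ g s → num 0 := num 0 :* g :- s :* num 0) refl (mat B χ y) (sum χ - + R))
      ... | yes p = subst 0≤_ (solve 2 (λ g s → g :- s := num 1 :* g :- s :* num 1) refl (mat B χ y) (sum χ - + R)) (row y (P⇒near p))

  -- Two almost-cliques covering almost all of the 3v - 9 neighbours of x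
  -- would span more than the available 3v² + O(v) adjacent pairs.
  not-covered : ∀ x {T T′ : Fin n → Set} (Q : LargeClique T) (Q′ : LargeClique T′) →
    0≤ + R - sum (λ j → ind (x ∼? j ×-dec ¬? (near? (members Q) j) ×-dec ¬? (near? (members Q′) j))) → ⊥
  not-covered x Q Q′ few = absurd-nonneg 152
    (0≤-+ (0≤-+ (0≤-+ (0≤-+ (0≤-+ (0≤-+ (0≤-+ (0≤-+ (0≤-* (0≤+ 2) main) (0≤i*i (s₁ - s₂)))
      (0≤-* 0≤r (0≤-+ 0≤a 0≤b))) (0≤i*i r)) (0≤-* (0≤+ 3) (0≤i*i R′))) (0≤-* (0≤+ 36) (0≤+ R))) (0≤-* (0≤-* (0≤+ 12) (0≤+ R)) 0≤t))
      (0≤-* (0≤+ 78) 0≤t)) (0≤-* (0≤+ 3) (0≤-* 0≤t 0≤t)))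
    (solve 4 (λ s₁ s₂ R v →
      let s₃ = num 3 :* (v :- num 2) :- num 3 :- s₁ :- s₂
          r = R :- s₃
          t = v :- num 26 :- num 4 :* R
          a = num 69 :+ num 11 :* R :+ num 3 :* t
          b = num 69 :+ num 9 :* R :+ num 3 :* t
      in num 2 :* (num 3 :* (v :* v) :+ num 12 :* v :- num 36 :- (s₁ :- R) :* s₁ :- (s₂ :- R) :* s₂)
         :+ (s₁ :- s₂) :* (s₁ :- s₂) :+ r :* (a :+ b) :+ r :* r :+ num 3 :* (R :* R) :+ num 36 :* R
         :+ num 12 :* R :* t :+ num 78 :* t :+ num 3 :* (t :* t) := con ℤ.-[1+ 152 ]) refl s₁ s₂ R′ (+ v))
    where
    P₁? = λ j → x ∼? j ×-dec near? (members Q) j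
    P₂? = λ j → x ∼? j ×-dec ¬? (near? (members Q) j) ×-dec near? (members Q′) j
    P₃? = λ j → x ∼? j ×-dec ¬? (near? (members Q) j) ×-dec ¬? (near? (members Q′) j)
    module N₁ = NearSet x Q P₁? proj₁ proj₂
    module N₂ = NearSet x Q′ P₂? proj₁ (proj₂ ∘ proj₂)
    R′ = + R
    s₁ = sum N₁.χ
    s₂ = sum N₂.χ
    s₃ = + 3 * (+ v - + 2) - + 3 - s₁ - s₂
    r = R′ - s₃
    t = + v - + 26 - + 4 * R′
    0≤a : 0≤ + 69 + + 11 * R′ + + 3 * t
    0≤a = 0≤-+ (0≤-+ (0≤+ 69) (0≤-* (0≤+ 11) (0≤+ R))) (0≤-* (0≤+ 3) 0≤t)
    0≤b : 0≤ + 69 + + 9 * R′ + + 3 * t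
    0≤b = 0≤-+ (0≤-+ (0≤+ 69) (0≤-* (0≤+ 9) (0≤+ R))) (0≤-* (0≤+ 3) 0≤t)

    χ₃ : Vector n
    χ₃ j = ind (P₃? j)

    s₃≡ : sum χ₃ ≡ s₃
    s₃≡ = trans (solve 3 (λ a b c → c := (a :+ (b :+ c)) :- a :- b) refl s₁ s₂ (sum χ₃))
      (cong (λ k → k - s₁ - s₂) (trans (sym (trans
        (sum-cong λ j → ind-partition (x ∼? j) (near? (members Q) j) (near? (members Q′) j))
        (trans (∑-distrib-+ N₁.χ (λ j → N₂.χ j + χ₃ j)) (cong (_+_ s₁) (∑-distrib-+ N₂.χ χ₃))))) (degree x)))

    0≤r : 0≤ r
    0≤r = subst (λ s → 0≤ R′ - s) s₃≡ few

    ρ : Vector n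
    ρ j = χ₃ j + + 3 * unit x j
    0≤ρ : ∀ j → 0≤ ρ j
    0≤ρ j = 0≤-+ (ind-nonneg (P₃? j)) (0≤-* (0≤+ 3) (ind-nonneg (x Fin.≟ j)))
    0≤χ₁ : ∀ j → 0≤ N₁.χ j
    0≤χ₁ j = ind-nonneg (P₁? j)
    0≤χ₂ : ∀ j → 0≤ N₂.χ j
    0≤χ₂ j = ind-nonneg (P₂? j)

    rest : Vector n
    rest j = 1ℤ * N₂.χ j + ρ j

    0≤rest : ∀ j → 0≤ rest j
    0≤rest j = 0≤-+ (0≤-* (0≤+ 1) (0≤χ₂ j)) (0≤ρ j)

    B-split : ∀ j → B x j ≡ 1ℤ * N₁.χ j + rest j
    B-split j = trans (B-row x j) (trans
      (cong (_+ + 3 * unit x j) (ind-partition (x ∼? j) (near? (members Q) j) (near? (members Q′) j)))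
      (solve 4 (λ a b c u → (a :+ (b :+ c)) :+ u := num 1 :* a :+ (num 1 :* b :+ (c :+ u))) refl
        (N₁.χ j) (N₂.χ j) (χ₃ j) (+ 3 * unit x j)))

    C = + 3 * (+ v * + v) + + 12 * + v - + 36

    expand : C ≡ form N₁.χ N₁.χ + form N₂.χ N₂.χ + (+ 2 * form N₁.χ rest + (+ 2 * form N₂.χ ρ + form ρ ρ))
    expand = trans (sym (cube-diagonal x)) (trans (dot-cong B-split (mat-cong B B-split)) (trans
      (norm-linear 1ℤ N₁.χ rest) (trans
      (cong (λ z → 1ℤ * 1ℤ * form N₁.χ N₁.χ + + 2 * 1ℤ * form N₁.χ rest + z) (norm-linear 1ℤ N₂.χ ρ))
      (solve 5 (λ a b c d e → (num 1 :* num 1 :* a :+ num 2 :* num 1 :* c) :+ (num 1 :* num 1 :* b :+ num 2 :* num 1 :* d :+ e)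
         := a :+ b :+ (num 2 :* c :+ (num 2 :* d :+ e))) refl
        (form N₁.χ N₁.χ) (form N₂.χ N₂.χ) (form N₁.χ rest) (form N₂.χ ρ) (form ρ ρ)))))

    X = + 2 * form N₁.χ rest + (+ 2 * form N₂.χ ρ + form ρ ρ)

    0≤X : 0≤ X
    0≤X = 0≤-+ (0≤-* (0≤+ 2) (form-nonneg 0≤χ₁ 0≤rest)) (0≤-+ (0≤-* (0≤+ 2) (form-nonneg 0≤χ₂ 0≤ρ)) (form-nonneg 0≤ρ 0≤ρ))

    main : 0≤ C - (s₁ - R′) * s₁ - (s₂ - R′) * s₂
    main = subst 0≤_ (trans
      (solve 5 (λ a b p q x → (a :- p) :+ (b :- q) :+ x := a :+ b :+ x :- p :- q) refl
        (form N₁.χ N₁.χ) (form N₂.χ N₂.χ) ((s₁ - R′) * s₁) ((s₂ - R′) * s₂) X)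
      (cong (λ c → c - (s₁ - R′) * s₁ - (s₂ - R′) * s₂) (sym expand)))
      (0≤-+ (0≤-+ N₁.quadratic N₂.quadratic) 0≤X)

  record Star (x : Fin n) : Set where
    field
      Q : Fin 3 → LargeClique (x ∼_)
      far₀₁ : All (λ q → ¬ Near (members (Q 0F)) q) (members (Q 1F))
      far₀₂ : All (λ q → ¬ Near (members (Q 0F)) q) (members (Q 2F))
      far₁₂ : All (λ q → ¬ Near (members (Q 1F)) q) (members (Q 2F))

  weaken : ∀ {P P′ : Fin n → Set} → (∀ {j} → P j → P′ j) → LargeClique P → LargeClique P′
  weaken f Q = record { members = members Q ; order = order Q ; clique = clique Q ; all = All.map f (all Q) }

  star : ∀ x → Star x
  star x with find-clique x (x ∼?_) id
  ... | inj₂ few = ⊥-elim (absurd-nonneg 68 (0≤-+ (0≤-+ few (0≤-* (0≤+ 3) 0≤t)) (0≤-* (0≤+ 11) (0≤+ R)))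
          (trans (cong (λ d → + R - d + + 3 * (+ v - + 26 - + 4 * + R) + + 11 * + R) (degree x))
          (solve 2 (λ v R → R :- (num 3 :* (v :- num 2) :- num 3) :+ num 3 :* (v :- num 26 :- num 4 :* R) :+ num 11 :* R
          := con ℤ.-[1+ 68 ]) refl (+ v) (+ R))))
  -- While only one clique is known it is used twice, so that `not-covered` serves both steps.
  ... | inj₁ Q₀ with find-clique x (λ j → x ∼? j ×-dec ¬? (near? (members Q₀) j) ×-dec ¬? (near? (members Q₀) j)) proj₁
  ... | inj₂ few = ⊥-elim (not-covered x Q₀ Q₀ few)
  ... | inj₁ Q₁ with find-clique x (λ j → x ∼? j ×-dec ¬? (near? (members Q₀) j) ×-dec ¬? (near? (members Q₁) j)) proj₁
  ... | inj₂ few = ⊥-elim (not-covered x Q₀ Q₁ few)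
  ... | inj₁ Q₂ = record
          { Q = λ { 0F → Q₀ ; 1F → weaken proj₁ Q₁ ; 2F → weaken proj₁ Q₂ }
          ; far₀₁ = All.map (proj₁ ∘ proj₂) (all Q₁)
          ; far₀₂ = All.map (proj₁ ∘ proj₂) (all Q₂)
          ; far₁₂ = All.map (proj₂ ∘ proj₂) (all Q₂)
          }

  module Around (x : Fin n) where

    open Star (star x) public

    line : Fin 3 → List (Fin n)
    line i = members (Q i)

    Dᵢ : Fin 3 → Fin n → ℤ
    Dᵢ i y = D y (line i)

    ΣD : Fin n → ℤ
    ΣD y = sum (λ i → Dᵢ i y)

    cross : Fin 3 → Fin 3 → ℤ
    cross i j = form (total (line i)) (total (line j))

    cross-bound : ∀ i j → All (λ q → ¬ Near (line i) q) (line j) → 0≤ + 12 * + 915 - cross i j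
    cross-bound i j far = subst 0≤_ (cong₂ (λ s c → + 12 * s - c) (size≡ (Q j)) (sym (form-total-total (line i) (line j))))
      (Σˡ-upper (+ 12) (All.map (λ {q} → far-bound (line i) q) far))

    norm : ∀ i → cross i i ≡ + 915 * + 915 + + 2 * + 915
    norm i = trans (clique-norm (line i) (clique (Q i))) (cong (λ s → s * s + + 2 * s) (size≡ (Q i)))

    D-self : ∀ i → Dᵢ i x ≡ + 915
    D-self i = trans (D-neighbours (all (Q i))) (size≡ (Q i))

    K : ℤ
    K = cross 0F 1F + cross 0F 2F + cross 1F 2F

    F₁₂ F₀₁₂ U : Vector n
    F₁₂ i = 1ℤ * total (line 1F) i + total (line 2F) i
    F₀₁₂ i = 1ℤ * total (line 0F) i + F₁₂ i
    U i = - (+ 915) * unit x i + F₀₁₂ i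

    form-F₀₁₂ : ∀ y → form (unit y) F₀₁₂ ≡ 1ℤ * Dᵢ 0F y + (1ℤ * Dᵢ 1F y + Dᵢ 2F y)
    form-F₀₁₂ y = trans (form-linearʳ 1ℤ (unit y) (total (line 0F)) F₁₂) (cong₂ (λ p q → 1ℤ * p + q) (form-unit-total y (line 0F))
      (trans (form-linearʳ 1ℤ (unit y) (total (line 1F)) (total (line 2F)))
        (cong₂ (λ p q → 1ℤ * p + q) (form-unit-total y (line 1F)) (form-unit-total y (line 2F)))))

    -- The terms in 915² cancel because `x` has norm 3 and inner product 915 with each of the three
    -- clique sums. As `K` is at most 3 · 12 · 915, the norm of `U` is only linear in 915.
    U-norm : form U U ≡ + 6 * + 915 + + 2 * K
    U-norm = begin
      form U U
        ≡⟨ norm-linear (- (+ 915)) (unit x) F₀₁₂ ⟩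
      - (+ 915) * - (+ 915) * form (unit x) (unit x) + + 2 * - (+ 915) * form (unit x) F₀₁₂ + form F₀₁₂ F₀₁₂
        ≡⟨ cong₂ _+_ (cong₂ (λ p q → - (+ 915) * - (+ 915) * p + + 2 * - (+ 915) * q)
          (trans (form-unit x x) (B-diag x))
          (trans (form-F₀₁₂ x) (cong₂ (λ p q → 1ℤ * p + q) (D-self 0F) (cong₂ (λ p q → 1ℤ * p + q) (D-self 1F) (D-self 2F)))))
          (trans (norm-linear 1ℤ (total (line 0F)) F₁₂) (cong₂ _+_
          (cong₂ (λ p q → 1ℤ * 1ℤ * p + + 2 * 1ℤ * q) (norm 0F) (form-linearʳ 1ℤ (total (line 0F)) (total (line 1F)) (total (line 2F))))
          (trans (norm-linear 1ℤ (total (line 1F)) (total (line 2F)))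
          (cong₂ (λ p q → 1ℤ * 1ℤ * p + + 2 * 1ℤ * cross 1F 2F + q) (norm 1F) (norm 2F))))) ⟩
      - (+ 915) * - (+ 915) * + 3 + + 2 * - (+ 915) * (1ℤ * + 915 + (1ℤ * + 915 + + 915))
        + ((1ℤ * 1ℤ * N + + 2 * 1ℤ * (1ℤ * cross 0F 1F + cross 0F 2F)) + (1ℤ * 1ℤ * N + + 2 * 1ℤ * cross 1F 2F + N))
        ≡⟨ solve 3 (λ p q r →
          let M = num 915 ; o = num 1 ; two = num 2 ; N = M :* M :+ two :* M in
          :- M :* :- M :* num 3 :+ two :* :- M :* (o :* M :+ (o :* M :+ M))
          :+ ((o :* o :* N :+ two :* o :* (o :* p :+ q)) :+ (o :* o :* N :+ two :* o :* r :+ N))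
          := num 6 :* M :+ two :* (p :+ q :+ r)) refl (cross 0F 1F) (cross 0F 2F) (cross 1F 2F) ⟩
      + 6 * + 915 + + 2 * K ∎
      where
      open ≡-Reasoning
      N = + 915 * + 915 + + 2 * + 915

    deviation : Fin n → ℤ
    deviation y = - (+ 915) * B y x + ΣD y

    deviation-bound : ∀ y → 0≤ + 3 * (+ 6 * + 915 + + 2 * K) - deviation y * deviation y
    deviation-bound y = subst 0≤_ (cong₂ (λ p q → + 3 * p - q * q) U-norm
      (trans (form-linearʳ (- (+ 915)) (unit y) (unit x) F₀₁₂) (cong₂ (λ p q → - (+ 915) * p + q) (form-unit y x)
        (trans (form-F₀₁₂ y) (cong₂ _+_ (ℤ.*-identityˡ (Dᵢ 0F y)) (cong₂ _+_ (ℤ.*-identityˡ (Dᵢ 1F y)) (sym (ℤ.+-identityʳ (Dᵢ 2F y)))))))))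
      (cauchy-schwarz y U (B-diag y))

    -- U is nearly zero, so that 915 B y x is nearly the sum of the D's.
    large-deviation : ∀ y g → deviation y * deviation y ≡ g * g → 0≤ g - + 879 → ⊥
    large-deviation y g eq 0≤f = absurd-nonneg 558530
      (0≤-+ (0≤-+ (0≤-+ (subst (λ s → 0≤ + 3 * (+ 6 * + 915 + + 2 * K) - s) eq (deviation-bound y))
        (0≤-* (0≤+ 6) (0≤-+ (0≤-+ (cross-bound 0F 1F far₀₁) (cross-bound 0F 2F far₀₂)) (cross-bound 1F 2F far₁₂))))
        (0≤i*i (g - + 879))) (0≤-* (0≤+ 1758) 0≤f))
      (solve 4 (λ g p q r →
        let M = num 915 ; f = g :- num 879 in
        num 3 :* (num 6 :* M :+ num 2 :* (p :+ q :+ r)) :- g :* g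
          :+ num 6 :* ((num 12 :* M :- p) :+ (num 12 :* M :- q) :+ (num 12 :* M :- r))
          :+ f :* f :+ num 1758 :* f := con ℤ.-[1+ 558530 ]) refl g (cross 0F 1F) (cross 0F 2F) (cross 1F 2F))

    near-large : ∀ i {y} → Near (line i) y → 0≤ Dᵢ i y - + 903
    near-large i {y} near = subst 0≤_ (trans (cong (λ s → Dᵢ i y - s + + 12) (size≡ (Q i)))
      (solve 1 (λ d → d :- num 915 :+ num 12 := d :- num 903) refl (Dᵢ i y)))
      (near-bound (line i) y (clique (Q i)) (25≤size (Q i)) near)

    -- For a nonadjacent `y` the deviation is `ΣD y`, of which one near line already contributes
    -- 903.
    near⇒adjacent : ∀ {i y} → y ≢ x → Near (line i) y → x ∼ y
    near⇒adjacent {i} {y} y≢x near with x ∼? y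
    ... | yes x∼y = x∼y
    ... | no x≁y = ⊥-elim (large-deviation y (ΣD y)
      (cong (λ s → s * s) (trans (cong (λ b → - (+ 915) * b + ΣD y) (B-nonadjacent y≢x (x≁y ∘ ∼-sym)))
        (ℤ.+-identityˡ (ΣD y))))
      (subst 0≤_ (solve 2 (λ s d → s :- d :+ (d :- num 903) :+ num 24 := s :- num 879) refl (ΣD y) (Dᵢ i y))
        (0≤-+ (0≤-+ (sum-without (λ i → Dᵢ i y) (λ i → D-nonneg y (line i)) i) (near-large i near)) (0≤+ 24))))

    deviation-adjacent : ∀ {y} → x ∼ y → deviation y ≡ - (+ 915) + ΣD y
    deviation-adjacent {y} x∼y = cong (_+ ΣD y) (trans (cong (- (+ 915) *_) (B-adjacent (∼-sym x∼y))) (ℤ.*-identityʳ (- (+ 915))))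

    -- A neighbour far from all three lines has `ΣD y ≤ 36` in place of about 915. This tightest
    -- case fixes the 879 = 915 - 36 of `large-deviation`.
    adjacent⇒near : ∀ {y} → x ∼ y → ∃[ i ] Near (line i) y
    adjacent⇒near {y} x∼y with near? (line 0F) y | near? (line 1F) y | near? (line 2F) y
    ... | yes near | _ | _ = 0F , near
    ... | no _ | yes near | _ = 1F , near
    ... | no _ | no _ | yes near = 2F , near
    ... | no f₀ | no f₁ | no f₂ = ⊥-elim (large-deviation y (+ 915 - ΣD y)
      (trans (cong (λ s → s * s) (deviation-adjacent x∼y))
        (solve 1 (λ s → (con (- (+ 915)) :+ s) :* (con (- (+ 915)) :+ s) := (num 915 :- s) :* (num 915 :- s)) refl (ΣD y)))
      (subst 0≤_ (solve 3 (λ a b c → (num 12 :- a) :+ (num 12 :- b) :+ (num 12 :- c)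
          := num 915 :- (a :+ (b :+ (c :+ num 0))) :- num 879) refl (Dᵢ 0F y) (Dᵢ 1F y) (Dᵢ 2F y))
        (0≤-+ (0≤-+ (far-bound (line 0F) y f₀) (far-bound (line 1F) y f₁)) (far-bound (line 2F) y f₂))))

    -- Two near lines give `ΣD y ≥ 2 · 903`, too much for a neighbour, whose value is about 915.
    near-unique : ∀ {i j y} → i ≢ j → Near (line i) y → Near (line j) y → y ≡ x
    near-unique {i} {j} {y} i≢j nearᵢ nearⱼ with y Fin.≟ x
    ... | yes y≡x = y≡x
    ... | no y≢x = ⊥-elim (large-deviation y (- (+ 915) + ΣD y)
      (cong (λ s → s * s) (deviation-adjacent (near⇒adjacent {i} y≢x nearᵢ)))
      (subst 0≤_ (solve 3 (λ s d e → s :- (d :+ e) :+ (d :- num 903) :+ (e :- num 903) :+ num 12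
          := con (- (+ 915)) :+ s :- num 879) refl (ΣD y) (Dᵢ i y) (Dᵢ j y))
        (0≤-+ (0≤-+ (0≤-+ (sum-without² (λ i → Dᵢ i y) (λ i → D-nonneg y (line i)) i≢j) (near-large i nearᵢ)) (near-large j nearⱼ)) (0≤+ 12))))

    near-self : ∀ i → Near (line i) x
    near-self i = subst (λ d → 0≤ d - + 13) (sym (D-self i)) (0≤+ 902)

    near-other : ∀ i → ∃[ y ] (y ≢ x × Near (line i) y)
    near-other i = pick (line i) refl (order (Q i)) (all (Q i)) (clique (Q i))
      where
      pick : ∀ ys → line i ≡ ys → length ys ≡ 915 → All (x ∼_) ys → Clique ys → ∃[ y ] (y ≢ x × Near (line i) y)
      pick (y ∷ ys) eq l (x∼y ∷ _) cl = y , (λ y≡x → ∼-irrefl x∼y (sym y≡x)) , subst (λ Q → Near Q y) (sym eq)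
        (subst 0≤_ (trans (cong (λ s → D y (y ∷ ys) - s + + 902) (cong +_ l))
          (solve 1 (λ d → d :- num 915 :+ num 902 := d :- num 13) refl (D y (y ∷ ys))))
          (0≤-+ (member-bound (clique-member cl (here refl))) (0≤+ 902)))

  size-take : ∀ (xs : List (Fin n)) → 300 ≤ length xs → size (take 300 xs) ≡ + 300
  size-take xs le = cong +_ (trans (List.length-take 300 xs) (ℕ.m≤n⇒m⊓n≡m le))

  module Agree (x : Fin n) (i : Fin 3) (y : Fin n) (near-y : Near (Around.line x i) y) where

    private
      module X = Around x
      module Y = Around y

    chosen : Fin 3 → List (Fin n)
    chosen j = filter (near? (Y.line j)) (X.line i)

    -- At `q = y` the diagonal entry 3 is matched by the three lines of `y`, all near `y`; a
    -- neighbour is near at least one of them. Summed over the clique, this distributes its members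
    -- among the lines of `y`.
    B-covered : ∀ q → 0≤ ind (near? (Y.line 0F) q) + (ind (near? (Y.line 1F) q) + ind (near? (Y.line 2F) q)) - B y q
    B-covered q with B-cases y q
    ... | inj₁ refl = ℤ.≤-reflexive (sym (cong₂ _-_ (cong₂ _+_ (ind-yes (near? (Y.line 0F) y) (Y.near-self 0F))
          (cong₂ _+_ (ind-yes (near? (Y.line 1F) y) (Y.near-self 1F)) (ind-yes (near? (Y.line 2F) y) (Y.near-self 2F)))) (B-diag y)))
    ... | inj₂ (inj₂ (y≢q , y≁q)) = subst (λ b → 0≤ ind (near? (Y.line 0F) q) + (ind (near? (Y.line 1F) q) + ind (near? (Y.line 2F) q)) - b)
          (sym (B-nonadjacent y≢q y≁q)) (0≤-+ (0≤-+ (ind-nonneg (near? (Y.line 0F) q))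
          (0≤-+ (ind-nonneg (near? (Y.line 1F) q)) (ind-nonneg (near? (Y.line 2F) q)))) (0≤+ 0))
    ... | inj₂ (inj₁ y∼q) = subst (λ b → 0≤ ind (near? (Y.line 0F) q) + (ind (near? (Y.line 1F) q) + ind (near? (Y.line 2F) q)) - b)
          (sym (B-adjacent y∼q)) (one-near (Y.adjacent⇒near y∼q))
      where
      i₀ = ind (near? (Y.line 0F) q)
      i₁ = ind (near? (Y.line 1F) q)
      i₂ = ind (near? (Y.line 2F) q)
      0≤i₀ = ind-nonneg (near? (Y.line 0F) q)
      0≤i₁ = ind-nonneg (near? (Y.line 1F) q)
      0≤i₂ = ind-nonneg (near? (Y.line 2F) q)
      one-near : ∃[ j ] Near (Y.line j) q → 0≤ i₀ + (i₁ + i₂) - 1ℤ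
      one-near (0F , near) = subst 0≤_ (trans (solve 2 (λ b c → b :+ c := num 1 :+ (b :+ c) :- num 1) refl i₁ i₂)
        (cong (λ a → a + (i₁ + i₂) - 1ℤ) (sym (ind-yes (near? (Y.line 0F) q) near)))) (0≤-+ 0≤i₁ 0≤i₂)
      one-near (1F , near) = subst 0≤_ (trans (solve 2 (λ a c → a :+ c := a :+ (num 1 :+ c) :- num 1) refl i₀ i₂)
        (cong (λ b → i₀ + (b + i₂) - 1ℤ) (sym (ind-yes (near? (Y.line 1F) q) near)))) (0≤-+ 0≤i₀ 0≤i₂)
      one-near (2F , near) = subst 0≤_ (trans (solve 2 (λ a b → a :+ b := a :+ (b :+ num 1) :- num 1) refl i₀ i₁)
        (cong (λ c → i₀ + (i₁ + c) - 1ℤ) (sym (ind-yes (near? (Y.line 2F) q) near)))) (0≤-+ 0≤i₀ 0≤i₁)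

    covered : 0≤ size (chosen 0F) + (size (chosen 1F) + size (chosen 2F)) - X.Dᵢ i y
    covered = subst 0≤_ eq (Σˡ-nonneg (All.universal B-covered (X.line i)))
      where
      f : Fin 3 → Fin n → ℤ
      f j q = ind (near? (Y.line j) q)
      eq : Σˡ (λ q → f 0F q + (f 1F q + f 2F q) - B y q) (X.line i) ≡ size (chosen 0F) + (size (chosen 1F) + size (chosen 2F)) - X.Dᵢ i y
      eq = begin
        Σˡ (λ q → f 0F q + (f 1F q + f 2F q) - B y q) (X.line i)
          ≡⟨ Σˡ-cong (All.universal (λ q → solve 4 (λ a b c d → a :+ (b :+ c) :- d := con (- 1ℤ) :* d :+ (num 1 :* a :+ (num 1 :* b :+ c))) refl
          (f 0F q) (f 1F q) (f 2F q) (B y q)) (X.line i)) ⟩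
        Σˡ (λ q → - 1ℤ * B y q + (1ℤ * f 0F q + (1ℤ * f 1F q + f 2F q))) (X.line i)
          ≡⟨ Σˡ-linear (- 1ℤ) (B y) (λ q → 1ℤ * f 0F q + (1ℤ * f 1F q + f 2F q)) (X.line i) ⟩
        - 1ℤ * X.Dᵢ i y + Σˡ (λ q → 1ℤ * f 0F q + (1ℤ * f 1F q + f 2F q)) (X.line i)
          ≡⟨ cong (_+_ (- 1ℤ * X.Dᵢ i y)) (trans (Σˡ-linear 1ℤ (f 0F) (λ q → 1ℤ * f 1F q + f 2F q) (X.line i))
          (cong (_+_ (1ℤ * Σˡ (f 0F) (X.line i))) (Σˡ-linear 1ℤ (f 1F) (f 2F) (X.line i)))) ⟩
        - 1ℤ * X.Dᵢ i y + (1ℤ * Σˡ (f 0F) (X.line i) + (1ℤ * Σˡ (f 1F) (X.line i) + Σˡ (f 2F) (X.line i)))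
          ≡⟨ cong₂ (λ a b → - 1ℤ * X.Dᵢ i y + (1ℤ * a + b)) (sym (size-filter (near? (Y.line 0F)) (X.line i)))
          (cong₂ (λ a b → 1ℤ * a + b) (sym (size-filter (near? (Y.line 1F)) (X.line i))) (sym (size-filter (near? (Y.line 2F)) (X.line i)))) ⟩
        - 1ℤ * X.Dᵢ i y + (1ℤ * size (chosen 0F) + (1ℤ * size (chosen 1F) + size (chosen 2F)))
          ≡⟨ solve 4 (λ a b c d → con (- 1ℤ) :* d :+ (num 1 :* a :+ (num 1 :* b :+ c)) := a :+ (b :+ c) :- d) refl
          (size (chosen 0F)) (size (chosen 1F)) (size (chosen 2F)) (X.Dᵢ i y) ⟩
        size (chosen 0F) + (size (chosen 1F) + size (chosen 2F)) - X.Dᵢ i y ∎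
        where open ≡-Reasoning

    small-or-large : ∀ xs → 300 ≤ length {A = Fin n} xs ⊎ 0≤ + 299 - size xs
    small-or-large xs with ℕ.≤-<-connex 300 (length xs)
    ... | inj₁ le = inj₁ le
    ... | inj₂ (ℕ.s≤s lt) = inj₂ (ℤ.i≤j⇒0≤j-i (ℤ.+≤+ lt))

    some-large : ∃[ j ] (300 ≤ length (chosen j))
    some-large with small-or-large (chosen 0F) | small-or-large (chosen 1F) | small-or-large (chosen 2F)
    ... | inj₁ le | _ | _ = 0F , le
    ... | inj₂ _ | inj₁ le | _ = 1F , le
    ... | inj₂ _ | inj₂ _ | inj₁ le = 2F , le
    ... | inj₂ s₀ | inj₂ s₁ | inj₂ s₂ = ⊥-elim (absurd-nonneg 5
      (0≤-+ (0≤-+ (0≤-+ (0≤-+ covered (X.near-large i near-y)) s₀) s₁) s₂)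
      (solve 4 (λ a b c d → a :+ (b :+ c) :- d :+ (d :- num 903) :+ (num 299 :- a) :+ (num 299 :- b) :+ (num 299 :- c)
        := con ℤ.-[1+ 5 ]) refl (size (chosen 0F)) (size (chosen 1F)) (size (chosen 2F)) (X.Dᵢ i y)))

    agree : ∃[ j ] (∀ z → (Near (X.line i) z → Near (Y.line j) z) × (Near (Y.line j) z → Near (X.line i) z))
    agree = j , λ z →
      -- Nearness passes from the clique at `x` to 300 of its members, to 300 members of the clique
      -- at `y`, and on to that whole clique. Both samples are cut to 300 because `NearClique`
      -- compares equal sizes.
      (λ near → near-⊆⁻ z Sy⊆ (C.near⇐ z (near-⊆ z (clique (X.Q i)) (25≤size (X.Q i)) (25≤ Sx size-Sx) Sx⊆ near))) ,
      (λ near → near-⊆⁻ z Sx⊆ (C.near⇒ z (near-⊆ z (clique (Y.Q j)) (25≤size (Y.Q j)) (25≤ Sy size-Sy) Sy⊆ near)))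
      where
      j = proj₁ some-large
      Sx Sy : List (Fin n)
      Sx = take 300 (chosen j)
      Sy = take 300 (Y.line j)
      Sx⊆ : Sx ⊆ X.line i
      Sx⊆ = take-Sublist 300 (filter-Sublist (near? (Y.line j)) ⊆-refl)
      Sy⊆ : Sy ⊆ Y.line j
      Sy⊆ = take-Sublist 300 ⊆-refl
      size-Sx : size Sx ≡ + 300
      size-Sx = size-take (chosen j) (proj₂ some-large)
      size-Sy : size Sy ≡ + 300
      size-Sy = size-take (Y.line j) (subst (300 ≤_) (sym (order (Y.Q j))) (ℕ.m≤m+n 300 615))
      25≤ : ∀ xs → size xs ≡ + 300 → 0≤ size {A = Fin n} xs - + 25
      25≤ xs eq = subst (λ s → 0≤ s - + 25) (sym eq) (0≤+ 275)
      module C = NearClique Sy Sx (clique-⊆ Sy⊆ (clique (Y.Q j))) (clique-⊆ Sx⊆ (clique (X.Q i)))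
        (trans size-Sx (sym size-Sy)) (subst (λ s → 0≤ s - + 150) (sym size-Sy) (0≤+ 150))
        (All.map (λ {q} near → near-⊆ q (clique (Y.Q j)) (25≤size (Y.Q j)) (25≤ Sy size-Sy) Sy⊆ near)
          (All.take⁺ 300 (All.all-filter (near? (Y.line j)) (X.line i))))

  threeLines : ThreeLines _∼_
  threeLines = record
    { On = λ x i y → Near (Around.line x i) y
    ; on? = λ x i y → near? (Around.line x i) y
    ; on-self = λ x i → Around.near-self x i
    ; on-other = λ x i → Around.near-other x i
    ; on-adjacent = λ {x} {i} → Around.near⇒adjacent x {i}
    ; adjacent-on = λ {x} → Around.adjacent⇒near x
    ; on-unique = λ {x} {i} {j} → Around.near-unique x {i} {j}
    ; on-agree = λ {x} {i} {y} near → Agree.agree x i y near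
    }

-- The hypergraph of lines

∣⁅x⁆∪p∣ : ∀ {n} (x : Fin n) (p : Subset n) → x ∉ₛ p → ∣ ⁅ x ⁆ ∪ p ∣ ≡ suc ∣ p ∣
∣⁅x⁆∪p∣ zero (true ∷ p) x∉p = contradiction here x∉p
∣⁅x⁆∪p∣ zero (false ∷ p) x∉p = cong (λ q → suc ∣ q ∣) (∪-identityˡ p)
∣⁅x⁆∪p∣ (suc x) (true ∷ p) x∉p = cong suc (∣⁅x⁆∪p∣ x p (x∉p ∘ there))
∣⁅x⁆∪p∣ (suc x) (false ∷ p) x∉p = ∣⁅x⁆∪p∣ x p (x∉p ∘ there)

funToFin-cong : ∀ {m n} {f g : Fin m → Fin n} → (∀ i → f i ≡ g i) → Fin.funToFin f ≡ Fin.funToFin g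
funToFin-cong {zero} f≗g = refl
funToFin-cong {suc m} f≗g = cong₂ Fin.combine (f≗g zero) (funToFin-cong (f≗g ∘ suc))

module LinesToHypergraph (G : Graph)
  (threeLines : ThreeLines (λ i j → Graph._∼_ G (Inverse.from (Graph.enum G) i) (Inverse.from (Graph.enum G) j))) where

  open Graph G
  open ThreeLines threeLines
  open Inverse enum using (to; from; strictlyInverseˡ; strictlyInverseʳ)

  -- The points of the hypergraph are the sets of vertices, numbered; only
  -- those that are lines lie on an edge.
  code : Fin order → Fin 3 → Fin (2 ℕ.^ order)
  code x i = Fin.funToFin {order} {2} (λ y → if ⌊ on? x i y ⌋ then 1F else 0F)

  digit : ∀ {P : Set} → Dec P → Fin 2
  digit P? = if ⌊ P? ⌋ then 1F else 0F

  digit⇒ : ∀ {P Q : Set} (P? : Dec P) (Q? : Dec Q) → digit P? ≡ digit Q? → P → Q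
  digit⇒ _ (yes q) eq p = q
  digit⇒ (yes _) (no ¬q) ()
  digit⇒ (no ¬p) (no ¬q) eq p = contradiction p ¬p

  digit-cong : ∀ {P Q : Set} (P? : Dec P) (Q? : Dec Q) → (P → Q) → (Q → P) → digit P? ≡ digit Q?
  digit-cong (yes _) (yes _) f g = refl
  digit-cong (yes p) (no ¬q) f g = contradiction (f p) ¬q
  digit-cong (no ¬p) (yes q) f g = contradiction (g q) ¬p
  digit-cong (no _) (no _) f g = refl

  same-code : ∀ {x i y j} → code x i ≡ code y j → ∀ {z} → On x i z → On y j z
  same-code {x} {i} {y} {j} eq {z} = digit⇒ (on? x i z) (on? y j z) (trans (sym (Fin.finToFun-funToFin {order} {2} (digit ∘ on? x i) z))
    (trans (cong (λ k → Fin.finToFun {2} {order} k z) eq) (Fin.finToFun-funToFin {order} {2} (digit ∘ on? y j) z)))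

  agree⇒same-code : ∀ {x i y j} → (∀ z → (On x i z → On y j z) × (On y j z → On x i z)) → code x i ≡ code y j
  agree⇒same-code {x} {i} {y} {j} agree = funToFin-cong {order} {2} λ z →
    digit-cong (on? x i z) (on? y j z) (proj₁ (agree z)) (proj₂ (agree z))

  code-injective : ∀ {x i j} → i ≢ j → code x i ≢ code x j
  code-injective {x} {i} {j} i≢j eq =
    let y , y≢x , onᵢ = on-other x i in y≢x (on-unique i≢j onᵢ (same-code {x} {i} {x} {j} eq onᵢ))

  edge : Fin order → Subset (2 ℕ.^ order)
  edge x = ⁅ code x 0F ⁆ ∪ (⁅ code x 1F ⁆ ∪ ⁅ code x 2F ⁆)

  code∈edge : ∀ x i → code x i ∈ₛ edge x
  code∈edge x 0F = x∈p∪q⁺ (inj₁ (x∈⁅x⁆ (code x 0F)))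
  code∈edge x 1F = x∈p∪q⁺ {p = ⁅ code x 0F ⁆} (inj₂ (x∈p∪q⁺ (inj₁ (x∈⁅x⁆ (code x 1F)))))
  code∈edge x 2F = x∈p∪q⁺ {p = ⁅ code x 0F ⁆} (inj₂ (x∈p∪q⁺ {p = ⁅ code x 1F ⁆} (inj₂ (x∈⁅x⁆ (code x 2F)))))

  ∈edge⇒code : ∀ x {p} → p ∈ₛ edge x → ∃[ i ] p ≡ code x i
  ∈edge⇒code x p∈ with x∈p∪q⁻ ⁅ code x 0F ⁆ (⁅ code x 1F ⁆ ∪ ⁅ code x 2F ⁆) p∈
  ... | inj₁ p∈₀ = 0F , x∈⁅y⁆⇒x≡y (code x 0F) p∈₀
  ... | inj₂ p∈′ with x∈p∪q⁻ ⁅ code x 1F ⁆ ⁅ code x 2F ⁆ p∈′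
  ... | inj₁ p∈₁ = 1F , x∈⁅y⁆⇒x≡y (code x 1F) p∈₁
  ... | inj₂ p∈₂ = 2F , x∈⁅y⁆⇒x≡y (code x 2F) p∈₂

  ∣edge∣≡3 : ∀ x → ∣ edge x ∣ ≡ 3
  ∣edge∣≡3 x = trans (∣⁅x⁆∪p∣ (code x 0F) (⁅ code x 1F ⁆ ∪ ⁅ code x 2F ⁆) outside₀)
    (cong suc (trans (∣⁅x⁆∪p∣ (code x 1F) ⁅ code x 2F ⁆ (code-injective (λ ()) ∘ x∈⁅y⁆⇒x≡y (code x 2F)))
      (cong suc (∣⁅x⁆∣≡1 (code x 2F)))))
    where
    outside₀ : code x 0F ∉ₛ ⁅ code x 1F ⁆ ∪ ⁅ code x 2F ⁆
    outside₀ p∈ with x∈p∪q⁻ ⁅ code x 1F ⁆ ⁅ code x 2F ⁆ p∈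
    ... | inj₁ p∈₁ = code-injective (λ ()) (x∈⁅y⁆⇒x≡y (code x 1F) p∈₁)
    ... | inj₂ p∈₂ = code-injective (λ ()) (x∈⁅y⁆⇒x≡y (code x 2F) p∈₂)

  -- Since `y` lies on its own lines, the shared codes put it on two different lines through `x`.
  -- Both linearity and injectivity of `edge` rest on this.
  two-common-lines : ∀ {x y i j p q} → i ≢ j → p ≡ code x i → q ≡ code x j → p ∈ₛ edge y → q ∈ₛ edge y → y ≡ x
  two-common-lines {x} {y} {i} {j} i≢j refl refl p∈ q∈ =
    let k , p≡ = ∈edge⇒code y p∈
        l , q≡ = ∈edge⇒code y q∈
    in on-unique i≢j (same-code {y} {k} {x} {i} (sym p≡) (on-self y k)) (same-code {y} {l} {x} {j} (sym q≡) (on-self y l))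

  edge-injective : ∀ {x y} → edge x ≡ edge y → x ≡ y
  edge-injective {x} {y} eq = sym (two-common-lines {x} {y} {0F} {1F} (λ ()) refl refl
    (subst (code x 0F ∈ₛ_) eq (code∈edge x 0F)) (subst (code x 1F ∈ₛ_) eq (code∈edge x 1F)))

  H : Hypergraph
  H = record
    { size = 2 ℕ.^ order
    ; isEdge = λ e → ⌊ Fin.any? (λ x → edge x ≟ₛ e) ⌋
    ; nonempty = λ e t → let x , eq = toWitness {a? = Fin.any? (λ x → edge x ≟ₛ e)} t
          in code x 0F , subst (code x 0F ∈ₛ_) eq (code∈edge x 0F)
    }

  open Hypergraph H using (Edge; isEdge)

  label : Edge → Fin order
  label (e , t) = proj₁ (toWitness {a? = Fin.any? (λ x → edge x ≟ₛ e)} t)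

  edge-label : ∀ ε → edge (label ε) ≡ proj₁ ε
  edge-label (e , t) = proj₂ (toWitness {a? = Fin.any? (λ x → edge x ≟ₛ e)} t)

  toEdge : Fin order → Edge
  toEdge x = edge x , fromWitness {a? = Fin.any? (λ y → edge y ≟ₛ edge x)} (x , refl)

  Edge-≡ : ∀ {ε ε′ : Edge} → proj₁ ε ≡ proj₁ ε′ → ε ≡ ε′
  Edge-≡ {e , t} {.e , t′} refl = cong (e ,_) (Bool.T-irrelevant t t′)

  uniform : Uniform 3 H
  uniform ε = trans (cong ∣_∣ (sym (edge-label ε))) (∣edge∣≡3 (label ε))

  linear : Linear H
  linear p q p≢q ε ε′ p∈ q∈ p∈′ q∈′ = trans (sym (edge-label ε)) (trans (cong edge (sym same)) (edge-label ε′))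
    where
    x = label ε
    y = label ε′
    same : y ≡ x
    same = let i , p≡ = ∈edge⇒code x (subst (p ∈ₛ_) (sym (edge-label ε)) p∈)
               j , q≡ = ∈edge⇒code x (subst (q ∈ₛ_) (sym (edge-label ε)) q∈)
          in two-common-lines (λ i≡j → p≢q (trans p≡ (trans (cong (code x) i≡j) (sym q≡)))) p≡ q≡
          (subst (p ∈ₛ_) (sym (edge-label ε′)) p∈′) (subst (q ∈ₛ_) (sym (edge-label ε′)) q∈′)

  vertices↔edges : Vertex ↔ Edge
  vertices↔edges = mk↔ₛ′ (toEdge ∘ to) (from ∘ label)
    (λ ε → Edge-≡ (trans (cong edge (strictlyInverseˡ (label ε))) (edge-label ε)))
    (λ g → trans (cong from (edge-injective (edge-label (toEdge (to g))))) (strictlyInverseʳ g))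

  adjacent⇒meet : ∀ {x y} → from x ∼ from y → edge x ≢ edge y × Nonempty (edge x ∩ edge y)
  adjacent⇒meet {x} {y} x∼y =
    let i , onᵢ = adjacent-on x∼y
        j , agree = on-agree onᵢ
    in (λ eq → ∼-irrefl (cong from (edge-injective eq)) x∼y) ,
       code x i , x∈p∩q⁺ (code∈edge x i , subst (_∈ₛ edge y) (sym (agree⇒same-code {x} {i} {y} {j} agree)) (code∈edge y j))

  meet⇒adjacent : ∀ {x y} → edge x ≢ edge y × Nonempty (edge x ∩ edge y) → from x ∼ from y
  meet⇒adjacent {x} {y} (x≢y , p , p∈) =
    let p∈x , p∈y = x∈p∩q⁻ (edge x) (edge y) p∈
        i , p≡ = ∈edge⇒code x p∈x
        j , p≡′ = ∈edge⇒code y p∈y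
    in on-adjacent (λ y≡x → x≢y (cong edge (sym y≡x))) (same-code {y} {j} {x} {i} (trans (sym p≡′) p≡) (on-self y j))

  isomorphic : G ≅ intersectionGraph H
  isomorphic = vertices↔edges , λ g h → mk⇔
    (λ g∼h → adjacent⇒meet (subst₂ _∼_ (sym (strictlyInverseʳ g)) (sym (strictlyInverseʳ h)) g∼h))
    (λ meet → subst₂ _∼_ (strictlyInverseʳ g) (strictlyInverseʳ h) (meet⇒adjacent meet))

shiftedAdjacency : ∀ {v} G → JohnsonLike v (shifted G) → ShiftedAdjacency (shifted G)
shiftedAdjacency G johnsonLike = record
  { B-sym = shifted-sym G
  ; positive-semidefinite = JohnsonLike.positive-semidefinite johnsonLike
  ; B-diag = shifted-diag G
  ; _∼_ = λ i j → from i ∼ from j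
  ; _∼?_ = λ i j → from i ∼? from j
  ; ∼-sym = ∼-sym
  ; ∼-irrefl = λ { i∼j refl → ∼-irrefl refl i∼j }
  ; B-adjacent = λ {i} {j} i∼j → trans (shifted-off-diag G (λ { refl → ∼-irrefl refl i∼j })) (ind-yes (from i ∼? from j) i∼j)
  ; B-nonadjacent = λ {i} {j} i≢j i≁j → trans (shifted-off-diag G i≢j) (ind-no (from i ∼? from j) i≁j)
  }
  where
  open Graph G
  open Inverse enum using (from)

theorem1p7 : ∃[ v′ ] (0 < v′ ×
    (∀ (v : ℕ) → v′ ≤ v →
    ∀ (G : Graph) → Cospectral G (johnson₃ v) →
    ∃[ H ] (Uniform 3 H × Linear H × G ≅ intersectionGraph H)))
theorem1p7 = 26 ℕ.+ 4 ℕ.* R , ℕ.s≤s ℕ.z≤n , λ v v′≤v G cospectral →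
  let 7≤v = ℕ.≤-trans (ℕ.m≤m+n 7 (19 ℕ.+ 4 ℕ.* R)) v′≤v
      johnsonLike = CospectralToJohnson.johnsonLike v (v ℕ.∸ 7) (sym (ℕ.m+[n∸m]≡n 7≤v)) G cospectral
      open LinesToHypergraph G (Stars.threeLines (shiftedAdjacency G johnsonLike) v R (proj₂ (ramsey 915 10)) (large v v′≤v)
        (JohnsonLike.row-sum johnsonLike) (JohnsonLike.cube-diagonal johnsonLike))
  in H , uniform , linear , isomorphic
  where
  R : ℕ
  R = proj₁ (ramsey 915 10)

  large : ∀ v → 26 ℕ.+ 4 ℕ.* R ≤ v → 0≤ + v - + 26 - + 4 * + R
  large v le = subst 0≤_ (trans (cong (λ m → + v - (+ 26 + m)) (ℤ.pos-* 4 R))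
    (solve 2 (λ v r → v :- (num 26 :+ r) := v :- num 26 :- r) refl (+ v) (+ 4 * + R)))
    (ℤ.i≤j⇒0≤j-i (ℤ.+≤+ le))
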